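{- Let $p\ge5$ be a prime with Legendre symbol $\left(\frac{ -6}{p}\right)=-1$, and let $\alpha\ge0$, $n\ge0$ be integers. Then for every integer $i$ with $1\le i\le p-1$, $$\overline{S}_3\big(48p^{2\alpha+2}n+2(24i+5p)p^{2\alpha+1}\big)\equiv0\pmod{24}.$$
   Context: For $|q|<1$ and a positive integer $k$, write $f_k=\prod_{j\ge1}(1-q^{kj})$. The function $\overline{S}_3(n)$ (number of $3$-Schur overpartitions of $n$) is defined by $\sum_{n\ge0}\overline{S}_3(n)q^n=\prod_{n\ge1}\frac{(1+q^{2n-1})(1-q^{3(2n-1)})}{(1+q^{3(2n-1)})(1-q^{2n-1})}=\frac{f_2^3f_3^2f_{12}}{f_1^2f_4f_6^3}$. -}

module Defs where

open import Data.Nat as ℕ using (ℕ; zero; suc)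
open import Data.Integer as ℤ using (ℤ; +_; -_; _+_; _*_)
open import Data.Integer.Divisibility using (_∣_)
open import Data.List using (List; []; _∷_; upTo; map; foldr)
open import Data.Nat.DivMod using (_%_)
open import Relation.Binary.PropositionalEquality using (_≡_)
open import Relation.Nullary using (¬_)
open import Data.Product using (∃; _×_)
open import Data.Bool using (Bool; true; false; if_then_else_; _∨_)

Series : Set
Series = ℕ → ℤ

sumTo : ℕ → (ℕ → ℤ) → ℤ
sumTo zero    f = f 0
sumTo (suc n) f = sumTo n f + f (suc n)

_⊛_ : Series → Series → Series
(a ⊛ b) n = sumTo n (λ i → a i * b (n ℕ.∸ i))

one : Series
one zero    = + 1
one (suc _) = + 0

-- 1 + q^k   (k ≥ 1)
onePlus : ℕ → Series
onePlus k n = if (n ℕ.≡ᵇ 0) ∨ (n ℕ.≡ᵇ k) then + 1 else + 0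

-- 1 - q^k   (k ≥ 1)
oneMinus : ℕ → Series
oneMinus k n = if n ℕ.≡ᵇ 0 then + 1 else (if n ℕ.≡ᵇ k then - (+ 1) else + 0)

-- 1/(1 - q^k) = Σ_{i≥0} q^{k i}   (k ≥ 1)
invOneMinus : ℕ → Series
invOneMinus k n with n % suc (k ℕ.∸ 1)
... | zero  = + 1
... | suc _ = + 0

-- 1/(1 + q^k) = Σ_{i≥0} (-1)^i q^{k i}   (k ≥ 1)
invOnePlus : ℕ → Series
invOnePlus k n with n % suc (k ℕ.∸ 1)
... | suc _ = + 0
... | zero  = sign (n ℕ./ suc (k ℕ.∸ 1))
  where
  sign : ℕ → ℤ
  sign zero          = + 1
  sign (suc zero)    = - (+ 1)
  sign (suc (suc m)) = sign m

factor : ℕ → Series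
factor j = ((onePlus m ⊛ oneMinus (3 ℕ.* m)) ⊛ invOnePlus (3 ℕ.* m)) ⊛ invOneMinus m
  where m = 2 ℕ.* j ℕ.∸ 1

partialProd : ℕ → Series
partialProd zero    = one
partialProd (suc N) = partialProd N ⊛ factor (suc N)

-- Number of 3-Schur overpartitions: the coefficient of q^n in
-- ∏_{j≥1} factor j.  Factor j equals 1 + O(q^{2j-1}), so the
-- coefficient of q^n is already determined by the factors j ≤ n.
S3bar : ℕ → ℤ
S3bar n = partialProd n n

QuadRes : ℤ → ℕ → Set
QuadRes a p = ∃ λ (x : ℤ) → (+ p) ∣ (x * x ℤ.- a)

LegendreMinusOne : ℤ → ℕ → Set
LegendreMinusOne a p = ¬ ((+ p) ∣ a) × ¬ QuadRes a p

{-# OPTIONS --safe #-}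

-- In Ramanujan's notation let A = φ(-q²)/φ(-q) = ∏ (1+q^(2j-1))/(1-q^(2j-1)) and B = A(-q) = 1/A.
-- The generating function of S3bar is S = A(q)/A(q³), and the arguments N of the theorem are
-- ≡ 10 (mod 48).
--
-- Modulo 3, A(q³) ≡ A³ gives S ≡ B².  From φ(q) + φ(-q) = 2φ(q⁴) and φ(q)φ(-q) = φ(-q²)² one
-- gets A² + B² = 2A(q²)⁴.  Taking even and odd parts, the coefficient of S at 4k+2 is congruent
-- to that of 2Z at k, where Z² = 4A¹²Z(q²) ≡ 4A(q³)⁴Z(q²); this forces Z to be a series in q³
-- modulo 3, while k ≡ 2 (mod 3) here.
--
-- Modulo 8, S = φ(-q²)φ(-q³)/(φ(-q)φ(-q⁶)) with φ(-q) = 1 + 2τ.  Expanding, the coefficient of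
-- S at N can fail to vanish only if N is represented by one of six forms kx² + ly²; congruences
-- exclude all of them but x² + 6y², and that one is excluded because p divides N to an odd
-- power while -6 is a non-residue of p.

module Submission where

open import Defs
open import Data.Nat as ℕ using (ℕ; zero; suc; z≤n; s≤s; NonZero; _+_; _*_; _^_; _≤_; _∸_)
import Data.Nat.Properties as ℕ
import Data.Nat.Divisibility as ℕ
import Data.Nat.DivMod as ℕ
open import Data.Nat.Coprimality using (Coprime; coprime-Bézout)
open import Data.Nat.GCD using (module Bézout)
open import Data.Nat.Induction using (<-rec)
open import Data.Nat.Primality using (Prime; euclidsLemma; prime⇒irreducible; prime⇒nonZero)
open import Data.Nat.Tactic.RingSolver using () renaming (solve-∀ to ℕ-solve-∀)
open import Data.Integer as ℤ using (ℤ; +_; -_)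
import Data.Integer.Properties as ℤ
import Data.Integer.DivMod as ℤ
open import Data.Integer.Divisibility using (_∣_)
open import Data.Integer.Divisibility.Signed as ℤ using (divides; ∣⇒∣ᵤ) renaming (_∣_ to _∣ₛ_)
open import Data.Integer.Tactic.RingSolver using (solve-∀)
open import Algebra.Bundles using (CommutativeRing)
open import Algebra.Solver.Ring.AlmostCommutativeRing
  using (AlmostCommutativeRing; fromCommutativeRing; _-Raw-AlmostCommutative⟶_)
import Algebra.Solver.Ring
open import Data.Bool using (true; false; if_then_else_)
open import Data.Empty using (⊥)
open import Data.Fin as Fin using (Fin; toℕ)
import Data.Fin.Properties as Fin
open import Data.Maybe using (Maybe; nothing; just)
open import Data.Product using (_,_; _×_; proj₁; proj₂; ∃; ∃₂)
open import Data.Sum using (_⊎_; inj₁; inj₂; [_,_]′)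
open import Function using (id)
open import Relation.Binary using (IsEquivalence)
open import Relation.Binary.PropositionalEquality
  using (_≡_; _≢_; refl; sym; trans; cong; cong₂; subst; subst₂; module ≡-Reasoning)
import Relation.Binary.Reasoning.Setoid
open import Relation.Nullary using (Dec; yes; no; ¬_; contradiction; ¬?)
open import Relation.Nullary.Decidable using (from-yes; _⊎-dec_)

-- Formal power series

-- The two identities for φ are visible on different sides: φ(q) + φ(-q) = 2φ(q⁴) on the theta
-- series, φ(q)φ(-q) = φ(-q²)² on the product. Gauss's identity between the two therefore has to be
-- proved; this is done through a finite form whose error is invisible in each fixed coefficient.
-- The series Z comes from taking parts twice. The even part of A² is A⁴, and the odd part of A⁴ =
-- A²·A² is twice the product Z of the two parts of A². The relation for Z² then follows from AB =
-- 1. As Z has constant term 4, the coefficient of Zₙ in Z² is 8, a unit modulo 3, and this is what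
-- lets an induction run through Z². Modulo 8, the form x² + 6y² is the one that needs the Legendre
-- symbol: 10 = 2² + 6·1², so no congruence modulo 48 can exclude it. Division is avoided
-- throughout: a quotient is stated as a product, such as S · A(q³) = A, and a congruence modulo m
-- as an equality up to an explicit multiple `κ m · h`.

sumTo-cong : ∀ n {f g} → (∀ i → i ℕ.≤ n → f i ≡ g i) → sumTo n f ≡ sumTo n g
sumTo-cong zero    e = e 0 z≤n
sumTo-cong (suc n) e = cong₂ ℤ._+_
  (sumTo-cong n (λ i i≤n → e i (ℕ.m≤n⇒m≤1+n i≤n))) (e (suc n) ℕ.≤-refl)

sumTo-+ : ∀ n f g → sumTo n (λ i → f i ℤ.+ g i) ≡ sumTo n f ℤ.+ sumTo n g
sumTo-+ zero    f g = refl
sumTo-+ (suc n) f g rewrite sumTo-+ n f g = interchange (sumTo n f) (sumTo n g) (f (suc n)) (g (suc n))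
  where
  interchange : ∀ a b c d → (a ℤ.+ b) ℤ.+ (c ℤ.+ d) ≡ (a ℤ.+ c) ℤ.+ (b ℤ.+ d)
  interchange = solve-∀

sumTo-* : ∀ n c f → sumTo n (λ i → c ℤ.* f i) ≡ c ℤ.* sumTo n f
sumTo-* zero    c f = refl
sumTo-* (suc n) c f rewrite sumTo-* n c f = sym (ℤ.*-distribˡ-+ c _ _)

sumTo-0 : ∀ n {f} → (∀ i → i ℕ.≤ n → f i ≡ + 0) → sumTo n f ≡ + 0
sumTo-0 zero    e = e 0 z≤n
sumTo-0 (suc n) e = cong₂ ℤ._+_
  (sumTo-0 n (λ i i≤n → e i (ℕ.m≤n⇒m≤1+n i≤n))) (e (suc n) ℕ.≤-refl)

tail : Series → Series
tail f n = f (suc n)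

sumTo-front : ∀ n f → sumTo (suc n) f ≡ f 0 ℤ.+ sumTo n (tail f)
sumTo-front zero    f = refl
sumTo-front (suc n) f rewrite sumTo-front n f = ℤ.+-assoc (f 0) _ _

⊛-head : ∀ f g n → (f ⊛ g) (suc n) ≡ f 0 ℤ.* g (suc n) ℤ.+ (tail f ⊛ g) n
⊛-head f g n = sumTo-front n _

⊛-last : ∀ f g n → (f ⊛ g) (suc n) ≡ (f ⊛ tail g) n ℤ.+ f (suc n) ℤ.* g 0
⊛-last f g n = cong₂ ℤ._+_
  (sumTo-cong n (λ i i≤n → cong (λ k → f i ℤ.* g k) (ℕ.+-∸-assoc 1 i≤n)))
  (cong (λ k → f (suc n) ℤ.* g k) (ℕ.n∸n≡0 n))

⊛-cong≤ : ∀ n {f f′ g g′} → (∀ i → i ℕ.≤ n → f i ≡ f′ i) → (∀ i → i ℕ.≤ n → g i ≡ g′ i) →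
  (f ⊛ g) n ≡ (f′ ⊛ g′) n
⊛-cong≤ n f≡ g≡ = sumTo-cong n (λ i i≤n → cong₂ ℤ._*_ (f≡ i i≤n) (g≡ _ (ℕ.m∸n≤m n i)))

⊛-comm-at : ∀ n f g → (f ⊛ g) n ≡ (g ⊛ f) n
⊛-comm-at zero    f g = ℤ.*-comm (f 0) (g 0)
⊛-comm-at (suc n) f g = begin
  (f ⊛ g) (suc n)                              ≡⟨ ⊛-head f g n ⟩
  f 0 ℤ.* g (suc n) ℤ.+ (tail f ⊛ g) n           ≡⟨ cong₂ ℤ._+_ (ℤ.*-comm (f 0) _) (⊛-comm-at n (tail f) g) ⟩
  g (suc n) ℤ.* f 0 ℤ.+ (g ⊛ tail f) n           ≡⟨ ℤ.+-comm (g (suc n) ℤ.* f 0) _ ⟩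
  (g ⊛ tail f) n ℤ.+ g (suc n) ℤ.* f 0           ≡⟨ ⊛-last g f n ⟨
  (g ⊛ f) (suc n)                              ∎
  where open ≡-Reasoning

⊛-distribʳ-at : ∀ n h f g → ((λ i → f i ℤ.+ g i) ⊛ h) n ≡ (f ⊛ h) n ℤ.+ (g ⊛ h) n
⊛-distribʳ-at n h f g = trans
  (sumTo-cong n (λ i _ → ℤ.*-distribʳ-+ (h (n ℕ.∸ i)) (f i) (g i)))
  (sumTo-+ n _ _)

⊛-scale-at : ∀ n c f g → ((λ i → c ℤ.* f i) ⊛ g) n ≡ c ℤ.* (f ⊛ g) n
⊛-scale-at n c f g = trans
  (sumTo-cong n (λ i _ → ℤ.*-assoc c (f i) _)) (sumTo-* n c _)

⊛-assoc-at : ∀ n f g h → ((f ⊛ g) ⊛ h) n ≡ (f ⊛ (g ⊛ h)) n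
⊛-assoc-at zero    f g h = ℤ.*-assoc (f 0) (g 0) (h 0)
⊛-assoc-at (suc n) f g h = begin
  ((f ⊛ g) ⊛ h) (suc n)
    ≡⟨ ⊛-head (f ⊛ g) h n ⟩
  f 0 ℤ.* g 0 ℤ.* h (suc n) ℤ.+ (tail (f ⊛ g) ⊛ h) n
    ≡⟨ cong (λ z → f 0 ℤ.* g 0 ℤ.* h (suc n) ℤ.+ z)
         (⊛-cong≤ n {g = h} (λ i _ → ⊛-head f g i) (λ _ _ → refl)) ⟩
  f 0 ℤ.* g 0 ℤ.* h (suc n) ℤ.+ ((λ i → f 0 ℤ.* tail g i ℤ.+ (tail f ⊛ g) i) ⊛ h) n
    ≡⟨ cong (λ z → f 0 ℤ.* g 0 ℤ.* h (suc n) ℤ.+ z) (⊛-distribʳ-at n h (λ i → f 0 ℤ.* tail g i) (tail f ⊛ g)) ⟩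
  f 0 ℤ.* g 0 ℤ.* h (suc n) ℤ.+ (((λ i → f 0 ℤ.* tail g i) ⊛ h) n ℤ.+ ((tail f ⊛ g) ⊛ h) n)
    ≡⟨ cong (λ z → f 0 ℤ.* g 0 ℤ.* h (suc n) ℤ.+ z)
         (cong₂ ℤ._+_ (⊛-scale-at n (f 0) (tail g) h) (⊛-assoc-at n (tail f) g h)) ⟩
  f 0 ℤ.* g 0 ℤ.* h (suc n) ℤ.+ (f 0 ℤ.* (tail g ⊛ h) n ℤ.+ (tail f ⊛ (g ⊛ h)) n)
    ≡⟨ regroup (f 0) (g 0) (h (suc n)) _ _ ⟩
  f 0 ℤ.* (g 0 ℤ.* h (suc n) ℤ.+ (tail g ⊛ h) n) ℤ.+ (tail f ⊛ (g ⊛ h)) n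
    ≡⟨ cong (λ z → f 0 ℤ.* z ℤ.+ (tail f ⊛ (g ⊛ h)) n) (⊛-head g h n) ⟨
  f 0 ℤ.* (g ⊛ h) (suc n) ℤ.+ (tail f ⊛ (g ⊛ h)) n
    ≡⟨ ⊛-head f (g ⊛ h) n ⟨
  (f ⊛ (g ⊛ h)) (suc n) ∎
  where
  open ≡-Reasoning
  regroup : ∀ a b c d e → a ℤ.* b ℤ.* c ℤ.+ (a ℤ.* d ℤ.+ e) ≡ a ℤ.* (b ℤ.* c ℤ.+ d) ℤ.+ e
  regroup = solve-∀

infix  4 _≈_
infixl 6 _⊕_
infixl 7 _·_
infix  8 ⊖_
infix 25 #_

-- Without η, a product f · g is not unfolded when series are compared, which lets Agda infer f and g.
record ℤ⟦q⟧ : Set where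
  no-eta-equality
  constructor series
  infixl 20 _[_]
  field _[_] : Series
open ℤ⟦q⟧

record _≈_ (f g : ℤ⟦q⟧) : Set where
  constructor coeffwise
  field at : ∀ n → f [ n ] ≡ g [ n ]
open _≈_

_⊕_ _·_ : ℤ⟦q⟧ → ℤ⟦q⟧ → ℤ⟦q⟧
(f ⊕ g) [ n ] = f [ n ] ℤ.+ g [ n ]
(f · g) [ n ] = ((f [_]) ⊛ (g [_])) n

⊖_ : ℤ⟦q⟧ → ℤ⟦q⟧
(⊖ f) [ n ] = - f [ n ]

κ : ℤ → ℤ⟦q⟧
κ c [ zero ]  = c
κ c [ suc _ ] = + 0

#_ : ℕ → ℤ⟦q⟧
# n = κ (+ n)

tl : ℤ⟦q⟧ → ℤ⟦q⟧
tl f [ n ] = f [ suc n ]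

·-head : ∀ f g n → (f · g) [ suc n ] ≡ f [ 0 ] ℤ.* g [ suc n ] ℤ.+ (tl f · g) [ n ]
·-head f g n = ⊛-head (f [_]) (g [_]) n

-- This is how limits are handled: for the coefficient of q^n, a series may be replaced by any other
-- that agrees with it up to q^n, such as a partial product.
·-local : ∀ n f f′ g g′ → (∀ i → i ℕ.≤ n → f [ i ] ≡ f′ [ i ]) →
  (∀ i → i ℕ.≤ n → g [ i ] ≡ g′ [ i ]) → (f · g) [ n ] ≡ (f′ · g′) [ n ]
·-local n f f′ g g′ = ⊛-cong≤ n {f [_]} {f′ [_]} {g [_]} {g′ [_]}

κ·-at : ∀ n c g → (κ c · g) [ n ] ≡ c ℤ.* g [ n ]
κ·-at zero    c g = refl
κ·-at (suc n) c g = trans (·-head (κ c) g n)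
  (trans (cong (λ z → c ℤ.* g [ suc n ] ℤ.+ z) (sumTo-0 n (λ _ _ → refl))) (ℤ.+-identityʳ _))

·-identityˡ : ∀ f → # 1 · f ≈ f
·-identityˡ f .at n = trans (κ·-at n (+ 1) f) (ℤ.*-identityˡ (f [ n ]))

≈-isEquivalence : IsEquivalence _≈_
≈-isEquivalence = record
  { refl  = coeffwise (λ _ → refl)
  ; sym   = λ e → coeffwise (λ n → sym (at e n))
  ; trans = λ e e′ → coeffwise (λ n → trans (at e n) (at e′ n))
  }

·-comm : ∀ f g → f · g ≈ g · f
·-comm f g .at n = ⊛-comm-at n (f [_]) (g [_])

·-cong : ∀ {f f′ g g′} → f ≈ f′ → g ≈ g′ → f · g ≈ f′ · g′
·-cong {f} {f′} {g} {g′} e e′ .at n = ·-local n f f′ g g′ (λ i _ → at e i) (λ i _ → at e′ i)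

·-distribʳ : ∀ h f g → (f ⊕ g) · h ≈ f · h ⊕ g · h
·-distribʳ h f g .at n = ⊛-distribʳ-at n (h [_]) (f [_]) (g [_])

#0-at : ∀ n → # 0 [ n ] ≡ + 0
#0-at zero    = refl
#0-at (suc n) = refl

ℤ⟦q⟧-commutativeRing : CommutativeRing _ _
ℤ⟦q⟧-commutativeRing = record
  { Carrier = ℤ⟦q⟧
  ; _≈_ = _≈_
  ; _+_ = _⊕_
  ; _*_ = _·_
  ; -_ = ⊖_
  ; 0# = # 0
  ; 1# = # 1
  ; isCommutativeRing = record
    { isRing = record
      { +-isAbelianGroup = record
        { isGroup = record
          { isMonoid = record
            { isSemigroup = record
              { isMagma = record
                { isEquivalence = ≈-isEquivalence
                ; ∙-cong = λ e e′ → coeffwise (λ n → cong₂ ℤ._+_ (at e n) (at e′ n))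
                }
              ; assoc = λ f g h → coeffwise (λ n → ℤ.+-assoc (f [ n ]) (g [ n ]) (h [ n ]))
              }
            ; identity =
                (λ f → coeffwise (λ n → trans (cong (λ z → z ℤ.+ f [ n ]) (#0-at n)) (ℤ.+-identityˡ (f [ n ]))))
              , (λ f → coeffwise (λ n → trans (cong (λ z → f [ n ] ℤ.+ z) (#0-at n)) (ℤ.+-identityʳ (f [ n ]))))
            }
          ; inverse = (λ f → coeffwise (λ n → trans (ℤ.+-inverseˡ (f [ n ])) (sym (#0-at n))))
                    , (λ f → coeffwise (λ n → trans (ℤ.+-inverseʳ (f [ n ])) (sym (#0-at n))))
          ; ⁻¹-cong = λ e → coeffwise (λ n → cong -_ (at e n))
          }
        ; comm = λ f g → coeffwise (λ n → ℤ.+-comm (f [ n ]) (g [ n ]))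
        }
      ; *-cong = ·-cong
      ; *-assoc = λ f g h → coeffwise (λ n → ⊛-assoc-at n (f [_]) (g [_]) (h [_]))
      ; *-identity = ·-identityˡ
                   , (λ f → coeffwise (λ n → trans (at (·-comm f (# 1)) n) (at (·-identityˡ f) n)))
      ; distrib = (λ h f g → coeffwise (λ n → trans (at (·-comm h (f ⊕ g)) n)
                    (trans (at (·-distribʳ h f g) n)
                      (cong₂ ℤ._+_ (at (·-comm f h) n) (at (·-comm g h) n)))))
                , ·-distribʳ
      }
    ; *-comm = ·-comm
    }
  }

open CommutativeRing ℤ⟦q⟧-commutativeRing
  using (setoid)
  renaming (refl to ≈-refl; sym to ≈-sym; trans to ≈-trans; +-cong to ⊕-cong; -‿cong to ⊖-cong)

module ≈-Reasoning = Relation.Binary.Reasoning.Setoid setoid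

ℤ⟦q⟧-almostCommutativeRing : AlmostCommutativeRing _ _
ℤ⟦q⟧-almostCommutativeRing = fromCommutativeRing ℤ⟦q⟧-commutativeRing

-- Makes ℤ the coefficient ring of the solver, so that numerals in an identity are combined by
-- integer arithmetic.
κ-morphism : ℤ.+-*-rawRing -Raw-AlmostCommutative⟶ ℤ⟦q⟧-almostCommutativeRing
κ-morphism = record
  { ⟦_⟧ = κ
  ; +-homo = λ a b → coeffwise λ { zero → refl ; (suc n) → refl }
  ; *-homo = λ a b → coeffwise λ { zero → refl
                                 ; (suc n) → sym (trans (κ·-at (suc n) a (κ b)) (ℤ.*-zeroʳ a)) }
  ; -‿homo = λ a → coeffwise λ { zero → refl ; (suc n) → refl }
  ; 0-homo = ≈-refl
  ; 1-homo = ≈-refl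
  }

κ≟ : ∀ a b → Maybe (κ a ≈ κ b)
κ≟ a b with a ℤ.≟ b
... | yes refl = just ≈-refl
... | no _     = nothing

open Algebra.Solver.Ring ℤ.+-*-rawRing ℤ⟦q⟧-almostCommutativeRing κ-morphism κ≟
  using (solve; _:=_; con; _:+_; _:*_; :-_; _:-_; _:^_)

sh : ℤ⟦q⟧ → ℤ⟦q⟧
sh f [ zero ]  = + 0
sh f [ suc n ] = f [ n ]

q^_ : ℕ → ℤ⟦q⟧
q^ zero  = # 1
q^ suc k = sh (q^ k)

infix 25 q^_

sh-· : ∀ f g → sh f · g ≈ sh (f · g)
sh-· f g .at zero    = ℤ.*-zeroˡ (g [ 0 ])
sh-· f g .at (suc n) = trans (·-head (sh f) g n) (trans
  (cong (λ z → z ℤ.+ ((f [_]) ⊛ (g [_])) n) (ℤ.*-zeroˡ (g [ suc n ]))) (ℤ.+-identityˡ _))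

sh-cong : ∀ {f g} → f ≈ g → sh f ≈ sh g
sh-cong e .at zero    = refl
sh-cong e .at (suc n) = at e n

q· : ∀ f → q^ 1 · f ≈ sh f
q· f = ≈-trans (sh-· (# 1) f) (sh-cong (·-identityˡ f))

q^-+ : ∀ j k → q^ (j ℕ.+ k) ≈ q^ j · q^ k
q^-+ zero    k = ≈-sym (·-identityˡ _)
q^-+ (suc j) k = ≈-trans (sh-cong (q^-+ j k)) (≈-sym (sh-· (q^ j) (q^ k)))

q^·-shift : ∀ k f n → (q^ k · f) [ k ℕ.+ n ] ≡ f [ n ]
q^·-shift zero    f n = at (·-identityˡ f) n
q^·-shift (suc k) f n = trans (at (sh-· (q^ k) f) (suc k ℕ.+ n)) (q^·-shift k f n)

q^·-low : ∀ k f n → n ℕ.< k → (q^ k · f) [ n ] ≡ + 0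
q^·-low (suc k) f zero    _         = at (sh-· (q^ k) f) 0
q^·-low (suc k) f (suc n) (s≤s n<k) = trans (at (sh-· (q^ k) f) (suc n)) (q^·-low k f n n<k)

expand : ∀ f → f ≈ κ (f [ 0 ]) ⊕ q^ 1 · tl f
expand f .at n = trans (lemma n) (cong (λ z → κ (f [ 0 ]) [ n ] ℤ.+ z) (sym (at (q· (tl f)) n)))
  where
  lemma : ∀ n → f [ n ] ≡ κ (f [ 0 ]) [ n ] ℤ.+ sh (tl f) [ n ]
  lemma zero    = sym (ℤ.+-identityʳ (f [ 0 ]))
  lemma (suc n) = sym (ℤ.+-identityˡ _)

·-suc : ∀ u → u [ 0 ] ≡ + 0 → ∀ f n → (u · f) [ suc n ] ≡ (tl u · f) [ n ]
·-suc u u0 f n = trans (·-head u f n)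
  (trans (cong (λ z → z ℤ.* f [ suc n ] ℤ.+ (tl u · f) [ n ]) u0)
  (trans (cong (λ z → z ℤ.+ (tl u · f) [ n ]) (ℤ.*-zeroˡ (f [ suc n ]))) (ℤ.+-identityˡ _)))

-- Substitutions q ↦ u(q)

-- The laws of substitution are proved by showing that both sides solve the same recursion.
unique-solution : {I : Set} (u : ℤ⟦q⟧) → u [ 0 ] ≡ + 0 →
  (next : I → I) (r x y : I → ℤ⟦q⟧) →
  (∀ i → x i ≈ r i ⊕ u · x (next i)) → (∀ i → y i ≈ r i ⊕ u · y (next i)) →
  ∀ i → x i ≈ y i
unique-solution {I} u u0 next r x y ex ey i .at n = <-rec P step n i
  where
  P : ℕ → Set
  P n = ∀ i → x i [ n ] ≡ y i [ n ]
  u· : ∀ n → (∀ {m} → m ℕ.< n → P m) → ∀ i → (u · x i) [ n ] ≡ (u · y i) [ n ]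
  u· zero    ih i = trans (cong (λ z → z ℤ.* x i [ 0 ]) u0) (trans (ℤ.*-zeroˡ (x i [ 0 ]))
    (sym (trans (cong (λ z → z ℤ.* y i [ 0 ]) u0) (ℤ.*-zeroˡ (y i [ 0 ])))))
  u· (suc n) ih i = trans (·-suc u u0 (x i) n)
    (trans (·-local n (tl u) (tl u) (x i) (y i) (λ _ _ → refl) (λ m m≤n → ih (s≤s m≤n) i)) (sym (·-suc u u0 (y i) n)))
  step : ∀ n → (∀ {m} → m ℕ.< n → P m) → P n
  step n ih i = trans (at (ex i) n)
    (trans (cong (λ z → r i [ n ] ℤ.+ z) (u· n ih (next i))) (sym (at (ey i) n)))

-- Characterises f ↦ f(u) by the Horner recursion f(u) = f(0) + u · (tl f)(u). Since u has no
-- constant term, the coefficient of q^n in u · g depends only on lower coefficients of g, so the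
-- recursion has a single solution. All laws are derived from it once, for `sub`, `neg` and their
-- composites alike.
record IsSubstitution (u : ℤ⟦q⟧) (σ : ℤ⟦q⟧ → ℤ⟦q⟧) : Set where
  field
    const-u : u [ 0 ] ≡ + 0
    unfold  : ∀ f → σ f ≈ κ (f [ 0 ]) ⊕ u · σ (tl f)

  head : ∀ f → σ f [ 0 ] ≡ f [ 0 ]
  head f = trans (at (unfold f) 0) (trans
    (cong (λ z → f [ 0 ] ℤ.+ z ℤ.* σ (tl f) [ 0 ]) const-u)
    (trans (cong (λ z → f [ 0 ] ℤ.+ z) (ℤ.*-zeroˡ (σ (tl f) [ 0 ]))) (ℤ.+-identityʳ _)))

  σ-cong : ∀ {f g} → f ≈ g → σ f ≈ σ g
  σ-cong {f} {g} e = unique-solution {I = ∃ λ ((f , g) : ℤ⟦q⟧ × ℤ⟦q⟧) → f ≈ g} u const-u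
    (λ ((f , g) , e) → (tl f , tl g) , coeffwise (λ n → at e (suc n)))
    (λ ((f , g) , e) → κ (f [ 0 ])) (λ i → σ (proj₁ (proj₁ i))) (λ i → σ (proj₂ (proj₁ i)))
    (λ ((f , g) , e) → unfold f)
    (λ ((f , g) , e) → subst (λ c → σ g ≈ κ c ⊕ u · σ (tl g)) (sym (at e 0)) (unfold g))
    ((f , g) , e)

  σ-local : ∀ n f g → (∀ i → i ℕ.≤ n → f [ i ] ≡ g [ i ]) → ∀ i → i ℕ.≤ n → σ f [ i ] ≡ σ g [ i ]
  σ-local n       f g e zero    _         = trans (head f) (trans (e 0 z≤n) (sym (head g)))
  σ-local (suc n) f g e (suc i) (s≤s i≤n) = trans (suc-at f) (trans
    (·-local i (tl u) (tl u) (σ (tl f)) (σ (tl g)) (λ _ _ → refl)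
      (λ j j≤i → σ-local n (tl f) (tl g) (λ k k≤n → e (suc k) (s≤s k≤n)) j (ℕ.≤-trans j≤i i≤n)))
    (sym (suc-at g)))
    where
    suc-at : ∀ f → σ f [ suc i ] ≡ (tl u · σ (tl f)) [ i ]
    suc-at f = trans (at (unfold f) (suc i)) (trans (ℤ.+-identityˡ _)
      (·-suc u const-u (σ (tl f)) i))

  σ-κ : ∀ c → σ (κ c) ≈ κ c
  σ-κ c = ≈-trans (unfold (κ c)) (≈-trans
    (⊕-cong ≈-refl (·-cong ≈-refl (≈-trans (σ-cong (coeffwise λ _ → refl)) σ-zero)))
    (solve 2 (λ k u → k :+ u :* con (+ 0) := k) ≈-refl (κ c) u))
    where
    -- Zero without a case split on the index, so that its tail agrees with it by `refl`.
    0s : ℤ⟦q⟧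
    0s [ n ] = + 0
    σ-zero : σ 0s ≈ # 0
    σ-zero = unique-solution {I = ℤ⟦q⟧} u const-u (λ f → f) (λ _ → # 0)
      (λ _ → σ 0s) (λ _ → # 0) (λ _ → ≈-trans (unfold 0s)
        (⊕-cong ≈-refl (·-cong ≈-refl (σ-cong (coeffwise (λ _ → refl))))))
      (λ _ → solve 1 (λ u → con (+ 0) := con (+ 0) :+ u :* con (+ 0)) ≈-refl u) (# 0)

  σ-⊕ : ∀ f g → σ (f ⊕ g) ≈ σ f ⊕ σ g
  σ-⊕ f g = unique-solution {I = ℤ⟦q⟧ × ℤ⟦q⟧} u const-u
    (λ (f , g) → tl f , tl g) (λ (f , g) → κ (f [ 0 ]) ⊕ κ (g [ 0 ]))
    (λ (f , g) → σ (f ⊕ g)) (λ (f , g) → σ f ⊕ σ g)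
    (λ (f , g) → ≈-trans (unfold (f ⊕ g))
      (⊕-cong (coeffwise λ { zero → refl ; (suc n) → refl })
        (·-cong ≈-refl (σ-cong (coeffwise (λ _ → refl))))))
    (λ (f , g) → ≈-trans (⊕-cong (unfold f) (unfold g))
      (solve 5 (λ a b u x y → (a :+ u :* x) :+ (b :+ u :* y) := (a :+ b) :+ u :* (x :+ y)) ≈-refl
        (κ (f [ 0 ])) (κ (g [ 0 ])) u (σ (tl f)) (σ (tl g))))
    (f , g)

  σ-scale : ∀ c g → σ (κ c · g) ≈ κ c · σ g
  σ-scale c g = unique-solution {I = ℤ⟦q⟧} u const-u
    tl (λ g → κ c · κ (g [ 0 ])) (λ g → σ (κ c · g)) (λ g → κ c · σ g)
    (λ g → ≈-trans (unfold (κ c · g)) (⊕-cong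
      (coeffwise λ { zero → refl
                   ; (suc n) → sym (trans (κ·-at (suc n) c (κ (g [ 0 ]))) (ℤ.*-zeroʳ c)) })
      (·-cong ≈-refl (σ-cong (coeffwise λ n →
        trans (κ·-at (suc n) c g) (sym (κ·-at n c (tl g))))))))
    (λ g → ≈-trans (·-cong ≈-refl (unfold g))
      (solve 4 (λ c a u x → c :* (a :+ u :* x) := c :* a :+ u :* (c :* x)) ≈-refl
        (κ c) (κ (g [ 0 ])) u (σ (tl g))))
    g

  -- With g fixed, both sides obey the same recursion in f, with inhomogeneous term f(0) · σ g.
  σ-· : ∀ f g → σ (f · g) ≈ σ f · σ g
  σ-· f g = unique-solution {I = ℤ⟦q⟧} u const-u
    tl (λ f → κ (f [ 0 ]) · σ g) (λ f → σ (f · g)) (λ f → σ f · σ g)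
    (λ f → begin
      σ (f · g)
        ≈⟨ σ-cong (≈-trans (·-cong (expand f) ≈-refl) (·-distribʳ g _ _)) ⟩
      σ (κ (f [ 0 ]) · g ⊕ (q^ 1 · tl f) · g)
        ≈⟨ σ-⊕ _ _ ⟩
      σ (κ (f [ 0 ]) · g) ⊕ σ ((q^ 1 · tl f) · g)
        ≈⟨ ⊕-cong (σ-scale (f [ 0 ]) g) (σ-cong (≈-trans
             (solve 3 (λ q f g → (q :* f) :* g := q :* (f :* g)) ≈-refl (q^ 1) (tl f) g)
             (q· (tl f · g)))) ⟩
      κ (f [ 0 ]) · σ g ⊕ σ (sh (tl f · g))
        ≈⟨ ⊕-cong ≈-refl (≈-trans (unfold (sh (tl f · g)))
             (⊕-cong ≈-refl (·-cong ≈-refl (σ-cong (coeffwise (λ _ → refl)))))) ⟩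
      κ (f [ 0 ]) · σ g ⊕ (# 0 ⊕ u · σ (tl f · g))
        ≈⟨ solve 2 (λ a b → a :+ (con (+ 0) :+ b) := a :+ b) ≈-refl
             (κ (f [ 0 ]) · σ g) (u · σ (tl f · g)) ⟩
      κ (f [ 0 ]) · σ g ⊕ u · σ (tl f · g) ∎)
    (λ f → ≈-trans (·-cong (unfold f) ≈-refl)
      (solve 4 (λ a u x g → (a :+ u :* x) :* g := a :* g :+ u :* (x :* g)) ≈-refl
        (κ (f [ 0 ])) u (σ (tl f)) (σ g)))
    f
    where open ≈-Reasoning

  σ-⊖ : ∀ f → σ (⊖ f) ≈ ⊖ σ f
  σ-⊖ f = begin
    σ (⊖ f)             ≈⟨ σ-cong (solve 1 (λ f → :- f := con (- (+ 1)) :* f) ≈-refl f) ⟩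
    σ (κ (- (+ 1)) · f) ≈⟨ σ-scale (- (+ 1)) f ⟩
    κ (- (+ 1)) · σ f   ≈⟨ solve 1 (λ f → con (- (+ 1)) :* f := :- f) ≈-refl (σ f) ⟩
    ⊖ σ f               ∎
    where open ≈-Reasoning

  σ-q : σ (q^ 1) ≈ u
  σ-q = ≈-trans (unfold (q^ 1)) (≈-trans (⊕-cong ≈-refl (·-cong ≈-refl
      (≈-trans (σ-cong (coeffwise (λ _ → refl))) (σ-κ (+ 1)))))
    (solve 1 (λ u → con (+ 0) :+ u :* con (+ 1) := u) ≈-refl u))

  σ-q^suc : ∀ k → σ (q^ suc k) ≈ u · σ (q^ k)
  σ-q^suc k = ≈-trans (σ-cong (≈-sym (q· (q^ k))))
    (≈-trans (σ-· (q^ 1) (q^ k)) (·-cong σ-q ≈-refl))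

open IsSubstitution

∘-isSubstitution : ∀ {u v σ τ} → IsSubstitution u σ → IsSubstitution v τ →
  IsSubstitution (σ v) (λ f → σ (τ f))
∘-isSubstitution {u} {v} {σ} {τ} S T .const-u = trans (head S v) (const-u T)
∘-isSubstitution {u} {v} {σ} {τ} S T .unfold f = begin
  σ (τ f)                              ≈⟨ σ-cong S (unfold T f) ⟩
  σ (κ (f [ 0 ]) ⊕ v · τ (tl f))           ≈⟨ σ-⊕ S _ _ ⟩
  σ (κ (f [ 0 ])) ⊕ σ (v · τ (tl f))       ≈⟨ ⊕-cong (σ-κ S (f [ 0 ])) (σ-· S v (τ (tl f))) ⟩
  κ (f [ 0 ]) ⊕ σ v · σ (τ (tl f))         ∎
  where open ≈-Reasoning

-- Reduces an identity between composite substitutions to comparing the images of q.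
substitution-unique : ∀ {u v σ τ} → IsSubstitution u σ → IsSubstitution v τ → u ≈ v →
  ∀ f → σ f ≈ τ f
substitution-unique {u} {σ = σ} {τ} S T u≈v = unique-solution u (const-u S) tl
  (λ f → κ (f [ 0 ])) σ τ (unfold S)
  (λ f → ≈-trans (unfold T f) (⊕-cong ≈-refl (·-cong (≈-sym u≈v) ≈-refl)))

-- spread c r f is q^r f(q^(c+1)).
spread : ℕ → ℕ → ℤ⟦q⟧ → ℤ⟦q⟧
spread c zero    f [ zero ]  = f [ 0 ]
spread c zero    f [ suc n ] = spread c c (tl f) [ n ]
spread c (suc r) f [ zero ]  = + 0
spread c (suc r) f [ suc n ] = spread c r f [ n ]

-- The substitution q ↦ q^k for k ≥ 1 (and sub 0 = sub 1).
sub : ℕ → ℤ⟦q⟧ → ℤ⟦q⟧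
sub k = spread (k ℕ.∸ 1) 0

spread-q^ : ∀ c r f → spread c r f ≈ q^ r · spread c 0 f
spread-q^ c zero    f = ≈-sym (·-identityˡ _)
spread-q^ c (suc r) f = ≈-trans (coeffwise λ { zero → refl ; (suc n) → refl })
  (≈-trans (sh-cong (spread-q^ c r f)) (≈-sym (sh-· (q^ r) _)))

sub-isSubstitution : ∀ k .{{_ : NonZero k}} → IsSubstitution (q^ k) (sub k)
sub-isSubstitution (suc c) .const-u  = refl
sub-isSubstitution (suc c) .unfold f .at zero    =
  sym (trans (cong (λ z → f [ 0 ] ℤ.+ z) (q^·-low (suc c) (sub (suc c) (tl f)) 0 (s≤s z≤n))) (ℤ.+-identityʳ _))
sub-isSubstitution (suc c) .unfold f .at (suc n) =
  trans (at (spread-q^ c c (tl f)) n) (sym (trans (ℤ.+-identityˡ _)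
    (at (sh-· (q^ c) (sub (suc c) (tl f))) (suc n))))

-- The substitution q ↦ -q.
neg : ℤ⟦q⟧ → ℤ⟦q⟧
neg f [ zero ]  = f [ 0 ]
neg f [ suc n ] = - neg (tl f) [ n ]

neg-isSubstitution : IsSubstitution (⊖ q^ 1) neg
neg-isSubstitution .const-u  = refl
neg-isSubstitution .unfold f = ≈-trans (expand (neg f))
  (⊕-cong ≈-refl (≈-trans (·-cong {f = q^ 1} {g′ = ⊖ neg (tl f)} ≈-refl (coeffwise (λ _ → refl)))
    (solve 2 (λ q x → q :* (:- x) := (:- q) :* x) ≈-refl (q^ 1) (neg (tl f)))))

module Sub (k : ℕ) .{{nz : NonZero k}} = IsSubstitution (sub-isSubstitution k)
module Neg = IsSubstitution neg-isSubstitution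

id-isSubstitution : IsSubstitution (q^ 1) (λ f → f)
id-isSubstitution .const-u  = refl
id-isSubstitution .unfold f = expand f

sub-q^ : ∀ k .{{_ : NonZero k}} l → sub k (q^ l) ≈ q^ (l ℕ.* k)
sub-q^ k zero    = Sub.σ-κ k (+ 1)
sub-q^ k (suc l) = ≈-trans (Sub.σ-q^suc k l)
  (≈-trans (·-cong ≈-refl (sub-q^ k l)) (≈-sym (q^-+ k (l ℕ.* k))))

q^-cong : ∀ {k l} → k ≡ l → q^ k ≈ q^ l
q^-cong refl = ≈-refl

sub-sub : ∀ k l m .{{_ : NonZero k}} .{{_ : NonZero l}} .{{_ : NonZero m}} → l ℕ.* k ≡ m →
  ∀ f → sub k (sub l f) ≈ sub m f
sub-sub k l m eq = substitution-unique
  (∘-isSubstitution (sub-isSubstitution k) (sub-isSubstitution l)) (sub-isSubstitution m)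
  (≈-trans (sub-q^ k l) (q^-cong eq))

-- Preferred to 2 * n because `double (suc n)` reduces to two successors, in step with the
-- recursions of `neg` and `sub 2`.
double : ℕ → ℕ
double zero    = 0
double (suc n) = suc (suc (double n))

double≡+ : ∀ n → double n ≡ n ℕ.+ n
double≡+ zero    = refl
double≡+ (suc n) = cong suc (trans (cong suc (double≡+ n)) (sym (ℕ.+-suc n n)))

neg-q^-even : ∀ k → neg (q^ double k) ≈ q^ double k
neg-q^-even zero    = Neg.σ-κ (+ 1)
neg-q^-even (suc k) = begin
  neg (q^ double (suc k))                 ≈⟨ Neg.σ-q^suc (suc (double k)) ⟩
  ⊖ q^ 1 · neg (q^ suc (double k))        ≈⟨ ·-cong ≈-refl (Neg.σ-q^suc (double k)) ⟩
  ⊖ q^ 1 · (⊖ q^ 1 · neg (q^ double k))   ≈⟨ ·-cong ≈-refl (·-cong ≈-refl (neg-q^-even k)) ⟩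
  ⊖ q^ 1 · (⊖ q^ 1 · q^ double k)
    ≈⟨ solve 2 (λ q x → (:- q) :* ((:- q) :* x) := q :* (q :* x)) ≈-refl (q^ 1) (q^ double k) ⟩
  q^ 1 · (q^ 1 · q^ double k)             ≈⟨ ·-cong ≈-refl (q· _) ⟩
  q^ 1 · q^ suc (double k)                ≈⟨ q· _ ⟩
  q^ double (suc k)                       ∎
  where open ≈-Reasoning

neg-q^-odd : ∀ k → neg (q^ suc (double k)) ≈ ⊖ q^ suc (double k)
neg-q^-odd k = begin
  neg (q^ suc (double k))    ≈⟨ Neg.σ-q^suc (double k) ⟩
  ⊖ q^ 1 · neg (q^ double k) ≈⟨ ·-cong ≈-refl (neg-q^-even k) ⟩
  ⊖ q^ 1 · q^ double k       ≈⟨ solve 2 (λ q x → (:- q) :* x := :- (q :* x)) ≈-refl (q^ 1) (q^ double k) ⟩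
  ⊖ (q^ 1 · q^ double k)     ≈⟨ ⊖-cong (q· _) ⟩
  ⊖ q^ suc (double k)        ∎
  where open ≈-Reasoning

neg-neg : ∀ f → neg (neg f) ≈ f
neg-neg = substitution-unique (∘-isSubstitution neg-isSubstitution neg-isSubstitution) id-isSubstitution
  (≈-trans (Neg.σ-⊖ (q^ 1)) (≈-trans (⊖-cong Neg.σ-q) (solve 1 (λ q → :- (:- q) := q) ≈-refl (q^ 1))))

neg-sub2 : ∀ f → neg (sub 2 f) ≈ sub 2 f
neg-sub2 = substitution-unique (∘-isSubstitution neg-isSubstitution (sub-isSubstitution 2))
  (sub-isSubstitution 2) (neg-q^-even 1)

neg-sub-odd : ∀ k f → neg (sub (suc (double k)) f) ≈ sub (suc (double k)) (neg f)
neg-sub-odd k = substitution-unique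
  (∘-isSubstitution neg-isSubstitution (sub-isSubstitution (suc (double k))))
  (∘-isSubstitution (sub-isSubstitution (suc (double k))) neg-isSubstitution)
  (≈-trans (neg-q^-odd k) (≈-sym (≈-trans (Sub.σ-⊖ (suc (double k)) (q^ 1))
    (⊖-cong (Sub.σ-q (suc (double k)))))))

-- Even and odd parts of a series

ev od : ℤ⟦q⟧ → ℤ⟦q⟧
ev f [ n ] = f [ double n ]
od f [ n ] = f [ suc (double n) ]

parity-split : ∀ f → f ≈ sub 2 (ev f) ⊕ q^ 1 · sub 2 (od f)
parity-split f .at n = trans (lemma n f) (cong (λ z → sub 2 (ev f) [ n ] ℤ.+ z) (sym (at (q· _) n)))
  where
  lemma : ∀ n f → f [ n ] ≡ sub 2 (ev f) [ n ] ℤ.+ sh (sub 2 (od f)) [ n ]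
  lemma 0 f = sym (ℤ.+-identityʳ _)
  lemma 1 f = sym (ℤ.+-identityˡ _)
  lemma 2 f = sym (ℤ.+-identityʳ _)
  lemma (suc (suc (suc n))) f = trans (lemma (suc n) (tl (tl f))) (cong₂ ℤ._+_
    (at (Sub.σ-cong 2 {g = tl (ev f)} (coeffwise (λ _ → refl))) (suc n))
    (at (Sub.σ-cong 2 {g = tl (od f)} (coeffwise (λ _ → refl))) n))

neg-parity-split : ∀ f → neg f ≈ sub 2 (ev f) ⊕ ⊖ (q^ 1 · sub 2 (od f))
neg-parity-split f = begin
  neg f
    ≈⟨ Neg.σ-cong (parity-split f) ⟩
  neg (sub 2 (ev f) ⊕ q^ 1 · sub 2 (od f))
    ≈⟨ ≈-trans (Neg.σ-⊕ _ _) (⊕-cong (neg-sub2 _) (Neg.σ-· _ _)) ⟩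
  sub 2 (ev f) ⊕ neg (q^ 1) · neg (sub 2 (od f))
    ≈⟨ ⊕-cong ≈-refl (·-cong Neg.σ-q (neg-sub2 _)) ⟩
  sub 2 (ev f) ⊕ ⊖ q^ 1 · sub 2 (od f)
    ≈⟨ solve 3 (λ a q b → a :+ (:- q) :* b := a :+ (:- (q :* b))) ≈-refl (sub 2 (ev f)) (q^ 1) (sub 2 (od f)) ⟩
  sub 2 (ev f) ⊕ ⊖ (q^ 1 · sub 2 (od f)) ∎
  where open ≈-Reasoning

sub-multiple : ∀ k .{{_ : NonZero k}} f n → sub k f [ n ℕ.* k ] ≡ f [ n ]
sub-multiple (suc c) f zero    = refl
sub-multiple (suc c) f (suc n) = trans (at (spread-q^ c c (tl f)) (c ℕ.+ n ℕ.* suc c))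
  (trans (q^·-shift c (sub (suc c) (tl f)) (n ℕ.* suc c)) (sub-multiple (suc c) (tl f) n))

spread-support : ∀ c r f n → (∀ i → n ≢ r ℕ.+ i ℕ.* suc c) → spread c r f [ n ] ≡ + 0
spread-support c zero    f zero    h = contradiction refl (h 0)
spread-support c zero    f (suc n) h = spread-support c c (tl f) n (λ i e → h (suc i) (cong suc e))
spread-support c (suc r) f zero    h = refl
spread-support c (suc r) f (suc n) h = spread-support c r f n (λ i e → h i (cong suc e))

sub-nonmultiple : ∀ k .{{_ : NonZero k}} f n → ¬ k ℕ.∣ n → sub k f [ n ] ≡ + 0
sub-nonmultiple (suc c) f n k∤n = spread-support c 0 f n (λ i e → k∤n (ℕ.divides i e))

ev-sub2 : ∀ f → ev (sub 2 f) ≈ f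
ev-sub2 f .at n = lemma n f
  where
  lemma : ∀ n f → sub 2 f [ double n ] ≡ f [ n ]
  lemma zero    f = refl
  lemma (suc n) f = lemma n (tl f)

od-sub2 : ∀ f n → sub 2 f [ suc (double n) ] ≡ + 0
od-sub2 f zero    = refl
od-sub2 f (suc n) = od-sub2 (tl f) n

-- Infinite products

prod : (ℕ → ℤ⟦q⟧) → ℕ → ℤ⟦q⟧
prod u zero    = # 1
prod u (suc N) = prod u N · u (suc N)

-- The diagonal, as in `S3bar`: coefficient n is read off after n factors. For a `Flat` sequence
-- this is the infinite product, because the later factors leave that coefficient unchanged.
lim : (ℕ → ℤ⟦q⟧) → ℤ⟦q⟧
lim u [ n ] = prod u n [ n ]

-- u j = 1 + O(q^j) for all j ≥ 1
Flat : (ℕ → ℤ⟦q⟧) → Set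
Flat u = ∀ j n → n ℕ.≤ j → u (suc j) [ n ] ≡ # 1 [ n ]

·-identityʳ : ∀ f → f · # 1 ≈ f
·-identityʳ f = ≈-trans (·-comm f (# 1)) (·-identityˡ f)

·-one-local : ∀ n f g → (∀ i → i ℕ.≤ n → g [ i ] ≡ # 1 [ i ]) → (f · g) [ n ] ≡ f [ n ]
·-one-local n f g eq = trans (·-local n f f g (# 1) (λ _ _ → refl) eq) (at (·-identityʳ f) n)

prod-stable : ∀ {u} → Flat u → ∀ {n N} → n ℕ.≤ N → prod u N [ n ] ≡ lim u [ n ]
prod-stable {u} flat {n} n≤N = helper (ℕ.≤⇒≤′ n≤N)
  where
  helper : ∀ {N} → n ℕ.≤′ N → prod u N [ n ] ≡ lim u [ n ]
  helper (ℕ.≤′-reflexive refl) = refl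
  helper {suc N} (ℕ.≤′-step n≤N) = trans
    (·-one-local n (prod u N) (u (suc N)) (λ i i≤n → flat N i (ℕ.≤-trans i≤n (ℕ.≤′⇒≤ n≤N))))
    (helper n≤N)

prod-cong : ∀ {u v} → (∀ j → u (suc j) ≈ v (suc j)) → ∀ N → prod u N ≈ prod v N
prod-cong eq zero    = ≈-refl
prod-cong eq (suc N) = ·-cong (prod-cong eq N) (eq N)

lim-cong : ∀ {u v} → (∀ j → u (suc j) ≈ v (suc j)) → lim u ≈ lim v
lim-cong eq .at n = at (prod-cong eq n) n

prod-· : ∀ u v N → prod u N · prod v N ≈ prod (λ j → u j · v j) N
prod-· u v zero    = ·-identityˡ (# 1)
prod-· u v (suc N) = ≈-trans
  (solve 4 (λ p x q y → (p :* x) :* (q :* y) := (p :* q) :* (x :* y)) ≈-refl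
    (prod u N) (u (suc N)) (prod v N) (v (suc N)))
  (·-cong (prod-· u v N) ≈-refl)

lim-· : ∀ {u v} → Flat u → Flat v → lim u · lim v ≈ lim (λ j → u j · v j)
lim-· {u} {v} fu fv .at n = trans
  (·-local n (lim u) (prod u n) (lim v) (prod v n)
    (λ i i≤n → sym (prod-stable fu i≤n)) (λ i i≤n → sym (prod-stable fv i≤n)))
  (at (prod-· u v n) n)

module _ {w σ} (S : IsSubstitution w σ) where
  prod-σ : ∀ u N → σ (prod u N) ≈ prod (λ j → σ (u j)) N
  prod-σ u zero    = σ-κ S (+ 1)
  prod-σ u (suc N) = ≈-trans (σ-· S (prod u N) (u (suc N))) (·-cong (prod-σ u N) ≈-refl)

  lim-σ : ∀ {u} → Flat u → σ (lim u) ≈ lim (λ j → σ (u j))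
  lim-σ {u} fu .at n = trans
    (σ-local S n (lim u) (prod u n) (λ i i≤n → sym (prod-stable fu i≤n)) n ℕ.≤-refl)
    (at (prod-σ u n) n)

prod-1 : ∀ {u} → (∀ j → u (suc j) ≈ # 1) → ∀ N → prod u N ≈ # 1
prod-1 eq zero    = ≈-refl
prod-1 eq (suc N) = ≈-trans (·-cong (prod-1 eq N) (eq N)) (·-identityˡ (# 1))

sub-low : ∀ k .{{_ : NonZero k}} f n → n ℕ.< k → sub k f [ n ] ≡ κ (f [ 0 ]) [ n ]
sub-low k f n n<k = trans (at (IsSubstitution.unfold (sub-isSubstitution k) f) n)
  (trans (cong (λ z → κ (f [ 0 ]) [ n ] ℤ.+ z) (q^·-low k (sub k (tl f)) n n<k)) (ℤ.+-identityʳ _))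

geo : ℤ⟦q⟧
geo [ _ ] = + 1

geo-inverse : (# 1 ⊕ ⊖ q^ 1) · geo ≈ # 1
geo-inverse = begin
  (# 1 ⊕ ⊖ q^ 1) · geo       ≈⟨ solve 2 (λ q g → (con (+ 1) :+ (:- q)) :* g := g :- q :* g) ≈-refl (q^ 1) geo ⟩
  geo ⊕ ⊖ (q^ 1 · geo)       ≈⟨ ⊕-cong ≈-refl (⊖-cong (q· geo)) ⟩
  geo ⊕ ⊖ sh geo             ≈⟨ coeffwise (λ { zero → refl ; (suc n) → refl }) ⟩
  # 1                        ∎
  where open ≈-Reasoning

neg-1+q : neg (# 1 ⊕ ⊖ q^ 1) ≈ # 1 ⊕ q^ 1
neg-1+q = begin
  neg (# 1 ⊕ ⊖ q^ 1)         ≈⟨ Neg.σ-⊕ (# 1) (⊖ q^ 1) ⟩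
  neg (# 1) ⊕ neg (⊖ q^ 1)   ≈⟨ ⊕-cong (Neg.σ-κ (+ 1)) (Neg.σ-⊖ (q^ 1)) ⟩
  # 1 ⊕ ⊖ neg (q^ 1)         ≈⟨ ⊕-cong ≈-refl (⊖-cong Neg.σ-q) ⟩
  # 1 ⊕ ⊖ ⊖ q^ 1             ≈⟨ solve 1 (λ q → con (+ 1) :+ (:- (:- q)) := con (+ 1) :+ q) ≈-refl (q^ 1) ⟩
  # 1 ⊕ q^ 1                 ∎
  where open ≈-Reasoning

neg-geo-inverse : (# 1 ⊕ q^ 1) · neg geo ≈ # 1
neg-geo-inverse = begin
  (# 1 ⊕ q^ 1) · neg geo          ≈⟨ ·-cong neg-1+q ≈-refl ⟨
  neg (# 1 ⊕ ⊖ q^ 1) · neg geo    ≈⟨ Neg.σ-· (# 1 ⊕ ⊖ q^ 1) geo ⟨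
  neg ((# 1 ⊕ ⊖ q^ 1) · geo)      ≈⟨ Neg.σ-cong geo-inverse ⟩
  neg (# 1)                       ≈⟨ Neg.σ-κ (+ 1) ⟩
  # 1                             ∎
  where open ≈-Reasoning

-- (1+q)/(1-q). Its values at odd powers of q multiply to A, its values at all positive powers to
-- 1/φ(-q).
α : ℤ⟦q⟧
α = (# 1 ⊕ q^ 1) · geo

neg-α : neg α ≈ (# 1 ⊕ ⊖ q^ 1) · neg geo
neg-α = ≈-trans (Neg.σ-· (# 1 ⊕ q^ 1) geo) (·-cong
  (≈-trans (Neg.σ-cong (≈-sym neg-1+q)) (neg-neg (# 1 ⊕ ⊖ q^ 1))) ≈-refl)

α-neg-α : α · neg α ≈ # 1
α-neg-α = begin
  α · neg α
    ≈⟨ ·-cong ≈-refl neg-α ⟩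
  α · ((# 1 ⊕ ⊖ q^ 1) · neg geo)
    ≈⟨ solve 4 (λ x g y h → (x :* g) :* (y :* h) := (y :* g) :* (x :* h)) ≈-refl
         (# 1 ⊕ q^ 1) geo (# 1 ⊕ ⊖ q^ 1) (neg geo) ⟩
  ((# 1 ⊕ ⊖ q^ 1) · geo) · ((# 1 ⊕ q^ 1) · neg geo)
    ≈⟨ ·-cong geo-inverse neg-geo-inverse ⟩
  # 1 · # 1
    ≈⟨ ·-identityˡ (# 1) ⟩
  # 1 ∎
  where open ≈-Reasoning

odd : ∀ j → 2 ℕ.* suc j ℕ.∸ 1 ≡ suc (double j)
odd j = trans (ℕ.+-suc j (j ℕ.+ 0)) (cong suc (trans (cong (j ℕ.+_) (ℕ.+-identityʳ j)) (sym (double≡+ j))))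

n≤double : ∀ n → n ℕ.≤ double n
n≤double n = subst (n ℕ.≤_) (sym (double≡+ n)) (ℕ.m≤m+n n n)

A-factor F-factor F⁻¹-factor : ℕ → ℤ⟦q⟧
A-factor j = sub (2 ℕ.* j ℕ.∸ 1) α
F-factor j = sub j (neg α)
F⁻¹-factor j = sub j α

A-factor≡ : ∀ j → A-factor (suc j) ≡ sub (suc (double j)) α
A-factor≡ j = cong (λ k → sub k α) (odd j)

-- F is Gauss's product for φ(-q).
A F : ℤ⟦q⟧
A = lim A-factor
F = lim F-factor

flat-A-factor : Flat A-factor
flat-A-factor j n n≤j = trans (cong (_[ n ]) (A-factor≡ j))
  (sub-low (suc (double j)) α n (s≤s (ℕ.≤-trans n≤j (n≤double j))))

flat-F-factor : Flat F-factor
flat-F-factor j n n≤j = sub-low (suc j) (neg α) n (s≤s n≤j)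

sub-α-inverse : ∀ k .{{_ : NonZero k}} → sub k α · sub k (neg α) ≈ # 1
sub-α-inverse k = ≈-trans (≈-sym (Sub.σ-· k α (neg α))) (≈-trans (Sub.σ-cong k α-neg-α) (Sub.σ-κ k (+ 1)))

-- All exponents in A are odd, so q ↦ -q turns each factor α(q^m) into α(-q^m), which is its
-- inverse.
A-inverse : A · neg A ≈ # 1
A-inverse = ≈-trans (·-cong ≈-refl (lim-σ neg-isSubstitution flat-A-factor))
  (≈-trans (lim-· flat-A-factor flat-neg-A) (coeffwise (λ n → at (prod-1 each n) n)))
  where
  neg-A : ∀ j → neg (A-factor (suc j)) ≈ sub (suc (double j)) (neg α)
  neg-A j = subst (λ s → neg s ≈ sub (suc (double j)) (neg α)) (sym (A-factor≡ j)) (neg-sub-odd j α)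
  flat-neg-A : Flat (λ j → neg (A-factor j))
  flat-neg-A j n n≤j = trans (at (neg-A j) n)
    (sub-low (suc (double j)) (neg α) n (s≤s (ℕ.≤-trans n≤j (n≤double j))))
  each : ∀ j → A-factor (suc j) · neg (A-factor (suc j)) ≈ # 1
  each j = ≈-trans (·-cong ≈-refl (neg-A j))
    (subst (λ s → s · sub (suc (double j)) (neg α) ≈ # 1) (sym (A-factor≡ j)) (sub-α-inverse (suc (double j))))

-- The factors of A cancel the odd-indexed factors of F up to 2N; the even-indexed ones are the
-- first N factors of F at q².
prod-F-double : ∀ N → prod F-factor (double N) · prod A-factor N ≈ sub 2 (prod F-factor N)
prod-F-double zero    = ≈-trans (·-identityˡ (# 1)) (≈-sym (Sub.σ-κ 2 (+ 1)))
prod-F-double (suc N) = begin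
  prod F-factor (double N) · F-factor (suc (double N)) · F-factor (double (suc N)) · (prod A-factor N · A-factor (suc N))
    ≈⟨ ·-cong ≈-refl (·-cong ≈-refl (subst (λ s → A-factor (suc N) ≈ s) (A-factor≡ N) ≈-refl)) ⟩
  prod F-factor (double N) · F-factor (suc (double N)) · F-factor (double (suc N)) · (prod A-factor N · sub (suc (double N)) α)
    ≈⟨ solve 5 (λ p x y q z → p :* x :* y :* (q :* z) := (p :* q) :* (z :* x) :* y) ≈-refl
         (prod F-factor (double N)) (F-factor (suc (double N))) (F-factor (double (suc N))) (prod A-factor N) (sub (suc (double N)) α) ⟩
  prod F-factor (double N) · prod A-factor N · (sub (suc (double N)) α · F-factor (suc (double N))) · F-factor (double (suc N))
    ≈⟨ ·-cong (·-cong (prod-F-double N) (sub-α-inverse (suc (double N)))) (≈-sym (sub-sub 2 (suc N) (double (suc N)) double≡* (neg α))) ⟩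
  sub 2 (prod F-factor N) · # 1 · sub 2 (F-factor (suc N))
    ≈⟨ ·-cong (·-identityʳ _) ≈-refl ⟩
  sub 2 (prod F-factor N) · sub 2 (F-factor (suc N))
    ≈⟨ Sub.σ-· 2 (prod F-factor N) (F-factor (suc N)) ⟨
  sub 2 (prod F-factor N · F-factor (suc N)) ∎
  where
  open ≈-Reasoning
  double≡* : suc N ℕ.* 2 ≡ double (suc N)
  double≡* = trans (ℕ.*-comm (suc N) 2) (trans (cong (suc N ℕ.+_) (ℕ.+-identityʳ (suc N))) (sym (double≡+ (suc N))))

FA : F · A ≈ sub 2 F
FA .at n = begin
  (F · A) [ n ]
    ≡⟨ ·-local n F (prod F-factor (double n)) A (prod A-factor n)
         (λ i i≤n → sym (prod-stable flat-F-factor (ℕ.≤-trans i≤n (n≤double n))))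
         (λ i i≤n → sym (prod-stable flat-A-factor i≤n)) ⟩
  (prod F-factor (double n) · prod A-factor n) [ n ]
    ≡⟨ at (prod-F-double n) n ⟩
  sub 2 (prod F-factor n) [ n ]
    ≡⟨ Sub.σ-local 2 n (prod F-factor n) F (λ i i≤n → prod-stable flat-F-factor i≤n) n ℕ.≤-refl ⟩
  sub 2 F [ n ] ∎
  where open ≡-Reasoning

-- Gauss's identity

geo′ : ℕ → ℤ⟦q⟧
geo′ j = sub j geo

sub-1+q : ∀ j .{{_ : NonZero j}} → sub j (# 1 ⊕ q^ 1) ≈ # 1 ⊕ q^ j
sub-1+q j = ≈-trans (Sub.σ-⊕ j (# 1) (q^ 1)) (⊕-cong (Sub.σ-κ j (+ 1)) (Sub.σ-q j))

sub-1-q : ∀ j .{{_ : NonZero j}} → sub j (# 1 ⊕ ⊖ q^ 1) ≈ # 1 ⊕ ⊖ q^ j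
sub-1-q j = ≈-trans (Sub.σ-⊕ j (# 1) (⊖ q^ 1)) (⊕-cong (Sub.σ-κ j (+ 1))
  (≈-trans (Sub.σ-⊖ j (q^ 1)) (⊖-cong (Sub.σ-q j))))

geo′-inverse : ∀ j .{{_ : NonZero j}} → (# 1 ⊕ ⊖ q^ j) · geo′ j ≈ # 1
geo′-inverse j = ≈-trans (·-cong (≈-sym (sub-1-q j)) ≈-refl)
  (≈-trans (≈-sym (Sub.σ-· j (# 1 ⊕ ⊖ q^ 1) geo)) (≈-trans (Sub.σ-cong j geo-inverse) (Sub.σ-κ j (+ 1))))

F⁻¹-factor-geo′ : ∀ j .{{_ : NonZero j}} → F⁻¹-factor j ≈ (# 1 ⊕ q^ j) · geo′ j
F⁻¹-factor-geo′ j = ≈-trans (Sub.σ-· j (# 1 ⊕ q^ 1) geo) (·-cong (sub-1+q j) ≈-refl)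

-- η s = 2 (-1)^s ∏_{j≤s} (1+q^j)/(1-q^j), and γ s = η s / (1+q^s) are the coefficients
-- of the solution Σ_s c_s x^s of (1-x) W(qx) = (1+x) W(x).
η γ : ℕ → ℤ⟦q⟧
η zero    = # 2
η (suc s) = ⊖ (η s · F⁻¹-factor (suc s))
γ zero    = # 1
γ (suc s) = ⊖ (η s · geo′ (suc s))

γ-minus : ∀ s → (# 1 ⊕ ⊖ q^ suc s) · γ (suc s) ≈ ⊖ η s
γ-minus s = begin
  (# 1 ⊕ ⊖ q^ suc s) · ⊖ (η s · geo′ (suc s))
    ≈⟨ solve 3 (λ x h g → x :* (:- (h :* g)) := :- (h :* (x :* g))) ≈-refl (# 1 ⊕ ⊖ q^ suc s) (η s) (geo′ (suc s)) ⟩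
  ⊖ (η s · ((# 1 ⊕ ⊖ q^ suc s) · geo′ (suc s)))
    ≈⟨ ⊖-cong (≈-trans (·-cong ≈-refl (geo′-inverse (suc s))) (·-identityʳ (η s))) ⟩
  ⊖ η s ∎
  where open ≈-Reasoning

γ-plus : ∀ s → (# 1 ⊕ q^ suc s) · γ (suc s) ≈ η (suc s)
γ-plus s = ≈-trans
  (solve 3 (λ x h g → x :* (:- (h :* g)) := :- (h :* (x :* g))) ≈-refl (# 1 ⊕ q^ suc s) (η s) (geo′ (suc s)))
  (⊖-cong (·-cong ≈-refl (≈-sym (F⁻¹-factor-geo′ (suc s)))))

-- That solution, truncated after x^k and evaluated at x = q^N; passing from N to `suc N` is x ↦ qx.
W : ℕ → ℕ → ℤ⟦q⟧
W zero    N = # 1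
W (suc k) N = W k N ⊕ γ (suc k) · q^ (suc k ℕ.* N)

-- The truncated solution satisfies the functional equation up to one boundary term. Below it the
-- powers of x cancel because (1-q^s) γ s = -η (s-1), while (1+q^(s-1)) γ (s-1) = η (s-1).
W-step : ∀ k N → (# 1 ⊕ ⊖ q^ N) · W k (suc N) ⊕ ⊖ ((# 1 ⊕ q^ N) · W k N) ≈ ⊖ (η k · q^ (suc k ℕ.* N))
W-step zero N = ≈-trans
  (solve 1 (λ x → (con (+ 1) :- x) :* con (+ 1) :- (con (+ 1) :+ x) :* con (+ 1) := :- (con (+ 2) :* x)) ≈-refl (q^ N))
  (⊖-cong (·-cong ≈-refl (q^-cong (sym (ℕ.+-identityʳ N)))))
W-step (suc k) N = begin
  (# 1 ⊕ ⊖ x) · (W k (suc N) ⊕ c′ · q^ (suc k ℕ.* suc N)) ⊕ ⊖ ((# 1 ⊕ x) · (W k N ⊕ c′ · y))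
    ≈⟨ ⊕-cong (·-cong ≈-refl (⊕-cong ≈-refl (·-cong ≈-refl
         (≈-trans (q^-cong (ℕ.*-suc (suc k) N)) (q^-+ (suc k) (suc k ℕ.* N)))))) ≈-refl ⟩
  (# 1 ⊕ ⊖ x) · (W k (suc N) ⊕ c′ · (z · y)) ⊕ ⊖ ((# 1 ⊕ x) · (W k N ⊕ c′ · y))
    ≈⟨ solve 6 (λ x w w′ c z y →
         (con (+ 1) :- x) :* (w′ :+ c :* (z :* y)) :- (con (+ 1) :+ x) :* (w :+ c :* y) :=
         ((con (+ 1) :- x) :* w′ :- (con (+ 1) :+ x) :* w) :+
           :- (y :* ((con (+ 1) :- z) :* c) :+ x :* y :* ((con (+ 1) :+ z) :* c)))
         ≈-refl x (W k N) (W k (suc N)) c′ z y ⟩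
  ((# 1 ⊕ ⊖ x) · W k (suc N) ⊕ ⊖ ((# 1 ⊕ x) · W k N)) ⊕
    ⊖ (y · ((# 1 ⊕ ⊖ z) · c′) ⊕ x · y · ((# 1 ⊕ z) · c′))
    ≈⟨ ⊕-cong (W-step k N) (⊖-cong (⊕-cong (·-cong ≈-refl (γ-minus k)) (·-cong ≈-refl (γ-plus k)))) ⟩
  ⊖ (η k · y) ⊕ ⊖ (y · ⊖ η k ⊕ x · y · η (suc k))
    ≈⟨ solve 4 (λ h y x h′ → (:- (h :* y)) :- (y :* (:- h) :+ x :* y :* h′) := :- (h′ :* (x :* y)))
         ≈-refl (η k) y x (η (suc k)) ⟩
  ⊖ (η (suc k) · (x · y))
    ≈⟨ ⊖-cong (·-cong ≈-refl (≈-sym (q^-+ N (suc k ℕ.* N)))) ⟩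
  ⊖ (η (suc k) · q^ (suc (suc k) ℕ.* N)) ∎
  where
  open ≈-Reasoning
  x = q^ N
  y = q^ (suc k ℕ.* N)
  z = q^ suc k
  c′ = γ (suc k)

±2 : ℕ → ℤ
±2 zero    = + 2
±2 (suc M) = - ±2 M

prod-F-η : ∀ M → prod F-factor M · η M ≈ κ (±2 M)
prod-F-η zero    = ·-identityˡ (# 2)
prod-F-η (suc M) = begin
  prod F-factor M · F-factor (suc M) · ⊖ (η M · F⁻¹-factor (suc M))
    ≈⟨ solve 4 (λ p x h y → p :* x :* (:- (h :* y)) := :- ((p :* h) :* (y :* x))) ≈-refl
         (prod F-factor M) (F-factor (suc M)) (η M) (F⁻¹-factor (suc M)) ⟩
  ⊖ (prod F-factor M · η M · (F⁻¹-factor (suc M) · F-factor (suc M)))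
    ≈⟨ ⊖-cong (≈-trans (·-cong (prod-F-η M) (sub-α-inverse (suc M))) (·-identityʳ (κ (±2 M)))) ⟩
  ⊖ κ (±2 M)
    ≈⟨ coeffwise (λ { zero → refl ; (suc n) → refl }) ⟩
  κ (- ±2 M) ∎
  where open ≈-Reasoning

F-factor-plus : ∀ j .{{_ : NonZero j}} → F-factor j · (# 1 ⊕ q^ j) ≈ # 1 ⊕ ⊖ q^ j
F-factor-plus j = begin
  F-factor j · (# 1 ⊕ q^ j)
    ≈⟨ ·-cong (Sub.σ-cong j neg-α) (≈-sym (sub-1+q j)) ⟩
  sub j ((# 1 ⊕ ⊖ q^ 1) · neg geo) · sub j (# 1 ⊕ q^ 1)
    ≈⟨ Sub.σ-· j _ (# 1 ⊕ q^ 1) ⟨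
  sub j ((# 1 ⊕ ⊖ q^ 1) · neg geo · (# 1 ⊕ q^ 1))
    ≈⟨ Sub.σ-cong j (≈-trans
         (solve 3 (λ x g y → x :* g :* y := x :* (y :* g)) ≈-refl (# 1 ⊕ ⊖ q^ 1) (neg geo) (# 1 ⊕ q^ 1))
         (≈-trans (·-cong ≈-refl neg-geo-inverse) (·-identityʳ _))) ⟩
  sub j (# 1 ⊕ ⊖ q^ 1)
    ≈⟨ sub-1-q j ⟩
  # 1 ⊕ ⊖ q^ j ∎
  where open ≈-Reasoning

1-q-cancel : ∀ j .{{_ : NonZero j}} {f g} → (# 1 ⊕ ⊖ q^ j) · f ≈ (# 1 ⊕ ⊖ q^ j) · g → f ≈ g
1-q-cancel j {f} {g} eq = ≈-trans (≈-sym (reduce f)) (≈-trans (·-cong ≈-refl eq) (reduce g))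
  where
  reduce : ∀ f → geo′ j · ((# 1 ⊕ ⊖ q^ j) · f) ≈ f
  reduce f = ≈-trans (solve 3 (λ g x f → g :* (x :* f) := (x :* g) :* f) ≈-refl (geo′ j) (# 1 ⊕ ⊖ q^ j) f)
    (≈-trans (·-cong (geo′-inverse j) ≈-refl) (·-identityˡ f))

-- Partial sums of φ(-q) = 1 + 2 Σ (-1)^k q^(k²); the term k = M + 1 has the sign opposite to
-- `±2 M`.
T : ℕ → ℤ⟦q⟧
T zero    = # 1
T (suc M) = T M ⊕ ⊖ (κ (±2 M) · q^ (suc M ℕ.* suc M))

-- The finite form of Gauss's identity, after Shanks.
prod-F-W : ∀ N → prod F-factor N · W N (suc N) ≈ T N
prod-F-W zero    = ·-identityˡ (# 1)
prod-F-W (suc M) = begin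
  p · δ · (W M (suc N) ⊕ γ N · q^ (N ℕ.* suc N))
    ≈⟨ ·-cong ≈-refl (⊕-cong ≈-refl (·-cong ≈-refl (≈-trans (q^-cong (ℕ.*-suc N N)) (q^-+ N (N ℕ.* N))))) ⟩
  p · δ · (W M (suc N) ⊕ γ N · (x · y))
    ≈⟨ 1-q-cancel N (begin
  (# 1 ⊕ ⊖ x) · (p · δ · (W M (suc N) ⊕ γ N · (x · y)))
    ≈⟨ solve 6 (λ x p δ w c y → 
         (con (+ 1) :- x) :* (p :* δ :* (w :+ c :* (x :* y))) :=
         p :* δ :* ((con (+ 1) :- x) :* w :+ ((con (+ 1) :- x) :* c) :* (x :* y)))
         ≈-refl x p δ (W M (suc N)) (γ N) y ⟩
  p · δ · ((# 1 ⊕ ⊖ x) · W M (suc N) ⊕ (# 1 ⊕ ⊖ x) · γ N · (x · y))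
    -- At x = q^N with N = M + 1 the boundary term x^N is q^(N²), the next square. Together with the
    -- contribution of γ N it acquires the factor 1 + x, which `F-factor-plus` turns into the 1 - x
    -- that is to be cancelled.
    ≈⟨ ·-cong ≈-refl (⊕-cong main (·-cong (γ-minus M) ≈-refl)) ⟩
  p · δ · (((# 1 ⊕ x) · W M N ⊕ ⊖ (η M · y)) ⊕ ⊖ η M · (x · y))
    ≈⟨ solve 6 (λ p δ x w h y →
         p :* δ :* (((con (+ 1) :+ x) :* w :- h :* y) :+ (:- h) :* (x :* y)) :=
         (δ :* (con (+ 1) :+ x)) :* (p :* w :- (p :* h) :* y))
         ≈-refl p δ x (W M N) (η M) y ⟩
  (δ · (# 1 ⊕ x)) · (p · W M N ⊕ ⊖ (p · η M · y))
    ≈⟨ ·-cong (F-factor-plus N) (⊕-cong (prod-F-W M) (⊖-cong (·-cong (prod-F-η M) ≈-refl))) ⟩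
  (# 1 ⊕ ⊖ x) · T (suc M) ∎) ⟩
  T (suc M) ∎
  where
  open ≈-Reasoning
  N = suc M
  p = prod F-factor M
  δ = F-factor N
  x = q^ N
  y = q^ (N ℕ.* N)
  main : (# 1 ⊕ ⊖ x) · W M (suc N) ≈ (# 1 ⊕ x) · W M N ⊕ ⊖ (η M · y)
  main = begin
    (# 1 ⊕ ⊖ x) · W M (suc N)
      ≈⟨ solve 2 (λ a b → a := b :+ (a :- b)) ≈-refl ((# 1 ⊕ ⊖ x) · W M (suc N)) ((# 1 ⊕ x) · W M N) ⟩
    (# 1 ⊕ x) · W M N ⊕ ((# 1 ⊕ ⊖ x) · W M (suc N) ⊕ ⊖ ((# 1 ⊕ x) · W M N))
      ≈⟨ ⊕-cong ≈-refl (W-step M N) ⟩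
    (# 1 ⊕ x) · W M N ⊕ ⊖ (η M · y) ∎

-- At x = q^(n+1) every term of W after the first is O(q^(n+1)), so W drops out of the finite
-- identity at coefficient n.
W-low : ∀ k n i → i ℕ.≤ n → W k (suc n) [ i ] ≡ # 1 [ i ]
W-low zero    n i i≤n = refl
W-low (suc k) n i i≤n = trans
  (cong₂ ℤ._+_ (W-low k n i i≤n)
    (trans (at (·-comm (γ (suc k)) (q^ (suc k ℕ.* suc n))) i)
      (q^·-low (suc k ℕ.* suc n) (γ (suc k)) i (s≤s (ℕ.≤-trans i≤n (ℕ.m≤m+n n (k ℕ.* suc n)))))))
  (ℤ.+-identityʳ _)

θ-partial : ℕ → ℤ⟦q⟧
θ-partial zero    = # 0
θ-partial (suc M) = θ-partial M ⊕ q^ (suc M ℕ.* suc M)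

-- θ is the sum of q^(x²) over x ≥ 1, so Φ is the theta series φ(q).
θ Φ : ℤ⟦q⟧
θ [ n ] = θ-partial n [ n ]
Φ = # 1 ⊕ # 2 · θ

-- Consecutive squares differ by an odd number, so the sign of the term and the parity of its
-- exponent flip together, and q ↦ -q makes all signs equal.
neg-±q^square : ∀ M → neg (κ (±2 M) · q^ (suc M ℕ.* suc M)) ≈ ⊖ (# 2 · q^ (suc M ℕ.* suc M))
neg-±q^square zero = ≈-trans (Neg.σ-scale (+ 2) (q^ 1)) (≈-trans (·-cong ≈-refl Neg.σ-q)
  (solve 1 (λ q → con (+ 2) :* (:- q) := :- (con (+ 2) :* q)) ≈-refl (q^ 1)))
neg-±q^square (suc M) = begin
  neg (κ (- ±2 M) · q^ (suc (suc M) ℕ.* suc (suc M)))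
    ≈⟨ Neg.σ-cong (·-cong (coeffwise {g = ⊖ κ (±2 M)} (λ { zero → refl ; (suc n) → refl }))
         (≈-trans (q^-cong next) (q^-+ (suc M ℕ.* suc M) (suc (double (suc M)))))) ⟩
  neg (⊖ κ (±2 M) · (s · o))
    ≈⟨ Neg.σ-cong (solve 3 (λ k s o → (:- k) :* (s :* o) := :- ((k :* s) :* o)) ≈-refl (κ (±2 M)) s o) ⟩
  neg (⊖ (κ (±2 M) · s · o))
    ≈⟨ ≈-trans (Neg.σ-⊖ _) (⊖-cong (Neg.σ-· (κ (±2 M) · s) o)) ⟩
  ⊖ (neg (κ (±2 M) · s) · neg o)
    ≈⟨ ⊖-cong (·-cong (neg-±q^square M) (neg-q^-odd (suc M))) ⟩
  ⊖ (⊖ (# 2 · s) · ⊖ o)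
    ≈⟨ solve 2 (λ s o → :- ((:- (con (+ 2) :* s)) :* (:- o)) := :- (con (+ 2) :* (s :* o))) ≈-refl s o ⟩
  ⊖ (# 2 · (s · o))
    ≈⟨ ⊖-cong (·-cong ≈-refl (≈-sym (≈-trans (q^-cong next) (q^-+ (suc M ℕ.* suc M) (suc (double (suc M))))))) ⟩
  ⊖ (# 2 · q^ (suc (suc M) ℕ.* suc (suc M))) ∎
  where
  open ≈-Reasoning
  s = q^ (suc M ℕ.* suc M)
  o = q^ suc (double (suc M))
  square-suc : ∀ m → suc m ℕ.* suc m ≡ m ℕ.* m ℕ.+ suc (m ℕ.+ m)
  square-suc = ℕ-solve-∀
  next : suc (suc M) ℕ.* suc (suc M) ≡ suc M ℕ.* suc M ℕ.+ suc (double (suc M))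
  next = trans (square-suc (suc M)) (cong (λ k → suc M ℕ.* suc M ℕ.+ suc k) (sym (double≡+ (suc M))))

neg-T : ∀ N → neg (T N) ≈ # 1 ⊕ # 2 · θ-partial N
neg-T zero    = ≈-trans (Neg.σ-κ (+ 1)) (solve 0 (con (+ 1) := con (+ 1) :+ con (+ 2) :* con (+ 0)) ≈-refl)
neg-T (suc M) = begin
  neg (T M ⊕ ⊖ t)                          ≈⟨ ≈-trans (Neg.σ-⊕ (T M) (⊖ t)) (⊕-cong (neg-T M) (Neg.σ-⊖ t)) ⟩
  # 1 ⊕ # 2 · θ-partial M ⊕ ⊖ neg t        ≈⟨ ⊕-cong ≈-refl (⊖-cong (neg-±q^square M)) ⟩
  # 1 ⊕ # 2 · θ-partial M ⊕ ⊖ ⊖ (# 2 · s)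
    ≈⟨ solve 2 (λ θ s → con (+ 1) :+ con (+ 2) :* θ :+ (:- (:- (con (+ 2) :* s)))
                     := con (+ 1) :+ con (+ 2) :* (θ :+ s)) ≈-refl (θ-partial M) s ⟩
  # 1 ⊕ # 2 · (θ-partial M ⊕ s)            ∎
  where
  open ≈-Reasoning
  s = q^ (suc M ℕ.* suc M)
  t = κ (±2 M) · s

θ-stable : ∀ {n N} → n ℕ.≤ N → θ-partial N [ n ] ≡ θ [ n ]
θ-stable {n} n≤N = helper (ℕ.≤⇒≤′ n≤N)
  where
  helper : ∀ {N} → n ℕ.≤′ N → θ-partial N [ n ] ≡ θ [ n ]
  helper (ℕ.≤′-reflexive refl) = refl
  helper {suc N} (ℕ.≤′-step n≤N) = trans (cong (λ z → θ-partial N [ n ] ℤ.+ z)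
      (trans (sym (at (·-identityʳ (q^ (suc N ℕ.* suc N))) n)) (q^·-low (suc N ℕ.* suc N) (# 1) n
        (s≤s (ℕ.≤-trans (ℕ.≤′⇒≤ n≤N) (ℕ.m≤m+n N (N ℕ.* suc N)))))))
    (trans (ℤ.+-identityʳ _) (helper n≤N))

-- Gauss's identity with q replaced by -q: the limit of `prod-F-W`, in which W contributes 1.
neg-F : neg F ≈ Φ
neg-F .at n = begin
  neg F [ n ]
    ≡⟨ Neg.σ-local n F (T n) F≡T n ℕ.≤-refl ⟩
  neg (T n) [ n ]
    ≡⟨ at (neg-T n) n ⟩
  (# 1 ⊕ # 2 · θ-partial n) [ n ]
    ≡⟨ cong (λ z → # 1 [ n ] ℤ.+ z) (trans (κ·-at n (+ 2) (θ-partial n)) (sym (κ·-at n (+ 2) θ))) ⟩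
  Φ [ n ] ∎
  where
  open ≡-Reasoning
  F≡T : ∀ i → i ℕ.≤ n → F [ i ] ≡ T n [ i ]
  F≡T i i≤n = trans (sym (prod-stable flat-F-factor i≤n)) (trans
    (sym (·-one-local i (prod F-factor n) (W n (suc n)) (λ j j≤i → W-low n n j (ℕ.≤-trans j≤i i≤n))))
    (at (prod-F-W n) i))

-- Odd squares are odd exponents and cancel under q ↦ -q; the even squares (2x)² = 4x² are counted
-- twice.
θ-partial-even : ∀ N → θ-partial (double N) ⊕ neg (θ-partial (double N)) ≈ # 2 · sub 4 (θ-partial N)
θ-partial-even zero    = ≈-trans (⊕-cong ≈-refl (Neg.σ-κ (+ 0))) (≈-trans
  (solve 0 (con (+ 0) :+ con (+ 0) := con (+ 2) :* con (+ 0)) ≈-refl) (·-cong ≈-refl (≈-sym (Sub.σ-κ 4 (+ 0)))))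
θ-partial-even (suc N) = begin
  t ⊕ o ⊕ r ⊕ neg (t ⊕ o ⊕ r)
    ≈⟨ ⊕-cong ≈-refl (≈-trans (Neg.σ-⊕ (t ⊕ o) r) (⊕-cong (Neg.σ-⊕ t o) ≈-refl)) ⟩
  t ⊕ o ⊕ r ⊕ (neg t ⊕ neg o ⊕ neg r)
    ≈⟨ ⊕-cong ≈-refl (⊕-cong (⊕-cong ≈-refl neg-o) neg-r) ⟩
  t ⊕ o ⊕ r ⊕ (neg t ⊕ ⊖ o ⊕ r)
    ≈⟨ solve 4 (λ t o r u → t :+ o :+ r :+ (u :+ (:- o) :+ r) := (t :+ u) :+ con (+ 2) :* r) ≈-refl t o r (neg t) ⟩
  (t ⊕ neg t) ⊕ # 2 · r
    ≈⟨ ⊕-cong (θ-partial-even N) (·-cong ≈-refl r≈) ⟩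
  # 2 · sub 4 (θ-partial N) ⊕ # 2 · sub 4 s
    ≈⟨ solve 2 (λ a b → con (+ 2) :* a :+ con (+ 2) :* b := con (+ 2) :* (a :+ b)) ≈-refl
         (sub 4 (θ-partial N)) (sub 4 s) ⟩
  # 2 · (sub 4 (θ-partial N) ⊕ sub 4 s)
    ≈⟨ ·-cong ≈-refl (Sub.σ-⊕ 4 (θ-partial N) s) ⟨
  # 2 · sub 4 (θ-partial (suc N)) ∎
  where
  open ≈-Reasoning
  t = θ-partial (double N)
  o = q^ (suc (double N) ℕ.* suc (double N))
  r = q^ (double (suc N) ℕ.* double (suc N))
  s = q^ (suc N ℕ.* suc N)
  odd-square : ∀ n → suc (n ℕ.+ n) ℕ.* suc (n ℕ.+ n) ≡ suc ((n ℕ.* n ℕ.+ n ℕ.* n ℕ.+ n ℕ.+ n) ℕ.+ (n ℕ.* n ℕ.+ n ℕ.* n ℕ.+ n ℕ.+ n))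
  odd-square = ℕ-solve-∀
  even-square : ∀ n → (n ℕ.+ n) ℕ.* (n ℕ.+ n) ≡ (n ℕ.* n ℕ.+ n ℕ.* n) ℕ.+ (n ℕ.* n ℕ.+ n ℕ.* n)
  even-square = ℕ-solve-∀
  fourfold : ∀ n → (n ℕ.+ n) ℕ.* (n ℕ.+ n) ≡ n ℕ.* n ℕ.* 4
  fourfold = ℕ-solve-∀
  m = N ℕ.* N ℕ.+ N ℕ.* N ℕ.+ N ℕ.+ N
  m′ = suc N ℕ.* suc N ℕ.+ suc N ℕ.* suc N
  o≡ : suc (double N) ℕ.* suc (double N) ≡ suc (double m)
  o≡ rewrite double≡+ N | double≡+ m = odd-square N
  r≡ : double (suc N) ℕ.* double (suc N) ≡ double m′
  r≡ = trans (cong₂ ℕ._*_ (double≡+ (suc N)) (double≡+ (suc N))) (trans (even-square (suc N)) (sym (double≡+ m′)))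
  neg-o : neg o ≈ ⊖ o
  neg-o = ≈-trans (Neg.σ-cong (q^-cong o≡)) (≈-trans (neg-q^-odd m) (⊖-cong (q^-cong (sym o≡))))
  neg-r : neg r ≈ r
  neg-r = ≈-trans (Neg.σ-cong (q^-cong r≡)) (≈-trans (neg-q^-even m′) (q^-cong (sym r≡)))
  r≈ : r ≈ sub 4 s
  r≈ = ≈-trans (q^-cong (trans (cong₂ ℕ._*_ (double≡+ (suc N)) (double≡+ (suc N))) (fourfold (suc N))))
    (≈-sym (sub-q^ 4 (suc N ℕ.* suc N)))

θ-even : θ ⊕ neg θ ≈ # 2 · sub 4 θ
θ-even .at n = begin
  θ [ n ] ℤ.+ neg θ [ n ]
    ≡⟨ cong₂ ℤ._+_ (sym (θ-stable (n≤double n)))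
         (Neg.σ-local n θ t (λ i i≤n → sym (θ-stable (ℕ.≤-trans i≤n (n≤double n)))) n ℕ.≤-refl) ⟩
  t [ n ] ℤ.+ neg t [ n ]
    ≡⟨ at (θ-partial-even n) n ⟩
  (# 2 · sub 4 (θ-partial n)) [ n ]
    ≡⟨ κ·-at n (+ 2) (sub 4 (θ-partial n)) ⟩
  + 2 ℤ.* sub 4 (θ-partial n) [ n ]
    ≡⟨ cong (+ 2 ℤ.*_) (Sub.σ-local 4 n (θ-partial n) θ (λ i i≤n → θ-stable i≤n) n ℕ.≤-refl) ⟩
  + 2 ℤ.* sub 4 θ [ n ]
    ≡⟨ κ·-at n (+ 2) (sub 4 θ) ⟨
  (# 2 · sub 4 θ) [ n ] ∎
  where
  open ≡-Reasoning
  t = θ-partial (double n)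

Φ-even : Φ ⊕ neg Φ ≈ # 2 · sub 4 Φ
Φ-even = begin
  Φ ⊕ neg Φ
    ≈⟨ ⊕-cong ≈-refl (≈-trans (Neg.σ-⊕ (# 1) (# 2 · θ)) (⊕-cong (Neg.σ-κ (+ 1)) (Neg.σ-scale (+ 2) θ))) ⟩
  # 1 ⊕ # 2 · θ ⊕ (# 1 ⊕ # 2 · neg θ)
    ≈⟨ solve 2 (λ a b → con (+ 1) :+ con (+ 2) :* a :+ (con (+ 1) :+ con (+ 2) :* b)
          := con (+ 2) :* (con (+ 1) :+ (a :+ b))) ≈-refl θ (neg θ) ⟩
  # 2 · (# 1 ⊕ (θ ⊕ neg θ))
    ≈⟨ ·-cong ≈-refl (⊕-cong (≈-sym (Sub.σ-κ 4 (+ 1))) (≈-trans θ-even (≈-sym (Sub.σ-scale 4 (+ 2) θ)))) ⟩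
  # 2 · (sub 4 (# 1) ⊕ sub 4 (# 2 · θ))
    ≈⟨ ·-cong ≈-refl (Sub.σ-⊕ 4 (# 1) (# 2 · θ)) ⟨
  # 2 · sub 4 Φ ∎
  where open ≈-Reasoning

q^-support : ∀ k n → k ≢ n → q^ k [ n ] ≡ + 0
q^-support zero    zero    k≢n = contradiction refl k≢n
q^-support zero    (suc n) k≢n = refl
q^-support (suc k) zero    k≢n = refl
q^-support (suc k) (suc n) k≢n = q^-support k n (λ k≡n → k≢n (cong suc k≡n))

θ-support : ∀ n → (θ [ n ] ≡ + 0) ⊎ (∃ λ x → n ≡ x ℕ.* x)
θ-support n = helper n
  where
  helper : ∀ N → (θ-partial N [ n ] ≡ + 0) ⊎ (∃ λ x → n ≡ x ℕ.* x)
  helper zero    = inj₁ (#0-at n)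
  helper (suc N) with suc N ℕ.* suc N ℕ.≟ n | helper N
  ... | yes eq | _       = inj₂ (suc N , sym eq)
  ... | no _   | inj₂ sq = inj₂ sq
  ... | no neq | inj₁ eq = inj₁ (cong₂ ℤ._+_ eq (q^-support (suc N ℕ.* suc N) n neq))

-- Functional equations of φ and A

≈0⇒≈ : ∀ {f g} → f ⊕ ⊖ g ≈ # 0 → f ≈ g
≈0⇒≈ {f} {g} eq = begin
  f                ≈⟨ solve 2 (λ f g → f := (f :- g) :+ g) ≈-refl f g ⟩
  (f ⊕ ⊖ g) ⊕ g    ≈⟨ ⊕-cong eq ≈-refl ⟩
  # 0 ⊕ g          ≈⟨ solve 1 (λ g → con (+ 0) :+ g := g) ≈-refl g ⟩
  g                ∎
  where open ≈-Reasoning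

κ-cancel : ∀ c .{{_ : ℤ.NonZero c}} {f g} → κ c · f ≈ κ c · g → f ≈ g
κ-cancel c {f} {g} eq .at n = ℤ.*-cancelˡ-≡ c (f [ n ]) (g [ n ])
  (trans (sym (κ·-at n c f)) (trans (at eq n) (κ·-at n c g)))

q^-cancel : ∀ k {f g} → q^ k · f ≈ q^ k · g → f ≈ g
q^-cancel k {f} {g} eq .at n = trans (sym (q^·-shift k f n)) (trans (at eq (k ℕ.+ n)) (q^·-shift k g n))

sub2-cancel : ∀ {f g} → sub 2 f ≈ sub 2 g → f ≈ g
sub2-cancel {f} {g} eq .at n = trans (sym (at (ev-sub2 f) n)) (trans (at eq (double n)) (at (ev-sub2 g) n))

-- F⁻ = φ(q) in Ramanujan's notation.
F⁻ B : ℤ⟦q⟧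
F⁻ = neg F
B  = neg A

AB : A · B ≈ # 1
AB = A-inverse

F⁻¹ : ℤ⟦q⟧
F⁻¹ = lim F⁻¹-factor

flat-F⁻¹-factor : Flat F⁻¹-factor
flat-F⁻¹-factor j n n≤j = sub-low (suc j) α n (s≤s n≤j)

F-F⁻¹ : F · F⁻¹ ≈ # 1
F-F⁻¹ = ≈-trans (lim-· flat-F-factor flat-F⁻¹-factor) (coeffwise (λ n → at (prod-1 each n) n))
  where
  each : ∀ j → F-factor (suc j) · F⁻¹-factor (suc j) ≈ # 1
  each j = ≈-trans (·-comm _ _) (sub-α-inverse (suc j))

F₂ : ℤ⟦q⟧
F₂ = sub 2 F

BF⁻ : F⁻ · B ≈ F₂
BF⁻ = ≈-trans (≈-sym (Neg.σ-· F A)) (≈-trans (Neg.σ-cong FA) (neg-sub2 F))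

F≈ : F ≈ B · F₂
F≈ = ≈-sym (≈-trans (·-cong ≈-refl (≈-sym FA)) (≈-trans
  (solve 3 (λ a b f → b :* (f :* a) := (a :* b) :* f) ≈-refl A B F)
  (≈-trans (·-cong AB ≈-refl) (·-identityˡ F))))

F⁻≈ : F⁻ ≈ A · F₂
F⁻≈ = ≈-sym (≈-trans (·-cong ≈-refl (≈-sym BF⁻)) (≈-trans
  (solve 3 (λ a b f → a :* (f :* b) := (a :* b) :* f) ≈-refl A B F⁻)
  (≈-trans (·-cong AB ≈-refl) (·-identityˡ F⁻))))

F⁻-even : F⁻ ⊕ F ≈ # 2 · sub 4 F⁻
F⁻-even = begin
  F⁻ ⊕ F         ≈⟨ ⊕-cong neg-F (≈-trans (≈-sym (neg-neg F)) (Neg.σ-cong neg-F)) ⟩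
  Φ ⊕ neg Φ      ≈⟨ Φ-even ⟩
  # 2 · sub 4 Φ  ≈⟨ ·-cong ≈-refl (Sub.σ-cong 4 (≈-sym neg-F)) ⟩
  # 2 · sub 4 F⁻ ∎
  where open ≈-Reasoning

FF⁻ : F · F⁻ ≈ F₂ · F₂
FF⁻ = begin
  F · F⁻               ≈⟨ ·-cong F≈ F⁻≈ ⟩
  B · F₂ · (A · F₂)    ≈⟨ solve 3 (λ a b f → b :* f :* (a :* f) := (a :* b) :* (f :* f)) ≈-refl A B F₂ ⟩
  A · B · (F₂ · F₂)    ≈⟨ ≈-trans (·-cong AB ≈-refl) (·-identityˡ _) ⟩
  F₂ · F₂              ∎
  where open ≈-Reasoning

-- Constant terms give 3 s₀ = 0, odd coefficients vanish because s(q²) has none, and the coefficient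
-- at 2k is -2 times the one at k, which is covered by induction.
-2-fixed-vanishes : ∀ {s} → s ≈ κ (- (+ 2)) · sub 2 s → s ≈ # 0
-2-fixed-vanishes {s} eq .at n = trans (<-rec P step n) (sym (#0-at n))
  where
  P : ℕ → Set
  P n = s [ n ] ≡ + 0
  eq-at : ∀ n → s [ n ] ≡ - (+ 2) ℤ.* sub 2 s [ n ]
  eq-at n = trans (at eq n) (κ·-at n (- (+ 2)) (sub 2 s))
  eq-0 : ∀ z → z ≡ - (+ 2) ℤ.* z → z ≡ + 0
  eq-0 z eq = ℤ.*-cancelˡ-≡ (+ 3) z (+ 0) (begin
    + 3 ℤ.* z                     ≡⟨ split z ⟩
    z ℤ.+ + 2 ℤ.* z               ≡⟨ cong (ℤ._+ + 2 ℤ.* z) eq ⟩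
    - (+ 2) ℤ.* z ℤ.+ + 2 ℤ.* z   ≡⟨ vanish z ⟩
    + 0                           ∎)
    where
    open ≡-Reasoning
    split : ∀ z → + 3 ℤ.* z ≡ z ℤ.+ + 2 ℤ.* z
    split = solve-∀
    vanish : ∀ z → - (+ 2) ℤ.* z ℤ.+ + 2 ℤ.* z ≡ + 0
    vanish = solve-∀
  step : ∀ n → (∀ {m} → m ℕ.< n → P m) → P n
  step zero    ih = eq-0 (s [ 0 ]) (eq-at 0)
  step n@(suc _) ih = trans (eq-at n) (trans (cong (λ z → - (+ 2) ℤ.* z) sub2-vanishes) (ℤ.*-zeroʳ (- (+ 2))))
    where
    sub2-vanishes : sub 2 s [ n ] ≡ + 0
    sub2-vanishes with 2 ℕ.∣? n
    ... | no 2∤n = sub-nonmultiple 2 s n 2∤n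
    ... | yes (ℕ.divides k@(suc _) n≡k*2) = trans (cong (λ j → sub 2 s [ j ]) n≡k*2)
      (trans (sub-multiple 2 s k) (ih (subst (k ℕ.<_) (sym n≡k*2) (ℕ.m<m*n k 2 (s≤s (s≤s z≤n))))))

-- The difference s of the two sides satisfies s = -2 s(q²).
F-squares : F · F ⊕ F⁻ · F⁻ ≈ # 2 · (sub 2 F⁻ · sub 2 F⁻)
F-squares = ≈0⇒≈ (-2-fixed-vanishes (begin
  F · F ⊕ F⁻ · F⁻ ⊕ ⊖ (# 2 · (G · G))
    ≈⟨ solve 3 (λ f f⁻ g → f :* f :+ f⁻ :* f⁻ :- con (+ 2) :* (g :* g) :=
         (f⁻ :+ f) :* (f⁻ :+ f) :- con (+ 2) :* (f :* f⁻) :- con (+ 2) :* (g :* g)) ≈-refl F F⁻ G ⟩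
  (F⁻ ⊕ F) · (F⁻ ⊕ F) ⊕ ⊖ (# 2 · (F · F⁻)) ⊕ ⊖ (# 2 · (G · G))
    ≈⟨ ⊕-cong (⊕-cong (·-cong F⁻-even F⁻-even) (⊖-cong (·-cong ≈-refl FF⁻))) ≈-refl ⟩
  # 2 · sub 4 F⁻ · (# 2 · sub 4 F⁻) ⊕ ⊖ (# 2 · (F₂ · F₂)) ⊕ ⊖ (# 2 · (G · G))
    ≈⟨ solve 3 (λ h f g → con (+ 2) :* h :* (con (+ 2) :* h) :- con (+ 2) :* (f :* f) :- con (+ 2) :* (g :* g)
         := con (- (+ 2)) :* (f :* f :+ g :* g :- con (+ 2) :* (h :* h))) ≈-refl (sub 4 F⁻) F₂ G ⟩
  κ (- (+ 2)) · (F₂ · F₂ ⊕ G · G ⊕ ⊖ (# 2 · (sub 4 F⁻ · sub 4 F⁻)))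
    ≈⟨ ·-cong ≈-refl (≈-sym sub2-s) ⟩
  κ (- (+ 2)) · sub 2 (F · F ⊕ F⁻ · F⁻ ⊕ ⊖ (# 2 · (G · G))) ∎))
  where
  open ≈-Reasoning
  G = sub 2 F⁻
  sub2-G : sub 2 G ≈ sub 4 F⁻
  sub2-G = sub-sub 2 2 4 refl F⁻
  sub2-s : sub 2 (F · F ⊕ F⁻ · F⁻ ⊕ ⊖ (# 2 · (G · G))) ≈ F₂ · F₂ ⊕ G · G ⊕ ⊖ (# 2 · (sub 4 F⁻ · sub 4 F⁻))
  sub2-s = ≈-trans (Sub.σ-⊕ 2 _ _) (⊕-cong
    (≈-trans (Sub.σ-⊕ 2 (F · F) (F⁻ · F⁻)) (⊕-cong (Sub.σ-· 2 F F) (Sub.σ-· 2 F⁻ F⁻)))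
    (≈-trans (Sub.σ-⊖ 2 _) (⊖-cong (≈-trans (Sub.σ-scale 2 (+ 2) (G · G))
      (·-cong ≈-refl (≈-trans (Sub.σ-· 2 G G) (·-cong sub2-G sub2-G)))))))

-- The parity dissection of A² and the relation for Z²

A⁴ : ℤ⟦q⟧
A⁴ = A · A · (A · A)

-- `F-squares` divided by φ(-q²)²: here φ(-q) = B φ(-q²), φ(q) = A φ(-q²), and φ(q²) = A(q²) φ(-q⁴)
-- = A(q²)² φ(-q²). The division is multiplication by V = 1/φ(-q²).
A-squares : A · A ⊕ B · B ≈ # 2 · sub 2 A⁴
A-squares = begin
  A · A ⊕ B · B
    ≈⟨ unit (A · A ⊕ B · B) ⟩
  (V · F₂) · (V · F₂) · (A · A ⊕ B · B)
    ≈⟨ solve 4 (λ v f a b → (v :* f) :* (v :* f) :* (a :* a :+ b :* b) :=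
         v :* v :* ((b :* f) :* (b :* f) :+ (a :* f) :* (a :* f))) ≈-refl V F₂ A B ⟩
  V · V · (B · F₂ · (B · F₂) ⊕ A · F₂ · (A · F₂))
    ≈⟨ ·-cong ≈-refl (⊕-cong (·-cong F≈ F≈) (·-cong F⁻≈ F⁻≈)) ⟨
  V · V · (F · F ⊕ F⁻ · F⁻)
    ≈⟨ ·-cong ≈-refl (≈-trans F-squares (·-cong ≈-refl (·-cong sub2-F⁻ sub2-F⁻))) ⟩
  V · V · (# 2 · (A₂ · (F₂ · A₂) · (A₂ · (F₂ · A₂))))
    ≈⟨ solve 3 (λ v a f → v :* v :* (con (+ 2) :* (a :* (f :* a) :* (a :* (f :* a)))) :=
         (v :* f) :* (v :* f) :* (con (+ 2) :* (a :* a :* (a :* a)))) ≈-refl V A₂ F₂ ⟩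
  (V · F₂) · (V · F₂) · (# 2 · (A₂ · A₂ · (A₂ · A₂)))
    ≈⟨ unit _ ⟨
  # 2 · (A₂ · A₂ · (A₂ · A₂))
    ≈⟨ ·-cong ≈-refl (≈-sym (≈-trans (Sub.σ-· 2 (A · A) (A · A)) (·-cong (Sub.σ-· 2 A A) (Sub.σ-· 2 A A)))) ⟩
  # 2 · sub 2 A⁴ ∎
  where
  open ≈-Reasoning
  A₂ = sub 2 A
  V = sub 2 F⁻¹
  V-inverse : V · F₂ ≈ # 1
  V-inverse = ≈-trans (≈-sym (Sub.σ-· 2 F⁻¹ F)) (≈-trans
    (Sub.σ-cong 2 (≈-trans (·-comm F⁻¹ F) F-F⁻¹)) (Sub.σ-κ 2 (+ 1)))
  unit : ∀ f → f ≈ (V · F₂) · (V · F₂) · f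
  unit f = ≈-sym (≈-trans (·-cong (≈-trans (·-cong V-inverse V-inverse) (·-identityˡ (# 1))) ≈-refl) (·-identityˡ f))
  sub2-F⁻ : sub 2 F⁻ ≈ A₂ · (F₂ · A₂)
  sub2-F⁻ = ≈-trans (Sub.σ-cong 2 F⁻≈) (≈-trans (Sub.σ-· 2 A F₂) (·-cong ≈-refl
    (≈-trans (Sub.σ-cong 2 (≈-sym FA)) (Sub.σ-· 2 F A))))

-- A² = A(q²)⁴ + q O(q²); squaring this, the odd part of A⁴ is 2 O A⁴ = 2Z.
O Z : ℤ⟦q⟧
O = od (A · A)
Z = O · A⁴

od-split : ∀ {f x y} → f ≈ sub 2 x ⊕ q^ 1 · sub 2 y → od f ≈ y
od-split {f} {x} {y} eq .at n = begin
  f [ suc (double n) ]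
    ≡⟨ at eq (suc (double n)) ⟩
  sub 2 x [ suc (double n) ] ℤ.+ (q^ 1 · sub 2 y) [ suc (double n) ]
    ≡⟨ cong₂ ℤ._+_ (od-sub2 x n) (at (q· (sub 2 y)) (suc (double n))) ⟩
  + 0 ℤ.+ sub 2 y [ double n ]
    ≡⟨ trans (ℤ.+-identityˡ _) (at (ev-sub2 y) n) ⟩
  y [ n ] ∎
  where open ≡-Reasoning

-- B² is A² at -q, so A² + B² is twice the even part of A², and `A-squares` identifies it.
ev-A² : ev (A · A) ≈ A⁴
ev-A² = sub2-cancel (κ-cancel (+ 2) (begin
  # 2 · sub 2 E
    ≈⟨ solve 2 (λ x y → con (+ 2) :* x := (x :+ y) :+ (x :+ (:- y))) ≈-refl (sub 2 E) (q^ 1 · sub 2 O) ⟩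
  (sub 2 E ⊕ q^ 1 · sub 2 O) ⊕ (sub 2 E ⊕ ⊖ (q^ 1 · sub 2 O))
    ≈⟨ ⊕-cong (parity-split (A · A)) (≈-trans (≈-sym (Neg.σ-· A A)) (neg-parity-split (A · A))) ⟨
  A · A ⊕ B · B
    ≈⟨ A-squares ⟩
  # 2 · sub 2 A⁴ ∎))
  where
  open ≈-Reasoning
  E = ev (A · A)

A²-split : A · A ≈ sub 2 A⁴ ⊕ q^ 1 · sub 2 O
A²-split = ≈-trans (parity-split (A · A)) (⊕-cong (Sub.σ-cong 2 ev-A²) ≈-refl)

B²-split : B · B ≈ sub 2 A⁴ ⊕ ⊖ (q^ 1 · sub 2 O)
B²-split = ≈-trans (≈-sym (Neg.σ-· A A)) (≈-trans (neg-parity-split (A · A))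
  (⊕-cong (Sub.σ-cong 2 ev-A²) ≈-refl))

q²-sub2 : ∀ f → q^ 1 · (q^ 1 · sub 2 f) ≈ sub 2 (q^ 1 · f)
q²-sub2 f = begin
  q^ 1 · (q^ 1 · sub 2 f)  ≈⟨ solve 2 (λ q f → q :* (q :* f) := (q :* q) :* f) ≈-refl (q^ 1) (sub 2 f) ⟩
  q^ 1 · q^ 1 · sub 2 f    ≈⟨ ·-cong (q^-+ 1 1) ≈-refl ⟨
  q^ 2 · sub 2 f           ≈⟨ ·-cong (Sub.σ-q 2) ≈-refl ⟨
  sub 2 (q^ 1) · sub 2 f   ≈⟨ Sub.σ-· 2 (q^ 1) f ⟨
  sub 2 (q^ 1 · f)         ∎
  where open ≈-Reasoning

A⁴-split : A⁴ ≈ sub 2 (A⁴ · A⁴ ⊕ q^ 1 · (O · O)) ⊕ q^ 1 · sub 2 (# 2 · Z)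
A⁴-split = begin
  A · A · (A · A)
    ≈⟨ ·-cong A²-split A²-split ⟩
  (x ⊕ q^ 1 · y) · (x ⊕ q^ 1 · y)
    ≈⟨ solve 3 (λ x y q → (x :+ q :* y) :* (x :+ q :* y) :=
         (x :* x :+ q :* (q :* (y :* y))) :+ q :* (con (+ 2) :* (y :* x))) ≈-refl x y (q^ 1) ⟩
  (x · x ⊕ q^ 1 · (q^ 1 · (y · y))) ⊕ q^ 1 · (# 2 · (y · x))
    ≈⟨ ⊕-cong (⊕-cong (≈-sym (Sub.σ-· 2 A⁴ A⁴)) (≈-trans (·-cong ≈-refl (·-cong ≈-refl (≈-sym (Sub.σ-· 2 O O)))) (q²-sub2 (O · O))))
         (·-cong ≈-refl (≈-trans (·-cong ≈-refl (≈-sym (Sub.σ-· 2 O A⁴))) (≈-sym (Sub.σ-scale 2 (+ 2) Z)))) ⟩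
  (sub 2 (A⁴ · A⁴) ⊕ sub 2 (q^ 1 · (O · O))) ⊕ q^ 1 · sub 2 (# 2 · Z)
    ≈⟨ ⊕-cong (Sub.σ-⊕ 2 _ _) ≈-refl ⟨
  sub 2 (A⁴ · A⁴ ⊕ q^ 1 · (O · O)) ⊕ q^ 1 · sub 2 (# 2 · Z) ∎
  where
  open ≈-Reasoning
  x = sub 2 A⁴
  y = sub 2 O

od-A⁴ : od A⁴ ≈ # 2 · Z
od-A⁴ = od-split A⁴-split

B⁴-split : B · B · (B · B) ≈ sub 2 (A⁴ · A⁴ ⊕ q^ 1 · (O · O)) ⊕ ⊖ (q^ 1 · sub 2 (# 2 · Z))
B⁴-split = begin
  B · B · (B · B)
    ≈⟨ ≈-trans (Neg.σ-· (A · A) (A · A)) (·-cong (Neg.σ-· A A) (Neg.σ-· A A)) ⟨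
  neg A⁴
    ≈⟨ Neg.σ-cong A⁴-split ⟩
  neg (sub 2 x ⊕ q^ 1 · sub 2 y)
    ≈⟨ ≈-trans (Neg.σ-⊕ _ _) (⊕-cong (neg-sub2 x) (Neg.σ-· (q^ 1) (sub 2 y))) ⟩
  sub 2 x ⊕ neg (q^ 1) · neg (sub 2 y)
    ≈⟨ ⊕-cong ≈-refl (·-cong Neg.σ-q (neg-sub2 y)) ⟩
  sub 2 x ⊕ ⊖ q^ 1 · sub 2 y
    ≈⟨ solve 3 (λ x q y → x :+ (:- q) :* y := x :- q :* y) ≈-refl (sub 2 x) (q^ 1) (sub 2 y) ⟩
  sub 2 x ⊕ ⊖ (q^ 1 · sub 2 y) ∎
  where
  open ≈-Reasoning
  x = A⁴ · A⁴ ⊕ q^ 1 · (O · O)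
  y = # 2 · Z

-- The product of the splittings of A² and B² is 1, so A(q²)⁸ - q² O(q²)² = 1, that is q O² = A⁸ -
-- 1. As A⁴B⁴ = 1, the right side is A⁴ (A⁴ - B⁴), and A⁴ - B⁴ is twice the odd half of A⁴, namely 4
-- q Z(q²).
o-square : O · O ≈ # 4 · (A⁴ · sub 2 Z)
o-square = q^-cancel 1 (sub2-cancel (begin
  sub 2 (q^ 1 · (O · O))
    ≈⟨ ≈-trans (≈-sym (q²-sub2 (O · O))) (·-cong ≈-refl (·-cong ≈-refl (Sub.σ-· 2 O O))) ⟩
  q^ 1 · (q^ 1 · (sub 2 O · sub 2 O))
    ≈⟨ solve 3 (λ x y q → q :* (q :* (y :* y)) := x :* x :- (x :+ q :* y) :* (x :+ (:- (q :* y)))) ≈-refl (sub 2 A⁴) (sub 2 O) (q^ 1) ⟩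
  sub 2 A⁴ · sub 2 A⁴ ⊕ ⊖ ((sub 2 A⁴ ⊕ q^ 1 · sub 2 O) · (sub 2 A⁴ ⊕ ⊖ (q^ 1 · sub 2 O)))
    ≈⟨ ⊕-cong (≈-sym (Sub.σ-· 2 A⁴ A⁴)) (⊖-cong (≈-trans (·-cong (≈-sym A²-split) (≈-sym B²-split)) A²B²)) ⟩
  sub 2 (A⁴ · A⁴) ⊕ ⊖ # 1
    ≈⟨ ⊕-cong ≈-refl (≈-trans (⊖-cong (≈-sym (Sub.σ-κ 2 (+ 1)))) (≈-sym (Sub.σ-⊖ 2 (# 1)))) ⟩
  sub 2 (A⁴ · A⁴) ⊕ sub 2 (⊖ # 1)
    ≈⟨ Sub.σ-⊕ 2 (A⁴ · A⁴) (⊖ # 1) ⟨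
  sub 2 (A⁴ · A⁴ ⊕ ⊖ # 1)
    ≈⟨ Sub.σ-cong 2 A⁸-1 ⟩
  sub 2 (q^ 1 · (# 4 · (A⁴ · sub 2 Z))) ∎))
  where
  open ≈-Reasoning
  A²B² : A · A · (B · B) ≈ # 1
  A²B² = ≈-trans (solve 2 (λ a b → a :* a :* (b :* b) := (a :* b) :* (a :* b)) ≈-refl A B)
    (≈-trans (·-cong AB AB) (·-identityˡ (# 1)))
  A⁸-1 : A⁴ · A⁴ ⊕ ⊖ # 1 ≈ q^ 1 · (# 4 · (A⁴ · sub 2 Z))
  A⁸-1 = begin
    A⁴ · A⁴ ⊕ ⊖ # 1
      ≈⟨ ⊕-cong ≈-refl (⊖-cong (≈-sym (≈-trans (·-cong A²B² A²B²) (·-identityˡ (# 1))))) ⟩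
    A⁴ · A⁴ ⊕ ⊖ (A · A · (B · B) · (A · A · (B · B)))
      ≈⟨ solve 3 (λ a b w → w :* w :- a :* a :* (b :* b) :* (a :* a :* (b :* b)) :=
            w :* w :- (a :* a :* (a :* a)) :* (b :* b :* (b :* b))) ≈-refl A B A⁴ ⟩
    A⁴ · A⁴ ⊕ ⊖ (A⁴ · (B · B · (B · B)))
      ≈⟨ solve 2 (λ a b → a :* a :- a :* b := a :* (a :- b)) ≈-refl A⁴ (B · B · (B · B)) ⟩
    A⁴ · (A⁴ ⊕ ⊖ (B · B · (B · B)))
      ≈⟨ ·-cong ≈-refl (⊕-cong A⁴-split (⊖-cong B⁴-split)) ⟩
    A⁴ · ((X ⊕ q^ 1 · sub 2 (# 2 · Z)) ⊕ ⊖ (X ⊕ ⊖ (q^ 1 · sub 2 (# 2 · Z))))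
      ≈⟨ ·-cong ≈-refl (⊕-cong (⊕-cong ≈-refl eq) (⊖-cong (⊕-cong ≈-refl (⊖-cong eq)))) ⟩
    A⁴ · ((X ⊕ q^ 1 · (# 2 · sub 2 Z)) ⊕ ⊖ (X ⊕ ⊖ (q^ 1 · (# 2 · sub 2 Z))))
      ≈⟨ solve 4 (λ a x q z → a :* ((x :+ q :* (con (+ 2) :* z)) :- (x :- q :* (con (+ 2) :* z))) :=
           q :* (con (+ 4) :* (a :* z))) ≈-refl A⁴ X (q^ 1) (sub 2 Z) ⟩
    q^ 1 · (# 4 · (A⁴ · sub 2 Z)) ∎
    where
    X = sub 2 (A⁴ · A⁴ ⊕ q^ 1 · (O · O))
    eq : q^ 1 · sub 2 (# 2 · Z) ≈ q^ 1 · (# 2 · sub 2 Z)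
    eq = ·-cong ≈-refl (Sub.σ-scale 2 (+ 2) Z)

-- A¹² is grouped into cubes because each A³ will become A(q³) modulo 3.
Z-square : Z · Z ≈ # 4 · (A · A · A · (A · A · A) · (A · A · A · (A · A · A)) · sub 2 Z)
Z-square = begin
  O · A⁴ · (O · A⁴)
    ≈⟨ solve 2 (λ O a → O :* a :* (O :* a) := (O :* O) :* (a :* a)) ≈-refl O A⁴ ⟩
  O · O · (A⁴ · A⁴)
    ≈⟨ ·-cong o-square ≈-refl ⟩
  # 4 · (A⁴ · sub 2 Z) · (A⁴ · A⁴)
    ≈⟨ solve 2 (λ a z → con (+ 4) :* (a :* a :* (a :* a) :* z) :* (a :* a :* (a :* a) :* (a :* a :* (a :* a)))
         := con (+ 4) :* (a :* a :* a :* (a :* a :* a) :* (a :* a :* a :* (a :* a :* a)) :* z)) ≈-refl A (sub 2 Z) ⟩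
  # 4 · (A · A · A · (A · A · A) · (A · A · A · (A · A · A)) · sub 2 Z) ∎
  where open ≈-Reasoning

-- The generating function of S3bar

q^-at : ∀ k n → q^ k [ n ] ≡ (if n ℕ.≡ᵇ k then + 1 else + 0)
q^-at zero    zero    = refl
q^-at zero    (suc n) = refl
q^-at (suc k) zero    = refl
q^-at (suc k) (suc n) = q^-at k n

onePlus-≈ : ∀ k .{{_ : NonZero k}} → series (onePlus k) ≈ # 1 ⊕ q^ k
onePlus-≈ (suc k) .at zero    = refl
onePlus-≈ (suc k) .at (suc n) = sym (trans (ℤ.+-identityˡ _) (q^-at k n))

oneMinus-≈ : ∀ k .{{_ : NonZero k}} → series (oneMinus k) ≈ # 1 ⊕ ⊖ q^ k
oneMinus-≈ (suc k) .at zero    = refl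
oneMinus-≈ (suc k) .at (suc n) with n ℕ.≡ᵇ k | q^-at k n
... | true  | eq = trans (cong -_ (sym eq)) (sym (ℤ.+-identityˡ _))
... | false | eq = trans (cong -_ (sym eq)) (sym (ℤ.+-identityˡ _))

%≡0⇒sub : ∀ k f n → n ℕ.% suc k ≡ 0 → sub (suc k) f [ n ] ≡ f [ n ℕ./ suc k ]
%≡0⇒sub k f n eq = trans (cong (λ m → sub (suc k) f [ m ]) n≡) (sub-multiple (suc k) f (n ℕ./ suc k))
  where
  n≡ : n ≡ n ℕ./ suc k ℕ.* suc k
  n≡ = trans (ℕ.m≡m%n+[m/n]*n n (suc k)) (cong (ℕ._+ n ℕ./ suc k ℕ.* suc k) eq)

%≢0⇒sub : ∀ k f n → n ℕ.% suc k ≢ 0 → sub (suc k) f [ n ] ≡ + 0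
%≢0⇒sub k f n neq = sub-nonmultiple (suc k) f n (λ k∣n → neq (ℕ.n∣m⇒m%n≡0 n (suc k) k∣n))

invOneMinus-≈ : ∀ k .{{_ : NonZero k}} → series (invOneMinus k) ≈ geo′ k
invOneMinus-≈ (suc k) .at n with n ℕ.% suc k in eq
... | zero  = sym (%≡0⇒sub k geo n eq)
... | suc r = sym (%≢0⇒sub k geo n (λ e → ℕ.1+n≢0 (trans (sym eq) e)))

neg-geo-alternates : (s : ℕ → ℤ) → s 0 ≡ + 1 → s 1 ≡ - (+ 1) → (∀ m → s (suc (suc m)) ≡ s m) →
  ∀ m → s m ≡ neg geo [ m ]
neg-geo-alternates s s0 s1 s+2 zero          = s0
neg-geo-alternates s s0 s1 s+2 (suc zero)    = s1
neg-geo-alternates s s0 s1 s+2 (suc (suc m)) = trans (s+2 m)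
  (trans (neg-geo-alternates s s0 s1 s+2 m) (sym (trans (ℤ.neg-involutive _)
    (at (Neg.σ-cong {g = geo} (coeffwise (λ _ → refl))) m))))

-- signAt k n is the function local to the definition of invOnePlus; having no name in scope
-- here, it is found by unification.
mutual
  signAt : ℕ → ℕ → ℕ → ℤ
  signAt = _

  invOnePlus-≈ : ∀ k .{{_ : NonZero k}} → series (invOnePlus k) ≈ sub k (neg geo)
  invOnePlus-≈ (suc k) .at n with n ℕ.% suc k in eq
  ... | suc r = sym (%≢0⇒sub k (neg geo) n (λ e → ℕ.1+n≢0 (trans (sym eq) e)))
  ... | zero  rewrite %≡0⇒sub k (neg geo) n eq with n ℕ./ suc k
  ... | m = signAt-alternates k n m

  signAt-alternates : ∀ k n m → signAt k n m ≡ neg geo [ m ]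
  signAt-alternates k n = neg-geo-alternates (signAt k n) refl refl (λ _ → refl)

factor-at : ℕ → ℤ⟦q⟧
factor-at m = series (((onePlus m ⊛ oneMinus (3 ℕ.* m)) ⊛ invOnePlus (3 ℕ.* m)) ⊛ invOneMinus m)

factor-at-≈ : ∀ m .{{_ : NonZero m}} → factor-at m ≈ sub m α · sub (3 ℕ.* m) (neg α)
factor-at-≈ m@(suc _) = begin
  factor-at m
    ≈⟨ coeffwise (λ _ → refl) ⟩
  series (onePlus m) · series (oneMinus m₃) · series (invOnePlus m₃) · series (invOneMinus m)
    ≈⟨ ·-cong (·-cong (·-cong (onePlus-≈ m) (oneMinus-≈ m₃)) (invOnePlus-≈ m₃)) (invOneMinus-≈ m) ⟩
  (# 1 ⊕ q^ m) · (# 1 ⊕ ⊖ q^ m₃) · sub m₃ (neg geo) · geo′ m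
    ≈⟨ solve 4 (λ x y g h → x :* y :* g :* h := (x :* h) :* (y :* g)) ≈-refl
         (# 1 ⊕ q^ m) (# 1 ⊕ ⊖ q^ m₃) (sub m₃ (neg geo)) (geo′ m) ⟩
  ((# 1 ⊕ q^ m) · geo′ m) · ((# 1 ⊕ ⊖ q^ m₃) · sub m₃ (neg geo))
    ≈⟨ ·-cong (F⁻¹-factor-geo′ m) (≈-trans (≈-trans (Sub.σ-cong m₃ neg-α) (Sub.σ-· m₃ _ _)) (·-cong (sub-1-q m₃) ≈-refl)) ⟨
  sub m α · sub m₃ (neg α) ∎
  where
  open ≈-Reasoning
  m₃ = 3 ℕ.* m

S : ℤ⟦q⟧
S = series S3bar

factors : ℕ → ℤ⟦q⟧
factors j = series (factor j)

factors≡ : ∀ j → factors (suc j) ≡ factor-at (suc (double j))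
factors≡ j = cong factor-at (odd j)

factors≈ : ∀ j → factors (suc j) ≈ sub (suc (double j)) α · sub (3 ℕ.* suc (double j)) (neg α)
factors≈ j = subst (λ s → s ≈ sub (suc (double j)) α · sub (3 ℕ.* suc (double j)) (neg α))
  (sym (factors≡ j)) (factor-at-≈ (suc (double j)))

flat-factors : Flat factors
flat-factors j n n≤j = trans (at (factors≈ j) n) (trans
  (·-one-local n (sub m α) (sub (3 ℕ.* m) (neg α))
    (λ i i≤n → sub-low (3 ℕ.* m) (neg α) i (ℕ.<-≤-trans (i<m i≤n) (ℕ.m≤m+n m (m ℕ.+ (m ℕ.+ 0))))))
  (sub-low m α n (i<m ℕ.≤-refl)))
  where
  m = suc (double j)
  i<m : ∀ {i} → i ℕ.≤ n → i ℕ.< m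
  i<m i≤n = s≤s (ℕ.≤-trans i≤n (ℕ.≤-trans n≤j (n≤double j)))

S≈lim : S ≈ lim factors
S≈lim .at n = at (partial n) n
  where
  partial : ∀ N → series (partialProd N) ≈ prod factors N
  partial zero    = coeffwise (λ { zero → refl ; (suc n) → refl })
  partial (suc N) = ≈-trans (coeffwise (λ _ → refl)) (·-cong (partial N) (≈-refl {factors (suc N)}))

-- Factor j of S is α(q^m)/α(q^(3m)) with m = 2j - 1, and its denominators multiply to A(q³).
S-quotient : S · sub 3 A ≈ A
S-quotient = begin
  S · sub 3 A
    ≈⟨ ·-cong S≈lim (lim-σ (sub-isSubstitution 3) flat-A-factor) ⟩
  lim factors · lim (λ j → sub 3 (A-factor j))
    ≈⟨ lim-· flat-factors flat-sub3-A ⟩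
  lim (λ j → factors j · sub 3 (A-factor j))
    ≈⟨ lim-cong each ⟩
  A ∎
  where
  open ≈-Reasoning
  sub3-A : ∀ j → sub 3 (A-factor (suc j)) ≈ sub (3 ℕ.* suc (double j)) α
  sub3-A j = subst (λ s → sub 3 s ≈ sub (3 ℕ.* suc (double j)) α) (sym (A-factor≡ j))
    (sub-sub 3 (suc (double j)) (3 ℕ.* suc (double j)) (ℕ.*-comm (suc (double j)) 3) α)
  flat-sub3-A : Flat (λ j → sub 3 (A-factor j))
  flat-sub3-A j n n≤j = trans
    (Sub.σ-local 3 n (A-factor (suc j)) (# 1) (λ i i≤n → flat-A-factor j i (ℕ.≤-trans i≤n n≤j)) n ℕ.≤-refl)
    (at (Sub.σ-κ 3 (+ 1)) n)
  each : ∀ j → factors (suc j) · sub 3 (A-factor (suc j)) ≈ A-factor (suc j)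
  each j = begin
    factors (suc j) · sub 3 (A-factor (suc j))
      ≈⟨ ·-cong (factors≈ j) (sub3-A j) ⟩
    sub m α · sub (3 ℕ.* m) (neg α) · sub (3 ℕ.* m) α
      ≈⟨ solve 3 (λ x y z → x :* y :* z := x :* (z :* y)) ≈-refl (sub m α) (sub (3 ℕ.* m) (neg α)) (sub (3 ℕ.* m) α) ⟩
    sub m α · (sub (3 ℕ.* m) α · sub (3 ℕ.* m) (neg α))
      ≈⟨ ≈-trans (·-cong ≈-refl (sub-α-inverse (3 ℕ.* m))) (·-identityʳ _) ⟩
    sub m α
      ≈⟨ subst (λ s → sub m α ≈ s) (sym (A-factor≡ j)) ≈-refl ⟩
    A-factor (suc j) ∎
    where m = suc (double j)

-- Divisibility by 3

∣-sumTo : ∀ {m} n f → (∀ i → i ℕ.≤ n → m ∣ₛ f i) → m ∣ₛ sumTo n f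
∣-sumTo zero    f h = h 0 z≤n
∣-sumTo (suc n) f h = ℤ.∣m∣n⇒∣m+n (∣-sumTo n f (λ i i≤n → h i (ℕ.m≤n⇒m≤1+n i≤n))) (h (suc n) ℕ.≤-refl)

κ-factor : ∀ m f → (∀ n → m ∣ₛ f [ n ]) → ∃ λ h → f ≈ κ m · h
κ-factor m f div = h , coeffwise λ n → trans (_∣ₛ_.equality (div n))
  (trans (ℤ.*-comm (h [ n ]) m) (sym (κ·-at n m h)))
  where
  h : ℤ⟦q⟧
  h [ n ] = _∣ₛ_.quotient (div n)

∣κ· : ∀ m h n → m ∣ₛ (κ m · h) [ n ]
∣κ· m h n = divides (h [ n ]) (trans (κ·-at n m h) (ℤ.*-comm m (h [ n ])))

-- Modulo m the hypothesis says that D f is q^k times D of the tail; as k ≥ 1, induction on the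
-- index applies. Used for D f = f^k - f(q^k) with k = m prime.
tl-divisible : ∀ m k .{{_ : NonZero k}} (D r : ℤ⟦q⟧ → ℤ⟦q⟧) →
  (∀ f → D f ≈ κ m · r f ⊕ q^ k · D (tl f)) → ∀ f → ∃ λ h → D f ≈ κ m · h
tl-divisible m k@(suc _) D r eq f = κ-factor m (D f) (λ n → <-rec P step n f)
  where
  P : ℕ → Set
  P n = ∀ f → m ∣ₛ D f [ n ]
  step : ∀ n → (∀ {i} → i ℕ.< n → P i) → P n
  step n ih f = subst (m ∣ₛ_) (sym (at (eq f) n)) (ℤ.∣m∣n⇒∣m+n (∣κ· m (r f) n) shifted)
    where
    shifted : m ∣ₛ (q^ k · D (tl f)) [ n ]
    shifted with n ℕ.<? k
    ... | yes n<k = subst (m ∣ₛ_) (sym (q^·-low k (D (tl f)) n n<k)) (divides (+ 0) refl)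
    ... | no n≮k with ℕ.m≤n⇒∃[o]m+o≡n (ℕ.≮⇒≥ n≮k)
    ... | j , refl = subst (m ∣ₛ_) (sym (q^·-shift k (D (tl f)) j)) (ih (ℕ.m<n+m j (s≤s z≤n)) (tl f))

square-mod-2 : ∀ c → + 2 ∣ₛ c ℤ.* c ℤ.- c
square-mod-2 c = subst (λ c → + 2 ∣ₛ c ℤ.* c ℤ.- c) (sym (ℤ.a≡a%ℕn+[a/ℕn]*n c 2))
  (residues (c ℤ.%ℕ 2) (c ℤ./ℕ 2) (ℤ.n%ℕd<d c 2))
  where
  even : ∀ q → (+ 0 ℤ.+ q ℤ.* + 2) ℤ.* (+ 0 ℤ.+ q ℤ.* + 2) ℤ.- (+ 0 ℤ.+ q ℤ.* + 2) ≡ (q ℤ.* q ℤ.* + 2 ℤ.- q) ℤ.* + 2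
  even = solve-∀
  odd′ : ∀ q → (+ 1 ℤ.+ q ℤ.* + 2) ℤ.* (+ 1 ℤ.+ q ℤ.* + 2) ℤ.- (+ 1 ℤ.+ q ℤ.* + 2) ≡ (q ℤ.* q ℤ.* + 2 ℤ.+ q) ℤ.* + 2
  odd′ = solve-∀
  residues : ∀ r q → r ℕ.< 2 → + 2 ∣ₛ (+ r ℤ.+ q ℤ.* + 2) ℤ.* (+ r ℤ.+ q ℤ.* + 2) ℤ.- (+ r ℤ.+ q ℤ.* + 2)
  residues 0 q _ = divides (q ℤ.* q ℤ.* + 2 ℤ.- q) (even q)
  residues 1 q _ = divides (q ℤ.* q ℤ.* + 2 ℤ.+ q) (odd′ q)
  residues (suc (suc r)) q (s≤s (s≤s ()))

cube-mod-3 : ∀ c → + 3 ∣ₛ c ℤ.* c ℤ.* c ℤ.- c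
cube-mod-3 c = subst (λ c → + 3 ∣ₛ c ℤ.* c ℤ.* c ℤ.- c) (sym (ℤ.a≡a%ℕn+[a/ℕn]*n c 3))
  (residues (c ℤ.%ℕ 3) (c ℤ./ℕ 3) (ℤ.n%ℕd<d c 3))
  where
  mid : ℤ → ℤ → ℤ
  mid r q = + 3 ℤ.* r ℤ.* r ℤ.* q ℤ.+ + 9 ℤ.* r ℤ.* q ℤ.* q ℤ.+ + 9 ℤ.* q ℤ.* q ℤ.* q ℤ.- q
  cubic : ℤ → ℤ → ℤ
  cubic r q = (r ℤ.+ q ℤ.* + 3) ℤ.* (r ℤ.+ q ℤ.* + 3) ℤ.* (r ℤ.+ q ℤ.* + 3) ℤ.- (r ℤ.+ q ℤ.* + 3)
  expanded : ∀ r q → (r ℤ.+ q ℤ.* + 3) ℤ.* (r ℤ.+ q ℤ.* + 3) ℤ.* (r ℤ.+ q ℤ.* + 3) ℤ.- (r ℤ.+ q ℤ.* + 3)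
    ≡ (r ℤ.* r ℤ.* r ℤ.- r) ℤ.+ (+ 3 ℤ.* r ℤ.* r ℤ.* q ℤ.+ + 9 ℤ.* r ℤ.* q ℤ.* q ℤ.+ + 9 ℤ.* q ℤ.* q ℤ.* q ℤ.- q) ℤ.* + 3
  expanded = solve-∀
  reduce : ∀ r q → + 3 ∣ₛ (r ℤ.* r ℤ.* r ℤ.- r) → + 3 ∣ₛ cubic r q
  reduce r q div = subst (+ 3 ∣ₛ_) (sym (expanded r q)) (ℤ.∣m∣n⇒∣m+n div (divides (mid r q) refl))
  residues : ∀ r q → r ℕ.< 3 → + 3 ∣ₛ cubic (+ r) q
  residues 0 q _ = reduce (+ 0) q (divides (+ 0) refl)
  residues 1 q _ = reduce (+ 1) q (divides (+ 0) refl)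
  residues 2 q _ = reduce (+ 2) q (divides (+ 2) refl)
  residues (suc (suc (suc r))) q (s≤s (s≤s (s≤s ())))

κ-- : ∀ x y → κ (x ℤ.- y) ≈ κ x ⊕ ⊖ κ y
κ-- x y = coeffwise λ { zero → refl ; (suc n) → refl }

κ-· : ∀ x y → κ (x ℤ.* y) ≈ κ x · κ y
κ-· x y = coeffwise λ { zero → refl ; (suc n) → sym (trans (κ·-at (suc n) x (κ y)) (ℤ.*-zeroʳ x)) }

-- With f = k + q t, the difference f² - f(q²) is k² - k, plus 2 k q t, plus q² times the same
-- difference for t. Fermat's congruence settles the constant term. The cubic case has the same
-- shape.
frobenius₂ : ∀ f → ∃ λ h → f · f ⊕ ⊖ sub 2 f ≈ # 2 · h
frobenius₂ = tl-divisible (+ 2) 2 (λ f → f · f ⊕ ⊖ sub 2 f)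
  (λ f → κ (g f) ⊕ κ (f [ 0 ]) · (q^ 1 · tl f))
  (λ f → let k = κ (f [ 0 ]) ; t = tl f ; q = q^ 1 in begin
    f · f ⊕ ⊖ sub 2 f
      ≈⟨ ⊕-cong (·-cong (expand f) (expand f)) (⊖-cong (≈-trans (IsSubstitution.unfold (sub-isSubstitution 2) f)
           (⊕-cong ≈-refl (·-cong (q^-+ 1 1) ≈-refl)))) ⟩
    (k ⊕ q · t) · (k ⊕ q · t) ⊕ ⊖ (k ⊕ q · q · sub 2 t)
      ≈⟨ solve 4 (λ k q t s → (k :+ q :* t) :* (k :+ q :* t) :- (k :+ q :* q :* s) :=
           (k :* k :- k) :+ con (+ 2) :* (k :* (q :* t)) :+ q :* q :* (t :* t :- s)) ≈-refl k q t (sub 2 t) ⟩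
    (k · k ⊕ ⊖ k) ⊕ # 2 · (k · (q · t)) ⊕ q · q · (t · t ⊕ ⊖ sub 2 t)
      ≈⟨ ⊕-cong (⊕-cong (κ-g f) ≈-refl) (·-cong (≈-sym (q^-+ 1 1)) ≈-refl) ⟩
    # 2 · κ (g f) ⊕ # 2 · (k · (q · t)) ⊕ q^ 2 · (t · t ⊕ ⊖ sub 2 t)
      ≈⟨ ⊕-cong (solve 2 (λ x y → con (+ 2) :* x :+ con (+ 2) :* y := con (+ 2) :* (x :+ y)) ≈-refl (κ (g f)) (k · (q · t))) ≈-refl ⟩
    # 2 · (κ (g f) ⊕ k · (q · t)) ⊕ q^ 2 · (t · t ⊕ ⊖ sub 2 t) ∎)
  where
  open ≈-Reasoning
  g : ℤ⟦q⟧ → ℤ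
  g f = _∣ₛ_.quotient (square-mod-2 (f [ 0 ]))
  κ-g : ∀ f → κ (f [ 0 ]) · κ (f [ 0 ]) ⊕ ⊖ κ (f [ 0 ]) ≈ # 2 · κ (g f)
  κ-g f = let c = f [ 0 ] in begin
    κ c · κ c ⊕ ⊖ κ c        ≈⟨ ≈-trans (κ-- (c ℤ.* c) c) (⊕-cong (κ-· c c) ≈-refl) ⟨
    κ (c ℤ.* c ℤ.- c)        ≡⟨ cong κ (trans (_∣ₛ_.equality (square-mod-2 c)) (ℤ.*-comm (g f) (+ 2))) ⟩
    κ (+ 2 ℤ.* g f)          ≈⟨ κ-· (+ 2) (g f) ⟩
    # 2 · κ (g f)            ∎

frobenius₃ : ∀ f → ∃ λ h → f · f · f ⊕ ⊖ sub 3 f ≈ # 3 · h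
frobenius₃ = tl-divisible (+ 3) 3 (λ f → f · f · f ⊕ ⊖ sub 3 f)
  (λ f → κ (g f) ⊕ (κ (f [ 0 ]) · κ (f [ 0 ]) · (q^ 1 · tl f) ⊕ κ (f [ 0 ]) · (q^ 1 · tl f) · (q^ 1 · tl f)))
  (λ f → let k = κ (f [ 0 ]) ; t = tl f ; q = q^ 1 in begin
    f · f · f ⊕ ⊖ sub 3 f
      ≈⟨ ⊕-cong (·-cong (·-cong (expand f) (expand f)) (expand f)) (⊖-cong (≈-trans (IsSubstitution.unfold (sub-isSubstitution 3) f)
           (⊕-cong ≈-refl (·-cong q³ ≈-refl)))) ⟩
    (k ⊕ q · t) · (k ⊕ q · t) · (k ⊕ q · t) ⊕ ⊖ (k ⊕ q · q · q · sub 3 t)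
      ≈⟨ solve 4 (λ k q t s → (k :+ q :* t) :* (k :+ q :* t) :* (k :+ q :* t) :- (k :+ q :* q :* q :* s) :=
           (k :* k :* k :- k) :+ con (+ 3) :* (k :* k :* (q :* t) :+ k :* (q :* t) :* (q :* t)) :+ q :* q :* q :* (t :* t :* t :- s))
           ≈-refl k q t (sub 3 t) ⟩
    (k · k · k ⊕ ⊖ k) ⊕ # 3 · (k · k · (q · t) ⊕ k · (q · t) · (q · t)) ⊕ q · q · q · (t · t · t ⊕ ⊖ sub 3 t)
      ≈⟨ ⊕-cong (⊕-cong (κ-g f) ≈-refl) (·-cong (≈-sym q³) ≈-refl) ⟩
    # 3 · κ (g f) ⊕ # 3 · (k · k · (q · t) ⊕ k · (q · t) · (q · t)) ⊕ q^ 3 · (t · t · t ⊕ ⊖ sub 3 t)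
      ≈⟨ ⊕-cong (solve 2 (λ x y → con (+ 3) :* x :+ con (+ 3) :* y := con (+ 3) :* (x :+ y)) ≈-refl
           (κ (g f)) (k · k · (q · t) ⊕ k · (q · t) · (q · t))) ≈-refl ⟩
    # 3 · (κ (g f) ⊕ (k · k · (q · t) ⊕ k · (q · t) · (q · t))) ⊕ q^ 3 · (t · t · t ⊕ ⊖ sub 3 t) ∎)
  where
  open ≈-Reasoning
  q³ : q^ 3 ≈ q^ 1 · q^ 1 · q^ 1
  q³ = ≈-trans (q^-+ 2 1) (·-cong (q^-+ 1 1) ≈-refl)
  g : ℤ⟦q⟧ → ℤ
  g f = _∣ₛ_.quotient (cube-mod-3 (f [ 0 ]))
  κ-g : ∀ f → κ (f [ 0 ]) · κ (f [ 0 ]) · κ (f [ 0 ]) ⊕ ⊖ κ (f [ 0 ]) ≈ # 3 · κ (g f)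
  κ-g f = let c = f [ 0 ] in begin
    κ c · κ c · κ c ⊕ ⊖ κ c
      ≈⟨ ≈-trans (κ-- (c ℤ.* c ℤ.* c) c) (⊕-cong (≈-trans (κ-· (c ℤ.* c) c) (·-cong (κ-· c c) ≈-refl)) ≈-refl) ⟨
    κ (c ℤ.* c ℤ.* c ℤ.- c)
      ≡⟨ cong κ (trans (_∣ₛ_.equality (cube-mod-3 c)) (ℤ.*-comm (g f) (+ 3))) ⟩
    κ (+ 3 ℤ.* g f)
      ≈⟨ κ-· (+ 3) (g f) ⟩
    # 3 · κ (g f) ∎

-- O starts with the coefficient of q in A², which is 4, and A⁴ starts with 1.
Z[0] : Z [ 0 ] ≡ + 4
Z[0] = refl

·-mod : ∀ m {f g f′ g′ h h′} → f ≈ g ⊕ κ m · h → f′ ≈ g′ ⊕ κ m · h′ →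
  ∃ λ k → f · f′ ≈ g · g′ ⊕ κ m · k
·-mod m {f} {g} {f′} {g′} {h} {h′} eq eq′ = g · h′ ⊕ h · g′ ⊕ κ m · h · h′ ,
  ≈-trans (·-cong eq eq′) (solve 5 (λ g h g′ h′ m →
    (g :+ m :* h) :* (g′ :+ m :* h′) := g :* g′ :+ m :* (g :* h′ :+ h :* g′ :+ m :* h :* h′)) ≈-refl g h g′ h′ (κ m))

cube-mod : ∀ f → ∃ λ h → f · f · f ≈ sub 3 f ⊕ # 3 · h
cube-mod f = let h , eq = frobenius₃ f in h ,
  ≈-trans (solve 2 (λ c s → c := s :+ (c :- s)) ≈-refl (f · f · f) (sub 3 f)) (⊕-cong ≈-refl eq)

twelfth-power-mod : ∀ f → ∃ λ h →
  f · f · f · (f · f · f) · (f · f · f · (f · f · f)) ≈ sub 3 (f · f · (f · f)) ⊕ # 3 · h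
twelfth-power-mod f =
  let h , eq   = cube-mod f
      h₂ , eq₂ = ·-mod (+ 3) eq eq
      h₄ , eq₄ = ·-mod (+ 3) eq₂ eq₂
  in h₄ , ≈-trans eq₄ (⊕-cong (≈-sym
       (≈-trans (Sub.σ-· 3 (f · f) (f · f)) (·-cong (Sub.σ-· 3 f f) (Sub.σ-· 3 f f)))) ≈-refl)

Z-square-mod-3 : ∃ λ h → Z · Z ≈ sub 3 (# 4 · A⁴) · sub 2 Z ⊕ # 3 · h
Z-square-mod-3 = let h , eq = twelfth-power-mod A in # 4 · h · sub 2 Z , (begin
  Z · Z
    ≈⟨ Z-square ⟩
  # 4 · (A · A · A · (A · A · A) · (A · A · A · (A · A · A)) · sub 2 Z)
    ≈⟨ ·-cong ≈-refl (·-cong eq ≈-refl) ⟩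
  # 4 · ((sub 3 A⁴ ⊕ # 3 · h) · sub 2 Z)
    ≈⟨ solve 3 (λ x h z → con (+ 4) :* ((x :+ con (+ 3) :* h) :* z) :=
         (con (+ 4) :* x) :* z :+ con (+ 3) :* (con (+ 4) :* h :* z)) ≈-refl (sub 3 A⁴) h (sub 2 Z) ⟩
  # 4 · sub 3 A⁴ · sub 2 Z ⊕ # 3 · (# 4 · h · sub 2 Z)
    ≈⟨ ⊕-cong (·-cong (≈-sym (Sub.σ-scale 3 (+ 4) A⁴)) ≈-refl) ≈-refl ⟩
  sub 3 (# 4 · A⁴) · sub 2 Z ⊕ # 3 · (# 4 · h · sub 2 Z) ∎)
  where open ≈-Reasoning

square-at-1 : ∀ f → (f · f) [ 1 ] ≡ + 2 ℤ.* (f [ 0 ] ℤ.* f [ 1 ])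
square-at-1 f = collect (f [ 0 ]) (f [ 1 ])
  where
  collect : ∀ x y → x ℤ.* y ℤ.+ y ℤ.* x ≡ + 2 ℤ.* (x ℤ.* y)
  collect = solve-∀

-- Isolates the two end terms of the convolution, the only ones in which the coefficient of top
-- index occurs.
square-ends : ∀ f m → (f · f) [ suc (suc m) ] ≡ (tl f · tl f) [ m ] ℤ.+ + 2 ℤ.* (f [ 0 ] ℤ.* f [ suc (suc m) ])
square-ends f m = begin
  (f · f) [ suc (suc m) ]
    ≡⟨ ·-head f f (suc m) ⟩
  f [ 0 ] ℤ.* z ℤ.+ (tl f · f) [ suc m ]
    ≡⟨ cong (λ t → f [ 0 ] ℤ.* z ℤ.+ t) (⊛-last (tl f [_]) (f [_]) m) ⟩
  f [ 0 ] ℤ.* z ℤ.+ ((tl f · tl f) [ m ] ℤ.+ z ℤ.* f [ 0 ])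
    ≡⟨ collect (f [ 0 ]) z ((tl f · tl f) [ m ]) ⟩
  (tl f · tl f) [ m ] ℤ.+ + 2 ℤ.* (f [ 0 ] ℤ.* z) ∎
  where
  open ≡-Reasoning
  z = f [ suc (suc m) ]
  collect : ∀ x z t → x ℤ.* z ℤ.+ (t ℤ.+ z ℤ.* x) ≡ t ℤ.+ + 2 ℤ.* (x ℤ.* z)
  collect = solve-∀

2Z[0] : ∀ z → + 2 ℤ.* (Z [ 0 ] ℤ.* z) ≡ + 8 ℤ.* z
2Z[0] z = trans (cong (λ c → + 2 ℤ.* (c ℤ.* z)) Z[0]) (sym (ℤ.*-assoc (+ 2) (+ 4) z))

-- In Z² ≡ 4A(q³)⁴ Z(q²) every term at n other than 2 Z₀ Zₙ has a factor Zₘ with m < n and 3 ∤ m,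
-- or is zero.
Z-mod-3 : ∀ n → ¬ 3 ℕ.∣ n → + 3 ∣ₛ Z [ n ]
Z-mod-3 = <-rec P step
  where
  P : ℕ → Set
  P n = ¬ 3 ℕ.∣ n → + 3 ∣ₛ Z [ n ]
  0∣ : ∀ {z} → z ≡ + 0 → + 3 ∣ₛ z
  0∣ eq = subst (+ 3 ∣ₛ_) (sym eq) (divides (+ 0) refl)

  module _ (n : ℕ) (ih : ∀ {m} → m ℕ.< n → P m) (3∤n : ¬ 3 ℕ.∣ n) where
    right : + 3 ∣ₛ (sub 3 (# 4 · A⁴) · sub 2 Z) [ n ]
    right = ∣-sumTo n _ term
      where
      term : ∀ i → i ℕ.≤ n → + 3 ∣ₛ sub 3 (# 4 · A⁴) [ i ] ℤ.* sub 2 Z [ n ℕ.∸ i ]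
      term i i≤n with 3 ℕ.∣? i
      ... | no 3∤i = 0∣ (trans (cong (ℤ._* sub 2 Z [ n ℕ.∸ i ]) (sub-nonmultiple 3 (# 4 · A⁴) i 3∤i)) (ℤ.*-zeroˡ (sub 2 Z [ n ℕ.∸ i ])))
      ... | yes 3∣i with 2 ℕ.∣? (n ℕ.∸ i)
      ... | no 2∤j = 0∣ (trans (cong (sub 3 (# 4 · A⁴) [ i ] ℤ.*_) (sub-nonmultiple 2 Z (n ℕ.∸ i) 2∤j)) (ℤ.*-zeroʳ (sub 3 (# 4 · A⁴) [ i ])))
      ... | yes (ℕ.divides k j≡k*2) = ℤ.∣n⇒∣m*n (sub 3 (# 4 · A⁴) [ i ])
        (subst (+ 3 ∣ₛ_) (sym (trans (cong (λ j → sub 2 Z [ j ]) j≡k*2) (sub-multiple 2 Z k))) (ih k<n 3∤k))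
        where
        3∤k : ¬ 3 ℕ.∣ k
        3∤k 3∣k = 3∤n (subst (3 ℕ.∣_) (ℕ.m∸n+n≡m i≤n)
          (ℕ.∣m∣n⇒∣m+n (subst (3 ℕ.∣_) (sym j≡k*2) (ℕ.∣m⇒∣m*n 2 3∣k)) 3∣i))
        k<k*2 : ∀ k → ¬ 3 ℕ.∣ k → k ℕ.< k ℕ.* 2
        k<k*2 zero      3∤0 = contradiction (3 ℕ.∣0) 3∤0
        k<k*2 k@(suc _) _   = ℕ.m<m*n k 2 (s≤s (s≤s z≤n))
        k<n : k ℕ.< n
        k<n = ℕ.<-≤-trans (subst (k ℕ.<_) (sym j≡k*2) (k<k*2 k 3∤k)) (ℕ.m∸n≤m n i)

  8∣⇒ : ∀ {z} → + 3 ∣ₛ + 8 ℤ.* z → + 3 ∣ₛ z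
  8∣⇒ {z} 3∣8z = subst (+ 3 ∣ₛ_) (9-8 z) (ℤ.∣m∣n⇒∣m-n (ℤ.∣m⇒∣m*n z (divides (+ 3) refl)) 3∣8z)
    where
    9-8 : ∀ z → + 9 ℤ.* z ℤ.- + 8 ℤ.* z ≡ z
    9-8 = solve-∀

  square-tail : ∀ m → (∀ {i} → i ℕ.< m → P i) → ¬ 3 ℕ.∣ m → ∃ λ k → + 3 ∣ₛ k × (Z · Z) [ m ] ≡ k ℤ.+ + 8 ℤ.* Z [ m ]
  square-tail zero ih 3∤0 = contradiction (3 ℕ.∣0) 3∤0
  square-tail (suc zero) ih _ = + 0 , divides (+ 0) refl ,
    trans (square-at-1 Z) (trans (2Z[0] (Z [ 1 ])) (sym (ℤ.+-identityˡ _)))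
  square-tail (suc (suc m)) ih 3∤n = (tl Z · tl Z) [ m ] , ∣-sumTo m _ term ,
    trans (square-ends Z m) (cong (λ t → (tl Z · tl Z) [ m ] ℤ.+ t) (2Z[0] (Z [ suc (suc m) ])))
    where
    term : ∀ i → i ℕ.≤ m → + 3 ∣ₛ tl Z [ i ] ℤ.* tl Z [ m ℕ.∸ i ]
    term i i≤m with 3 ℕ.∣? suc i
    ... | no 3∤i = ℤ.∣m⇒∣m*n (tl Z [ m ℕ.∸ i ]) (ih (s≤s (s≤s i≤m)) 3∤i)
    ... | yes 3∣i = ℤ.∣n⇒∣m*n (tl Z [ i ]) (ih (s≤s (s≤s (ℕ.m∸n≤m m i))) 3∤j)
      where
      3∤j : ¬ 3 ℕ.∣ suc (m ℕ.∸ i)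
      3∤j 3∣j = 3∤n (subst (3 ℕ.∣_) (cong suc (trans (ℕ.+-suc i (m ℕ.∸ i)) (cong suc (ℕ.m+[n∸m]≡n i≤m)))) (ℕ.∣m∣n⇒∣m+n 3∣i 3∣j))

  step : ∀ n → (∀ {m} → m ℕ.< n → P m) → P n
  step n ih 3∤n =
    let k , 3∣k , eq = square-tail n ih 3∤n
        h , sq       = Z-square-mod-3
    in 8∣⇒ (ℤ.∣m+n∣m⇒∣n (subst (+ 3 ∣ₛ_) (trans (sym (at sq n)) eq)
    (ℤ.∣m∣n⇒∣m+n (right n ih 3∤n) (∣κ· (+ 3) h n))) 3∣k)

-- Since AB = 1, S = S A³ B³ ≡ S A(q³) B³ = A B³ = B² modulo 3.
S-mod-3 : ∃ λ h → S ≈ B · B ⊕ # 3 · h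
S-mod-3 = let h , eq = frobenius₃ A in S · h · (B · B · B) , (begin
  S
    ≈⟨ ·-identityʳ S ⟨
  S · # 1
    ≈⟨ ·-cong ≈-refl (≈-trans (·-cong (·-cong AB AB) AB) (≈-trans (·-identityʳ _) (·-identityˡ _))) ⟨
  S · (A · B · (A · B) · (A · B))
    ≈⟨ solve 4 (λ S a b s → S :* (a :* b :* (a :* b) :* (a :* b)) := (S :* s) :* (b :* b :* b) :+ S :* (a :* a :* a :- s) :* (b :* b :* b)) ≈-refl S A B (sub 3 A) ⟩
  S · sub 3 A · (B · B · B) ⊕ S · (A · A · A ⊕ ⊖ sub 3 A) · (B · B · B)
    ≈⟨ ⊕-cong (·-cong S-quotient ≈-refl) (·-cong (·-cong ≈-refl eq) ≈-refl) ⟩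
  A · (B · B · B) ⊕ S · (# 3 · h) · (B · B · B)
    ≈⟨ solve 4 (λ S a b h → a :* (b :* b :* b) :+ S :* (con (+ 3) :* h) :* (b :* b :* b) :=
         (a :* b) :* (b :* b) :+ con (+ 3) :* (S :* h :* (b :* b :* b))) ≈-refl S A B h ⟩
  A · B · (B · B) ⊕ # 3 · (S · h · (B · B · B))
    ≈⟨ ⊕-cong (≈-trans (·-cong AB ≈-refl) (·-identityˡ _)) ≈-refl ⟩
  B · B ⊕ # 3 · (S · h · (B · B · B)) ∎)
  where open ≈-Reasoning

neg-at-double : ∀ f n → neg f [ double n ] ≡ f [ double n ]
neg-at-double f zero    = refl
neg-at-double f (suc n) = trans (ℤ.neg-involutive _) (neg-at-double (tl (tl f)) n)

-- The index is 4k + 2. Being even, it carries the same coefficient in B² as in A²; halving twice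
-- leads to A⁴ at 2k + 1 and then to 2Z at k.
3∣S3bar : ∀ k → ¬ 3 ℕ.∣ k → + 3 ∣ₛ S3bar (double (suc (double k)))
3∣S3bar k 3∤k = let h , eq = S-mod-3 in subst (+ 3 ∣ₛ_) (sym (at eq N)) (ℤ.∣m∣n⇒∣m+n
  (subst (+ 3 ∣ₛ_) (sym B²-at) (∣n⇒∣2n (Z-mod-3 k 3∤k))) (∣κ· (+ 3) h N))
  where
  open ≡-Reasoning
  N = double (suc (double k))
  ∣n⇒∣2n : ∀ {z} → + 3 ∣ₛ z → + 3 ∣ₛ + 2 ℤ.* z
  ∣n⇒∣2n = ℤ.∣n⇒∣m*n (+ 2)
  B²-at : (B · B) [ N ] ≡ + 2 ℤ.* Z [ k ]
  B²-at = begin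
    (B · B) [ N ]                ≡⟨ at (Neg.σ-· A A) N ⟨
    neg (A · A) [ N ]            ≡⟨ neg-at-double (A · A) (suc (double k)) ⟩
    (A · A) [ N ]                ≡⟨ at ev-A² (suc (double k)) ⟩
    A⁴ [ suc (double k) ]        ≡⟨ at od-A⁴ k ⟩
    (# 2 · Z) [ k ]              ≡⟨ κ·-at k (+ 2) Z ⟩
    + 2 ℤ.* Z [ k ]              ∎

-- Divisibility by 8

-- The sum of (-1)^x q^(x²) over x ≥ 1, supported on squares like θ.
τ : ℤ⟦q⟧
τ = neg θ

F≈1+2τ : F ≈ # 1 ⊕ # 2 · τ
F≈1+2τ = ≈-trans (≈-sym (neg-neg F)) (≈-trans (Neg.σ-cong neg-F)
  (≈-trans (Neg.σ-⊕ (# 1) (# 2 · θ)) (⊕-cong (Neg.σ-κ (+ 1)) (Neg.σ-scale (+ 2) θ))))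

sub-F : ∀ k .{{_ : NonZero k}} → sub k F ≈ # 1 ⊕ # 2 · sub k τ
sub-F k = ≈-trans (Sub.σ-cong k F≈1+2τ) (≈-trans (Sub.σ-⊕ k (# 1) (# 2 · τ))
  (⊕-cong (Sub.σ-κ k (+ 1)) (Sub.σ-scale k (+ 2) τ)))

S-theta-quotient : S · F · sub 6 F ≈ sub 2 F · sub 3 F
S-theta-quotient = begin
  S · F · sub 6 F
    ≈⟨ ·-cong ≈-refl (≈-trans (Sub.σ-cong 3 FA) (sub-sub 3 2 6 refl F)) ⟨
  S · F · sub 3 (F · A)
    ≈⟨ ·-cong ≈-refl (Sub.σ-· 3 F A) ⟩
  S · F · (sub 3 F · sub 3 A)
    ≈⟨ solve 4 (λ s f g a → s :* f :* (g :* a) := (f :* (s :* a)) :* g) ≈-refl S F (sub 3 F) (sub 3 A) ⟩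
  F · (S · sub 3 A) · sub 3 F
    ≈⟨ ·-cong (≈-trans (·-cong ≈-refl S-quotient) FA) ≈-refl ⟩
  sub 2 F · sub 3 F ∎
  where open ≈-Reasoning

neg-vanish : ∀ n f → f [ n ] ≡ + 0 → neg f [ n ] ≡ + 0
neg-vanish zero    f eq = eq
neg-vanish (suc n) f eq = cong -_ (neg-vanish n (tl f) eq)

sub-τ-support : ∀ k .{{_ : NonZero k}} n → (sub k τ [ n ] ≡ + 0) ⊎ (∃ λ x → n ≡ x ℕ.* x ℕ.* k)
sub-τ-support k n with k ℕ.∣? n
... | no k∤n = inj₁ (sub-nonmultiple k τ n k∤n)
... | yes (ℕ.divides j n≡j*k) with θ-support j
... | inj₁ eq         = inj₁ (trans (cong (λ m → sub k τ [ m ]) n≡j*k) (trans (sub-multiple k τ j) (neg-vanish j θ eq)))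
... | inj₂ (x , j≡x²) = inj₂ (x , trans n≡j*k (cong (ℕ._* k) j≡x²))

-- Zero is allowed for x and y, so that n = kx² and n = ly² are excluded as well. Being a record, it
-- lets k, l and n be inferred.
record NotOfForm (k l n : ℕ) : Set where
  constructor not-of-form
  field refute : ∀ x y → n ≢ x ℕ.* x ℕ.* k ℕ.+ y ℕ.* y ℕ.* l
open NotOfForm

sub-τ-vanish : ∀ k .{{_ : NonZero k}} n → (∀ x → n ≢ x ℕ.* x ℕ.* k) → sub k τ [ n ] ≡ + 0
sub-τ-vanish k n h with sub-τ-support k n
... | inj₁ eq       = eq
... | inj₂ (x , eq) = contradiction eq (h x)

sub-τ-product-vanish : ∀ k l .{{_ : NonZero k}} .{{_ : NonZero l}} {n} → NotOfForm k l n →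
  (sub k τ · sub l τ) [ n ] ≡ + 0
sub-τ-product-vanish k l {n} h = sumTo-0 n term
  where
  term : ∀ i → i ℕ.≤ n → sub k τ [ i ] ℤ.* sub l τ [ n ℕ.∸ i ] ≡ + 0
  term i i≤n with sub-τ-support k i | sub-τ-support l (n ℕ.∸ i)
  ... | inj₁ eq | _       = trans (cong (ℤ._* sub l τ [ n ℕ.∸ i ]) eq) (ℤ.*-zeroˡ (sub l τ [ n ℕ.∸ i ]))
  ... | inj₂ _  | inj₁ eq = trans (cong (sub k τ [ i ] ℤ.*_) eq) (ℤ.*-zeroʳ (sub k τ [ i ]))
  ... | inj₂ (x , i≡) | inj₂ (y , n∸i≡) =
    contradiction (trans (sym (ℕ.m+[n∸m]≡n i≤n)) (cong₂ ℕ._+_ i≡ n∸i≡)) (refute h x y)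

-- The geometric series for 1/(1+2f) modulo 8 is 1 - 2f + 4f²; the coefficients -2 and 4 are
-- represented by 6 and 12.
inverse-mod-8 : ∀ f → (# 1 ⊕ # 2 · f) · (# 1 ⊕ # 2 · (# 3 · f ⊕ # 6 · (f · f)))
  ≈ # 1 ⊕ # 8 · (f ⊕ # 3 · (f · f) ⊕ # 3 · (f · f · f))
inverse-mod-8 = solve 1 (λ f →
  (con (+ 1) :+ con (+ 2) :* f) :* (con (+ 1) :+ con (+ 2) :* (con (+ 3) :* f :+ con (+ 6) :* (f :* f))) :=
  con (+ 1) :+ con (+ 8) :* (f :+ con (+ 3) :* (f :* f) :+ con (+ 3) :* (f :* f :* f))) ≈-refl

-- Multiplies the equation by the inverses of 1 + 2a and 1 + 2d modulo 8. Terms are sorted by their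
-- power of 2: the linear ones carry 2, while the quadratic ones carry 4 and so matter only modulo
-- 2. There the squares a² and d² are series in q² again.
quotient-mod-8 : ∀ {s a b c d} →
  s · (# 1 ⊕ # 2 · a) · (# 1 ⊕ # 2 · d) ≈ (# 1 ⊕ # 2 · c) · (# 1 ⊕ # 2 · b) →
  ∃ λ h → s ≈ # 1 ⊕ # 2 · (b ⊕ c ⊕ # 3 · a ⊕ # 3 · d)
            ⊕ # 4 · (b · c ⊕ # 3 · (a · a) ⊕ # 3 · (d · d) ⊕ # 9 · (a · d) ⊕ # 3 · (a · b ⊕ c · a ⊕ b · d ⊕ c · d))
            ⊕ # 8 · h
quotient-mod-8 {s} {a} {b} {c} {d} eq = r ⊕ ⊖ (s · (u ⊕ v ⊕ # 8 · (u · v))) , (begin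
  s
    ≈⟨ solve 3 (λ s u v → s := s :* (con (+ 1) :+ con (+ 8) :* u) :* (con (+ 1) :+ con (+ 8) :* v)
         :+ con (+ 8) :* (:- (s :* (u :+ v :+ con (+ 8) :* (u :* v))))) ≈-refl s u v ⟩
  s · (# 1 ⊕ # 8 · u) · (# 1 ⊕ # 8 · v) ⊕ # 8 · e′
    ≈⟨ ⊕-cong (·-cong (·-cong ≈-refl (inverse-mod-8 a)) (inverse-mod-8 d)) ≈-refl ⟨
  s · ((# 1 ⊕ # 2 · a) · (# 1 ⊕ # 2 · x)) · ((# 1 ⊕ # 2 · d) · (# 1 ⊕ # 2 · y)) ⊕ # 8 · e′
    ≈⟨ ⊕-cong (solve 5 (λ s a x d y → s :* (a :* x) :* (d :* y) := (s :* a :* d) :* (x :* y)) ≈-refl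
         s (# 1 ⊕ # 2 · a) (# 1 ⊕ # 2 · x) (# 1 ⊕ # 2 · d) (# 1 ⊕ # 2 · y)) ≈-refl ⟩
  s · (# 1 ⊕ # 2 · a) · (# 1 ⊕ # 2 · d) · ((# 1 ⊕ # 2 · x) · (# 1 ⊕ # 2 · y)) ⊕ # 8 · e′
    ≈⟨ ⊕-cong (·-cong eq ≈-refl) ≈-refl ⟩
  (# 1 ⊕ # 2 · c) · (# 1 ⊕ # 2 · b) · ((# 1 ⊕ # 2 · x) · (# 1 ⊕ # 2 · y)) ⊕ # 8 · e′
    ≈⟨ solve 5 (λ a b c d e →
         let t = λ z → con (+ 1) :+ con (+ 2) :* z
             x = con (+ 3) :* a :+ con (+ 6) :* (a :* a)
             y = con (+ 3) :* d :+ con (+ 6) :* (d :* d)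
             w = b :+ c
             bc = b :* c
         in t c :* t b :* (t x :* t y) :+ con (+ 8) :* e :=
            con (+ 1) :+ con (+ 2) :* (b :+ c :+ con (+ 3) :* a :+ con (+ 3) :* d)
            :+ con (+ 4) :* (bc :+ con (+ 3) :* (a :* a) :+ con (+ 3) :* (d :* d) :+ con (+ 9) :* (a :* d)
              :+ con (+ 3) :* (a :* b :+ c :* a :+ b :* d :+ c :* d))
            :+ con (+ 8) :* ((con (+ 9) :* (a :* d :* (a :+ d)) :+ con (+ 18) :* (a :* a :* (d :* d))
              :+ con (+ 3) :* (a :* a :* w) :+ con (+ 3) :* (d :* d :* w)
              :+ bc :* (x :+ y) :+ (x :* y) :* (w :+ con (+ 2) :* bc)) :+ e)) ≈-refl a b c d e′ ⟩
  # 1 ⊕ # 2 · (b ⊕ c ⊕ # 3 · a ⊕ # 3 · d)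
    ⊕ # 4 · (b · c ⊕ # 3 · (a · a) ⊕ # 3 · (d · d) ⊕ # 9 · (a · d) ⊕ # 3 · (a · b ⊕ c · a ⊕ b · d ⊕ c · d))
    ⊕ # 8 · (r ⊕ e′) ∎)
  where
  open ≈-Reasoning
  u = a ⊕ # 3 · (a · a) ⊕ # 3 · (a · a · a)
  v = d ⊕ # 3 · (d · d) ⊕ # 3 · (d · d · d)
  x = # 3 · a ⊕ # 6 · (a · a)
  y = # 3 · d ⊕ # 6 · (d · d)
  e′ = ⊖ (s · (u ⊕ v ⊕ # 8 · (u · v)))
  -- The terms of degree at least 3, all of which carry a factor 8; `e′` is the error of replacing s
  -- by s(1+8u)(1+8v).
  r = # 9 · (a · d · (a ⊕ d)) ⊕ # 18 · (a · a · (d · d))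
    ⊕ # 3 · (a · a · (b ⊕ c)) ⊕ # 3 · (d · d · (b ⊕ c))
    ⊕ b · c · (x ⊕ y) ⊕ x · y · (b ⊕ c ⊕ # 2 · (b · c))

sub-1 : ∀ f → sub 1 f ≈ f
sub-1 = substitution-unique (sub-isSubstitution 1) id-isSubstitution ≈-refl

S-mod-8 : ∃ λ h → let a = sub 1 τ ; b = sub 3 τ ; c = sub 2 τ ; d = sub 6 τ in
  S ≈ # 1 ⊕ # 2 · (b ⊕ c ⊕ # 3 · a ⊕ # 3 · d)
    ⊕ # 4 · (b · c ⊕ # 3 · (a · a) ⊕ # 3 · (d · d) ⊕ # 9 · (a · d) ⊕ # 3 · (a · b ⊕ c · a ⊕ b · d ⊕ c · d))
    ⊕ # 8 · h
S-mod-8 = quotient-mod-8 (begin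
  S · (# 1 ⊕ # 2 · sub 1 τ) · (# 1 ⊕ # 2 · sub 6 τ)
    ≈⟨ ·-cong (·-cong ≈-refl (≈-trans (≈-sym (sub-F 1)) (sub-1 F))) (≈-sym (sub-F 6)) ⟩
  S · F · sub 6 F
    ≈⟨ S-theta-quotient ⟩
  sub 2 F · sub 3 F
    ≈⟨ ·-cong (sub-F 2) (sub-F 3) ⟩
  (# 1 ⊕ # 2 · sub 2 τ) · (# 1 ⊕ # 2 · sub 3 τ) ∎)
  where open ≈-Reasoning

record Divides (m N : ℕ) (f : ℤ⟦q⟧) : Set where
  constructor at-coefficient
  field divisibility : + m ∣ₛ f [ N ]
open Divides

module _ {N : ℕ} where
  vanishing : ∀ {m f} → f [ N ] ≡ + 0 → Divides m N f
  vanishing eq .divisibility = subst (_ ∣ₛ_) (sym eq) (divides (+ 0) refl)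

  respects : ∀ {m f g} → f ≈ g → Divides m N g → Divides m N f
  respects {m} eq p .divisibility = subst (+ m ∣ₛ_) (sym (at eq N)) (divisibility p)

  infixl 6 _⊕ᵈ_
  _⊕ᵈ_ : ∀ {m f g} → Divides m N f → Divides m N g → Divides m N (f ⊕ g)
  (p ⊕ᵈ r) .divisibility = ℤ.∣m∣n⇒∣m+n (divisibility p) (divisibility r)

  scaled : ∀ {m f} k → Divides m N f → Divides m N (# k · f)
  scaled {m} {f} k p .divisibility = subst (+ m ∣ₛ_) (sym (κ·-at N (+ k) f)) (ℤ.∣n⇒∣m*n (+ k) (divisibility p))

  gained : ∀ {m f} k → Divides m N f → Divides (k ℕ.* m) N (# k · f)
  gained {m} {f} k p .divisibility = subst₂ _∣ₛ_ (sym (ℤ.pos-* k m)) (sym (κ·-at N (+ k) f))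
    (ℤ.*-monoʳ-∣ (+ k) (divisibility p))

  -- f² ≡ f(q²) modulo 2, so the square of a one-variable theta series needs no form in two
  -- variables.
  square-even : ∀ {f} → sub 2 f [ N ] ≡ + 0 → Divides 2 N (f · f)
  square-even {f} eq .divisibility =
    let h , sq = frobenius₂ f
        split  = ≈-trans (solve 2 (λ f s → f :* f := s :+ (f :* f :- s)) ≈-refl f (sub 2 f)) (⊕-cong ≈-refl sq)
    in subst (+ 2 ∣ₛ_) (sym (at split N)) (ℤ.∣m∣n⇒∣m+n (subst (+ 2 ∣ₛ_) (sym eq) (divides (+ 0) refl)) (∣κ· (+ 2) h N))

-- Each monomial in the expansion modulo 8 is a theta series in one or two variables.
8∣S3bar : ∀ N → NotOfForm 1 2 N → NotOfForm 1 3 N → NotOfForm 1 6 N →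
  NotOfForm 3 2 N → NotOfForm 3 6 N → NotOfForm 2 6 N → + 8 ∣ₛ S3bar N
8∣S3bar N h₁₂ h₁₃ h₁₆ h₃₂ h₃₆ h₂₆ = let h , eq = S-mod-8 in divisibility (respects eq (
  vanishing (#1-at N N≢0)
  ⊕ᵈ scaled 2 (vanishing at₃ ⊕ᵈ vanishing at₂ ⊕ᵈ scaled 3 (vanishing at₁) ⊕ᵈ scaled 3 (vanishing at₆))
  ⊕ᵈ gained 4 (vanishing (sub-τ-product-vanish 3 2 h₃₂)
    ⊕ᵈ scaled 3 (square-even at₂′) ⊕ᵈ scaled 3 (square-even at₁₂)
    ⊕ᵈ scaled 9 (vanishing (sub-τ-product-vanish 1 6 h₁₆))
    ⊕ᵈ scaled 3 (vanishing (sub-τ-product-vanish 1 3 h₁₃)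
      ⊕ᵈ vanishing (trans (at (·-comm (sub 2 τ) (sub 1 τ)) N) (sub-τ-product-vanish 1 2 h₁₂))
      ⊕ᵈ vanishing (sub-τ-product-vanish 3 6 h₃₆) ⊕ᵈ vanishing (sub-τ-product-vanish 2 6 h₂₆)))
  ⊕ᵈ at-coefficient (∣κ· (+ 8) h N)))
  where
  N≢0 : N ≢ 0
  N≢0 = refute h₁₂ 0 0
  #1-at : ∀ n → n ≢ 0 → # 1 [ n ] ≡ + 0
  #1-at zero    n≢0 = contradiction refl n≢0
  #1-at (suc n) _   = refl
  -- The single theta series are settled by the binary forms with one variable equal to 0.
  at₁ : sub 1 τ [ N ] ≡ + 0
  at₁ = sub-τ-vanish 1 N (λ x eq → refute h₁₂ x 0 (trans eq (sym (ℕ.+-identityʳ _))))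
  at₃ : sub 3 τ [ N ] ≡ + 0
  at₃ = sub-τ-vanish 3 N (refute h₁₃ 0)
  at₂ : sub 2 τ [ N ] ≡ + 0
  at₂ = sub-τ-vanish 2 N (refute h₁₂ 0)
  at₆ : sub 6 τ [ N ] ≡ + 0
  at₆ = sub-τ-vanish 6 N (refute h₁₆ 0)
  at₂′ : sub 2 (sub 1 τ) [ N ] ≡ + 0
  at₂′ = trans (at (Sub.σ-cong 2 (sub-1 τ)) N) at₂
  -- The square of τ(q⁶) reduces to τ(q¹²), and 12x² = 3(2x)² is a value of x² + 3y².
  at₁₂ : sub 2 (sub 6 τ) [ N ] ≡ + 0
  at₁₂ = trans (at (sub-sub 2 6 12 refl τ) N)
    (sub-τ-vanish 12 N (λ x eq → refute h₁₃ 0 (2 ℕ.* x) (trans eq (quadruple x))))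
    where
    quadruple : ∀ x → x ℕ.* x ℕ.* 12 ≡ (2 ℕ.* x) ℕ.* (2 ℕ.* x) ℕ.* 3
    quadruple = ℕ-solve-∀

-- Excluding forms by congruences

residues⇒not-of-form : ∀ M .{{_ : NonZero M}} k l n r → n ℕ.% M ≡ r →
  (∀ (i j : Fin M) → (toℕ i ℕ.* toℕ i ℕ.* k ℕ.+ toℕ j ℕ.* toℕ j ℕ.* l) ℕ.% M ≢ r) → NotOfForm k l n
residues⇒not-of-form M k l n r n%M≡r avoid .refute x y n≡ = avoid (x ℕ.mod M) (y ℕ.mod M) (begin
  (toℕ (x ℕ.mod M) ℕ.* toℕ (x ℕ.mod M) ℕ.* k ℕ.+ toℕ (y ℕ.mod M) ℕ.* toℕ (y ℕ.mod M) ℕ.* l) ℕ.% M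
    ≡⟨ cong₂ (λ i j → (i ℕ.* i ℕ.* k ℕ.+ j ℕ.* j ℕ.* l) ℕ.% M) (toℕ-mod x) (toℕ-mod y) ⟩
  (x ℕ.% M ℕ.* (x ℕ.% M) ℕ.* k ℕ.+ y ℕ.% M ℕ.* (y ℕ.% M) ℕ.* l) ℕ.% M
    ≡⟨ ℕ.%-distribˡ-+ (x ℕ.% M ℕ.* (x ℕ.% M) ℕ.* k) _ M ⟩
  ((x ℕ.% M ℕ.* (x ℕ.% M) ℕ.* k) ℕ.% M ℕ.+ (y ℕ.% M ℕ.* (y ℕ.% M) ℕ.* l) ℕ.% M) ℕ.% M
    ≡⟨ cong₂ (λ i j → (i ℕ.+ j) ℕ.% M) (square x k) (square y l) ⟩
  ((x ℕ.* x ℕ.* k) ℕ.% M ℕ.+ (y ℕ.* y ℕ.* l) ℕ.% M) ℕ.% M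
    ≡⟨ ℕ.%-distribˡ-+ (x ℕ.* x ℕ.* k) _ M ⟨
  (x ℕ.* x ℕ.* k ℕ.+ y ℕ.* y ℕ.* l) ℕ.% M
    ≡⟨ cong (ℕ._% M) n≡ ⟨
  n ℕ.% M
    ≡⟨ n%M≡r ⟩
  r ∎)
  where
  open ≡-Reasoning
  toℕ-mod : ∀ x → toℕ (x ℕ.mod M) ≡ x ℕ.% M
  toℕ-mod x = Fin.toℕ-fromℕ< (ℕ.m%n<n x M)
  square : ∀ x k → (x ℕ.% M ℕ.* (x ℕ.% M) ℕ.* k) ℕ.% M ≡ (x ℕ.* x ℕ.* k) ℕ.% M
  square x k = begin
    (x ℕ.% M ℕ.* (x ℕ.% M) ℕ.* k) ℕ.% M
      ≡⟨ ℕ.%-distribˡ-* (x ℕ.% M ℕ.* (x ℕ.% M)) k M ⟩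
    ((x ℕ.% M ℕ.* (x ℕ.% M)) ℕ.% M ℕ.* (k ℕ.% M)) ℕ.% M
      ≡⟨ cong (λ s → (s ℕ.* (k ℕ.% M)) ℕ.% M) (ℕ.%-distribˡ-* x x M) ⟨
    ((x ℕ.* x) ℕ.% M ℕ.* (k ℕ.% M)) ℕ.% M
      ≡⟨ ℕ.%-distribˡ-* (x ℕ.* x) k M ⟨
    (x ℕ.* x ℕ.* k) ℕ.% M ∎

avoids? : ∀ M .{{_ : NonZero M}} k l r →
  Dec (∀ (i j : Fin M) → (toℕ i ℕ.* toℕ i ℕ.* k ℕ.+ toℕ j ℕ.* toℕ j ℕ.* l) ℕ.% M ≢ r)
avoids? M k l r = Fin.all? (λ i → Fin.all? (λ j →
  ¬? ((toℕ i ℕ.* toℕ i ℕ.* k ℕ.+ toℕ j ℕ.* toℕ j ℕ.* l) ℕ.% M ℕ.≟ r)))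

-- The residues 10 modulo 16, 2 modulo 4 and 1 modulo 3 exclude five of the forms. For x² + 2y²
-- modulus 8 would be too small, since 2 = 0² + 2·1².
8∣S3bar-48m+10 : ∀ m → NotOfForm 1 6 (10 ℕ.+ m ℕ.* 48) → + 8 ∣ₛ S3bar (10 ℕ.+ m ℕ.* 48)
8∣S3bar-48m+10 m h₁₆ = 8∣S3bar N
  (residues⇒not-of-form 16 1 2 N 10 (mod 16 3 refl) (from-yes (avoids? 16 1 2 10)))
  (residues⇒not-of-form 4 1 3 N 2 (mod 4 12 refl) (from-yes (avoids? 4 1 3 2)))
  h₁₆
  (residues⇒not-of-form 3 3 2 N 1 (mod 3 16 refl) (from-yes (avoids? 3 3 2 1)))
  (residues⇒not-of-form 3 3 6 N 1 (mod 3 16 refl) (from-yes (avoids? 3 3 6 1)))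
  (residues⇒not-of-form 3 2 6 N 1 (mod 3 16 refl) (from-yes (avoids? 3 2 6 1)))
  where
  N = 10 ℕ.+ m ℕ.* 48
  mod : ∀ M .{{_ : NonZero M}} c → c ℕ.* M ≡ 48 → N ℕ.% M ≡ 10 ℕ.% M
  mod M c eq = trans (cong (λ k → (10 ℕ.+ k) ℕ.% M) (trans (cong (m ℕ.*_) (sym eq)) (sym (ℕ.*-assoc m c M))))
    (ℕ.[m+kn]%n≡m%n 10 (m ℕ.* c) M)

-- The arithmetic of the arguments

prime∤⇒coprime : ∀ {p y} → Prime p → ¬ p ℕ.∣ y → Coprime p y
prime∤⇒coprime pp p∤y (d∣p , d∣y) with prime⇒irreducible pp d∣p
... | inj₁ d≡1  = d≡1
... | inj₂ refl = contradiction d∣y p∤y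

inverse-mod-prime : ∀ {p y} → Prime p → ¬ p ℕ.∣ y → ∃₂ λ w k → w ℤ.* + y ≡ + 1 ℤ.+ k ℤ.* + p
inverse-mod-prime {p} {y} pp p∤y with coprime-Bézout (prime∤⇒coprime pp p∤y)
... | Bézout.+- u v eq = - (+ v) , - (+ u) , (begin
  - (+ v) ℤ.* + y                             ≡⟨ rearrange (+ v) (+ y) ⟩
  + 1 ℤ.- (+ 1 ℤ.+ + v ℤ.* + y)               ≡⟨ cong (λ z → + 1 ℤ.- z) lifted ⟩
  + 1 ℤ.- + u ℤ.* + p                         ≡⟨ sign (+ u) (+ p) ⟩
  + 1 ℤ.+ - (+ u) ℤ.* + p                     ∎)
  where
  open ≡-Reasoning
  lifted : + 1 ℤ.+ + v ℤ.* + y ≡ + u ℤ.* + p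
  lifted = trans (cong (λ z → + 1 ℤ.+ z) (sym (ℤ.pos-* v y))) (trans (cong +_ eq) (ℤ.pos-* u p))
  rearrange : ∀ v y → - v ℤ.* y ≡ + 1 ℤ.- (+ 1 ℤ.+ v ℤ.* y)
  rearrange = solve-∀
  sign : ∀ u p → + 1 ℤ.- u ℤ.* p ≡ + 1 ℤ.+ - u ℤ.* p
  sign = solve-∀
... | Bézout.-+ u v eq = + v , + u ,
  trans (sym (ℤ.pos-* v y)) (trans (cong +_ (sym eq)) (cong (λ z → + 1 ℤ.+ z) (ℤ.pos-* u p)))

module _ {p : ℕ} (pp : Prime p) (χ : LegendreMinusOne (- (+ 6)) p) where

  -- If y had an inverse w modulo p, then x² + 6y² ≡ 0 would give (xw)² ≡ -6, making -6 a quadratic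
  -- residue.
  ∣form⇒∣second : ∀ x y → p ℕ.∣ x * x * 1 + y * y * 6 → p ℕ.∣ y
  ∣form⇒∣second x y (ℕ.divides m form≡) with p ℕ.∣? y
  ... | yes p∣y = p∣y
  ... | no  p∤y = let w , k , inv = inverse-mod-prime pp p∤y in
    contradiction (+ x ℤ.* w , ∣⇒∣ᵤ (divides (w ℤ.* w ℤ.* + m ℤ.- + 6 ℤ.* (k ℤ.* (+ 2 ℤ.+ k ℤ.* + p))) (begin
      (+ x ℤ.* w) ℤ.* (+ x ℤ.* w) ℤ.- - (+ 6)
        ≡⟨ complete (+ x) w (+ y) ⟩
      w ℤ.* w ℤ.* (+ x ℤ.* + x ℤ.* + 1 ℤ.+ + y ℤ.* + y ℤ.* + 6) ℤ.- + 6 ℤ.* ((w ℤ.* + y) ℤ.* (w ℤ.* + y) ℤ.- + 1)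
        ≡⟨ cong₂ (λ f t → w ℤ.* w ℤ.* f ℤ.- + 6 ℤ.* (t ℤ.* t ℤ.- + 1)) lifted inv ⟩
      w ℤ.* w ℤ.* (+ m ℤ.* + p) ℤ.- + 6 ℤ.* ((+ 1 ℤ.+ k ℤ.* + p) ℤ.* (+ 1 ℤ.+ k ℤ.* + p) ℤ.- + 1)
        ≡⟨ collect w (+ m) (+ p) k ⟩
      (w ℤ.* w ℤ.* + m ℤ.- + 6 ℤ.* (k ℤ.* (+ 2 ℤ.+ k ℤ.* + p))) ℤ.* + p ∎))) (proj₂ χ)
    where
    open ≡-Reasoning
    complete : ∀ x w y → (x ℤ.* w) ℤ.* (x ℤ.* w) ℤ.- - (+ 6) ≡
      w ℤ.* w ℤ.* (x ℤ.* x ℤ.* + 1 ℤ.+ y ℤ.* y ℤ.* + 6) ℤ.- + 6 ℤ.* ((w ℤ.* y) ℤ.* (w ℤ.* y) ℤ.- + 1)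
    complete = solve-∀
    collect : ∀ w m p k → w ℤ.* w ℤ.* (m ℤ.* p) ℤ.- + 6 ℤ.* ((+ 1 ℤ.+ k ℤ.* p) ℤ.* (+ 1 ℤ.+ k ℤ.* p) ℤ.- + 1)
      ≡ (w ℤ.* w ℤ.* m ℤ.- + 6 ℤ.* (k ℤ.* (+ 2 ℤ.+ k ℤ.* p))) ℤ.* p
    collect = solve-∀
    monomial : ∀ x c → + (x * x * c) ≡ + x ℤ.* + x ℤ.* + c
    monomial x c = trans (ℤ.pos-* (x * x) c) (cong (ℤ._* + c) (ℤ.pos-* x x))
    lifted : + x ℤ.* + x ℤ.* + 1 ℤ.+ + y ℤ.* + y ℤ.* + 6 ≡ + m ℤ.* + p
    lifted = trans (sym (trans (ℤ.pos-+ (x * x * 1) (y * y * 6)) (cong₂ ℤ._+_ (monomial x 1) (monomial y 6))))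
      (trans (cong +_ form≡) (ℤ.pos-* m p))

  ∣form⇒∣first : ∀ x y → p ℕ.∣ x * x * 1 + y * y * 6 → p ℕ.∣ x
  ∣form⇒∣first x y p∣form = [ id , id ]′ (euclidsLemma x x pp (subst (p ℕ.∣_) (ℕ.*-identityʳ (x * x))
    (ℕ.∣m+n∣m⇒∣n (subst (p ℕ.∣_) (ℕ.+-comm (x * x * 1) (y * y * 6)) p∣form)
      (ℕ.∣m⇒∣m*n 6 (ℕ.∣m⇒∣m*n y (∣form⇒∣second x y p∣form))))))

  instance
    p-nonZero : NonZero p
    p-nonZero = prime⇒nonZero pp

  -- Descent: p divides both x and y, so p² can be cancelled from the equation, lowering α by one.
  -- At α = 0 the cancellation leaves p dividing M.
  odd-power-not-of-form : ∀ α M → ¬ p ℕ.∣ M → NotOfForm 1 6 ((p * p) ^ α * (p * M))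
  odd-power-not-of-form α M p∤M .NotOfForm.refute x y N≡ with
    ∣form⇒∣first x y p∣form | ∣form⇒∣second x y p∣form
    where
    p∣form : p ℕ.∣ x * x * 1 + y * y * 6
    p∣form = subst (p ℕ.∣_) N≡ (ℕ.∣n⇒∣m*n ((p * p) ^ α) (ℕ.m∣m*n M))
  ... | ℕ.divides x′ refl | ℕ.divides y′ refl = descend α N≡
    where
    form′ = x′ * x′ * 1 + y′ * y′ * 6
    scale : ∀ x y p → (x * p) * (x * p) * 1 + (y * p) * (y * p) * 6 ≡ p * p * (x * x * 1 + y * y * 6)
    scale = ℕ-solve-∀
    descend : ∀ α → (p * p) ^ α * (p * M) ≡ (x′ * p) * (x′ * p) * 1 + (y′ * p) * (y′ * p) * 6 → ⊥
    descend zero eq = p∤M (ℕ.divides form′ (ℕ.*-cancelˡ-≡ M (form′ * p) p (begin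
      p * M                     ≡⟨ ℕ.*-identityˡ (p * M) ⟨
      1 * (p * M)               ≡⟨ trans eq (scale x′ y′ p) ⟩
      p * p * form′             ≡⟨ trans (ℕ.*-assoc p p form′) (cong (p *_) (ℕ.*-comm p form′)) ⟩
      p * (form′ * p)           ∎)))
      where open ≡-Reasoning
    descend (suc α) eq = NotOfForm.refute (odd-power-not-of-form α M p∤M) x′ y′
      (ℕ.*-cancelˡ-≡ _ form′ (p * p) {{ℕ.m*n≢0 p p}}
        (trans (sym (ℕ.*-assoc (p * p) ((p * p) ^ α) (p * M))) (trans eq (scale x′ y′ p))))

cancel-smaller : ∀ {p} → Prime p → ∀ c .{{_ : NonZero c}} {k} → c ℕ.< p → p ℕ.∣ c * k → p ℕ.∣ k
cancel-smaller pp c {k} c<p p∣ck with euclidsLemma c k pp p∣ck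
... | inj₁ p∣c = contradiction c<p (ℕ.≤⇒≯ (ℕ.∣⇒≤ p∣c))
... | inj₂ p∣k = p∣k

unit-square-mod-24 : ∀ (i : Fin 24) → (2 ℕ.∣ toℕ i ⊎ 3 ℕ.∣ toℕ i) ⊎ (toℕ i * toℕ i) ℕ.% 24 ≡ 1
unit-square-mod-24 = from-yes (Fin.all? (λ (i : Fin 24) →
  (2 ℕ.∣? toℕ i ⊎-dec 3 ℕ.∣? toℕ i) ⊎-dec (toℕ i * toℕ i) ℕ.% 24 ℕ.≟ 1))

-- A prime p ≥ 5 is a unit modulo 24, and every unit modulo 24 squares to 1.
prime-square-mod-24 : ∀ {p} → Prime p → 5 ≤ p → (p * p) ℕ.% 24 ≡ 1
prime-square-mod-24 {p} pp 5≤p = residue (subst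
  (λ r → (2 ℕ.∣ r ⊎ 3 ℕ.∣ r) ⊎ (r * r) ℕ.% 24 ≡ 1) (Fin.toℕ-fromℕ< (ℕ.m%n<n p 24))
  (unit-square-mod-24 (Fin.fromℕ< (ℕ.m%n<n p 24))))
  where
  no-small-divisor : ∀ d → d ℕ.< 5 → d ≢ 1 → d ℕ.∣ 24 → ¬ d ℕ.∣ p ℕ.% 24
  no-small-divisor d d<5 d≢1 d∣24 d∣r with prime⇒irreducible pp (ℕ.∣n∣m%n⇒∣m d∣24 d∣r)
  ... | inj₁ d≡1  = d≢1 d≡1
  ... | inj₂ refl = ℕ.≤⇒≯ 5≤p d<5
  residue : (2 ℕ.∣ p ℕ.% 24 ⊎ 3 ℕ.∣ p ℕ.% 24) ⊎ (p ℕ.% 24 * (p ℕ.% 24)) ℕ.% 24 ≡ 1 → (p * p) ℕ.% 24 ≡ 1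
  residue (inj₁ (inj₁ 2∣r)) = contradiction 2∣r
    (no-small-divisor 2 (s≤s (s≤s (s≤s z≤n))) (λ ()) (ℕ.divides 12 refl))
  residue (inj₁ (inj₂ 3∣r)) = contradiction 3∣r
    (no-small-divisor 3 (s≤s (s≤s (s≤s (s≤s z≤n)))) (λ ()) (ℕ.divides 8 refl))
  residue (inj₂ eq) = trans (ℕ.%-distribˡ-* p p 24) eq

1-mod-power : ∀ {M q} .{{_ : NonZero M}} → ∃ (λ t → q ≡ 1 + t * M) → ∀ α → ∃ λ t → q ^ α ≡ 1 + t * M
1-mod-power _ zero = 0 , refl
1-mod-power {M} (t , refl) (suc α) = let s , eq = 1-mod-power {M} (t , refl) α in
  t + s + t * M * s , trans (cong ((1 + t * M) *_) eq) (expanded t s M)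
  where
  expanded : ∀ t s M → (1 + t * M) * (1 + s * M) ≡ 1 + (t + s + t * M * s) * M
  expanded = ℕ-solve-∀

3∧8⇒24 : ∀ {z} → + 3 ∣ₛ z → + 8 ∣ₛ z → + 24 ∣ z
3∧8⇒24 {z} (divides a z≡3a) (divides b z≡8b) = ∣⇒∣ᵤ (divides (+ 3 ℤ.* b ℤ.- a) (begin
  z                                              ≡⟨ split z ⟩
  + 9 ℤ.* z ℤ.- + 8 ℤ.* z                        ≡⟨ cong₂ (λ x y → + 9 ℤ.* x ℤ.- + 8 ℤ.* y) z≡8b z≡3a ⟩
  + 9 ℤ.* (b ℤ.* + 8) ℤ.- + 8 ℤ.* (a ℤ.* + 3)    ≡⟨ collect a b ⟩
  (+ 3 ℤ.* b ℤ.- a) ℤ.* + 24                     ∎))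
  where
  open ≡-Reasoning
  split : ∀ z → z ≡ + 9 ℤ.* z ℤ.- + 8 ℤ.* z
  split = solve-∀
  collect : ∀ a b → + 9 ℤ.* (b ℤ.* + 8) ℤ.- + 8 ℤ.* (a ℤ.* + 3) ≡ (+ 3 ℤ.* b ℤ.- a) ℤ.* + 24
  collect = solve-∀

24∣S3bar : ∀ m → NotOfForm 1 6 (10 + m * 48) → + 24 ∣ S3bar (10 + m * 48)
24∣S3bar m h = 3∧8⇒24
  -- 10 + 48m = 4k + 2 with k = 12m + 2, which is 2 modulo 3.
  (subst (λ N → + 3 ∣ₛ S3bar N) index (3∣S3bar (12 * m + 2) 3∤)) (8∣S3bar-48m+10 m h)
  where
  index : double (suc (double (12 * m + 2))) ≡ 10 + m * 48
  index rewrite double≡+ (12 * m + 2) | double≡+ (suc (12 * m + 2 + (12 * m + 2))) = collect m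
    where
    collect : ∀ m → suc (12 * m + 2 + (12 * m + 2)) + suc (12 * m + 2 + (12 * m + 2)) ≡ 10 + m * 48
    collect = ℕ-solve-∀
  3∤ : ¬ 3 ℕ.∣ 12 * m + 2
  3∤ 3∣ with ℕ.∣⇒≤ (ℕ.∣m+n∣m⇒∣n 3∣ (ℕ.∣m⇒∣m*n m (ℕ.divides {3} {12} 4 refl)))
  ... | s≤s (s≤s ())

theorem4p6 : (p α n i : ℕ) → Prime p → 5 ≤ p → LegendreMinusOne (- (+ 6)) p →
    1 ≤ i → i ≤ p ∸ 1 →
    (+ 24) ∣ S3bar (48 * p ^ (2 * α + 2) * n + 2 * (24 * i + 5 * p) * p ^ (2 * α + 1))
theorem4p6 p α n i pp 5≤p χ 1≤i i≤p-1 =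
  -- N is a multiple of 48 plus 10 p^(2α+2). With p^(2α+2) = 1 + 24t the last term is 10 + 240t = 10
  -- + 48 · 5t, which accounts for the summand 5t of m.
  let t , eq = 1-mod-power {24} (p * p ℕ./ 24 ,
        trans (ℕ.m≡m%n+[m/n]*n (p * p) 24) (cong (_+ p * p ℕ./ 24 * 24) (prime-square-mod-24 pp 5≤p))) (suc α)
      m = p * p * Q * n + i * (p * Q) + 5 * t
      N≡ : N ≡ 10 + m * 48
      N≡ = trans odd-part (trans (split p Q n i) (trans
        (cong (λ z → (p * p * Q * n + i * (p * Q)) * 48 + 10 * z) eq)
        (collect (p * p * Q * n + i * (p * Q)) t)))
  in subst (λ N → + 24 ∣ S3bar N) (sym N≡)
       (24∣S3bar m (subst (NotOfForm 1 6) (trans (sym odd-part) N≡) (odd-power-not-of-form pp χ α M p∤M)))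
  where
  Q = (p * p) ^ α
  M = 48 * p * n + 2 * (24 * i + 5 * p)
  N = 48 * p ^ (2 * α + 2) * n + 2 * (24 * i + 5 * p) * p ^ (2 * α + 1)
  p^2α : p ^ (2 * α) ≡ Q
  p^2α = trans (sym (ℕ.^-*-assoc p 2 α)) (cong (λ s → (p * s) ^ α) (ℕ.*-identityʳ p))
  odd-part : N ≡ Q * (p * M)
  odd-part rewrite ℕ.^-distribˡ-+-* p (2 * α) 2 | ℕ.^-distribˡ-+-* p (2 * α) 1 | p^2α = factor-out Q p n i
    where
    factor-out : ∀ Q p n i → 48 * (Q * (p * (p * 1))) * n + 2 * (24 * i + 5 * p) * (Q * (p * 1))
      ≡ Q * (p * (48 * p * n + 2 * (24 * i + 5 * p)))
    factor-out = ℕ-solve-∀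
  split : ∀ p Q n i → Q * (p * (48 * p * n + 2 * (24 * i + 5 * p)))
    ≡ (p * p * Q * n + i * (p * Q)) * 48 + 10 * (p * p * Q)
  split = ℕ-solve-∀
  collect : ∀ u t → u * 48 + 10 * (1 + t * 24) ≡ 10 + (u + 5 * t) * 48
  collect = ℕ-solve-∀
  i<p : i ℕ.< p
  i<p = ℕ.≤-<-trans i≤p-1 (ℕ.∸-monoʳ-< {p} (s≤s z≤n) (ℕ.≤-trans (s≤s z≤n) 5≤p))
  regroup : ∀ p n i → 48 * p * n + 2 * (24 * i + 5 * p) ≡ p * (48 * n + 10) + 4 * (4 * (3 * i))
  regroup = ℕ-solve-∀
  -- Modulo p, M is 48i. Splitting 48 as 4 · 4 · 3 keeps each factor below p, and 1 ≤ i < p excludes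
  -- i itself.
  p∤M : ¬ p ℕ.∣ M
  p∤M p∣M = ℕ.≤⇒≯ (ℕ.∣⇒≤ {{ℕ.>-nonZero 1≤i}} p∣i) i<p
    where
    p∣48i : p ℕ.∣ 4 * (4 * (3 * i))
    p∣48i = ℕ.∣m+n∣m⇒∣n (subst (p ℕ.∣_) (regroup p n i) p∣M) (ℕ.m∣m*n (48 * n + 10))
    p∣i : p ℕ.∣ i
    p∣i = cancel-smaller pp 3 (ℕ.<-trans ℕ.≤-refl 5≤p)
      (cancel-smaller pp 4 5≤p (cancel-smaller pp 4 5≤p p∣48i))
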